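{- Let $m\ge n\ge 3$. Then \[\operatorname{M}(C_n\,\Box\, C_m)=\operatorname{Z}(C_n\,\Box\, C_m)= \begin{cases} 2n-1 & \text{if $m=n$ and $n$ is odd,}\\ 2n & \text{otherwise.} \end{cases}\]
   Context: All graphs are finite, simple and undirected. $C_k$ is the cycle on $k$ vertices. The Cartesian product $G\,\Box\, H$ has vertex set $V(G)\times V(H)$, with $(g,h)$ adjacent to $(g',h')$ iff either $g=g'$ and $h\sim h'$ in $H$, or $h=h'$ and $g\sim g'$ in $G$. For a graph $G$ on vertex set $\{1,\dots,N\}$, $\mathcal{S}(G)$ is the set of real symmetric $N\times N$ matrices $A=[a_{ij}]$ such that for $i\neq j$, $a_{ij}\neq 0$ iff $\{i,j\}$ is an edge of $G$ (diagonal entries are arbitrary); the maximum nullity is $\operatorname{M}(G)=\max\{\operatorname{null} A: A\in\mathcal{S}(G)\}$. Zero forcing: vertices are colored blue or white; if a blue vertex $u$ has exactly one white neighbor $w$, then $w$ is changed to blue. A zero forcing set is a set $B$ of vertices such that, coloring $B$ blue and all others white, repeated application of this rule colors all vertices blue; $\operatorname{Z}(G)$ is the minimum cardinality of a zero forcing set. -}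

module Defs where

open import Data.Nat as ℕ using (ℕ; zero; suc; _≤_; _∸_; _≡ᵇ_; _%_)
open import Data.Bool using (Bool; true; false; _∨_; _∧_; if_then_else_)
open import Data.Fin as Fin using (Fin; toℕ; remQuot)
open import Data.Fin.Subset using (Subset; _∈_; ∣_∣)
open import Data.Product using (Σ; ∃; _×_; _,_; proj₁; proj₂)
open import Relation.Binary.PropositionalEquality using (_≡_; _≢_)
open import Relation.Nullary using (¬_)
open import Function.Bundles using (_⇔_)
import Data.Sum

record Graph : Set where
  field
    N   : ℕ
    adj : Fin N → Fin N → Bool
open Graph public

succMod : ℕ → ℕ → ℕ
succMod k i = if suc i ≡ᵇ k then 0 else suc i

cycleAdj : (k : ℕ) → Fin k → Fin k → Bool
cycleAdj k i j = (succMod k (toℕ i) ≡ᵇ toℕ j) ∨ (succMod k (toℕ j) ≡ᵇ toℕ i)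

Cycle : ℕ → Graph
Cycle k = record { N = k ; adj = cycleAdj k }

_==ᶠ_ : ∀ {k} → Fin k → Fin k → Bool
i ==ᶠ j = toℕ i ≡ᵇ toℕ j

_□_ : Graph → Graph → Graph
G □ H = record { N = N G ℕ.* N H ; adj = a }
  where
  a : Fin (N G ℕ.* N H) → Fin (N G ℕ.* N H) → Bool
  a x y with remQuot (N H) x | remQuot (N H) y
  ... | (g , h) | (g′ , h′) =
    ((g ==ᶠ g′) ∧ adj H h h′) ∨ ((h ==ᶠ h′) ∧ adj G g g′)

module _ (G : Graph) (B : Subset (N G)) where
  -- Blue v : v is coloured blue by repeatedly applying the colour-change
  -- rule starting from B (least set containing B closed under forcing).
  data Blue : Fin (N G) → Set where
    initial : ∀ {v} → v ∈ B → Blue v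
    force   : ∀ {u w} → Blue u → adj G u w ≡ true →
              (∀ w′ → adj G u w′ ≡ true → w′ ≢ w → Blue w′) → Blue w

IsZeroForcingSet : (G : Graph) → Subset (N G) → Set
IsZeroForcingSet G B = ∀ v → Blue G B v

ZeroForcingNumber : Graph → ℕ → Set
ZeroForcingNumber G k =
  (Σ (Subset (N G)) λ B → ∣ B ∣ ≡ k × IsZeroForcingSet G B) ×
  (∀ B → IsZeroForcingSet G B → k ≤ ∣ B ∣)

-- The real numbers: a Dedekind-complete ordered field (unique up to
-- isomorphism, so any such structure is ℝ).

record RealField : Set₁ where
  infixl 6 _+_
  infixl 7 _*_
  infix 4 _≤ᵣ_
  field
    ℝ    : Set
    0# 1# : ℝ
    _+_ _*_ : ℝ → ℝ → ℝ
    -_   : ℝ → ℝ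
    inv  : (x : ℝ) → x ≢ 0# → ℝ
    _≤ᵣ_ : ℝ → ℝ → Set
    +-assoc : ∀ x y z → (x + y) + z ≡ x + (y + z)
    +-comm  : ∀ x y → x + y ≡ y + x
    +-identityˡ : ∀ x → 0# + x ≡ x
    -‿inverseˡ : ∀ x → (- x) + x ≡ 0#
    *-assoc : ∀ x y z → (x * y) * z ≡ x * (y * z)
    *-comm  : ∀ x y → x * y ≡ y * x
    *-identityˡ : ∀ x → 1# * x ≡ x
    distribˡ : ∀ x y z → x * (y + z) ≡ (x * y) + (x * z)
    inv-inverse : ∀ x (p : x ≢ 0#) → x * inv x p ≡ 1#
    0≢1 : 0# ≢ 1#
    ≤-refl  : ∀ x → x ≤ᵣ x
    ≤-trans : ∀ {x y z} → x ≤ᵣ y → y ≤ᵣ z → x ≤ᵣ z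
    ≤-antisym : ∀ {x y} → x ≤ᵣ y → y ≤ᵣ x → x ≡ y
    ≤-total : ∀ x y → (x ≤ᵣ y) Data.Sum.⊎ (y ≤ᵣ x)
    +-mono  : ∀ {x y} z → x ≤ᵣ y → x + z ≤ᵣ y + z
    *-nonneg : ∀ {x y} → 0# ≤ᵣ x → 0# ≤ᵣ y → 0# ≤ᵣ x * y
    sup : (P : ℝ → Set) → (∃ P) → (∃ λ b → ∀ x → P x → x ≤ᵣ b) →
          ∃ λ s → (∀ x → P x → x ≤ᵣ s) × (∀ b → (∀ x → P x → x ≤ᵣ b) → s ≤ᵣ b)

module _ (R : RealField) where
  open RealField R

  Σᶠ : ∀ {k} → (Fin k → ℝ) → ℝ
  Σᶠ {zero}  f = 0#
  Σᶠ {suc k} f = f Fin.zero + Σᶠ (λ i → f (Fin.suc i))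

  Matrix : ℕ → Set
  Matrix n = Fin n → Fin n → ℝ

  InS : (G : Graph) → Matrix (N G) → Set
  InS G A = (∀ i j → A i j ≡ A j i) ×
            (∀ i j → i ≢ j → (A i j ≢ 0# ⇔ adj G i j ≡ true))

  NullityAtLeast : ∀ {n} → Matrix n → ℕ → Set
  NullityAtLeast {n} A k =
    Σ (Fin k → Fin n → ℝ) λ v →
      (∀ l i → Σᶠ (λ j → A i j * v l j) ≡ 0#) ×
      (∀ (c : Fin k → ℝ) → (∀ j → Σᶠ (λ l → c l * v l j) ≡ 0#) → ∀ l → c l ≡ 0#)

  MaxNullity : Graph → ℕ → Set
  MaxNullity G k =
    (Σ (Matrix (N G)) λ A → InS G A × NullityAtLeast A k) ×
    (∀ A → InS G A → ¬ NullityAtLeast A (suc k))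

isEqualOdd : ℕ → ℕ → Bool
isEqualOdd n m = (m ≡ᵇ n) ∧ (n % 2 ≡ᵇ 1)

theorem2p6-value : ℕ → ℕ → ℕ
theorem2p6-value n m = if isEqualOdd n m then 2 ℕ.* n ∸ 1 else 2 ℕ.* n

{-# OPTIONS --safe #-}
-- A null vector of A ∈ S(G) that vanishes on a zero forcing set is zero, so the
-- nullity of A is at most the size of any zero forcing set.  Two adjacent columns of
-- the torus force everything, and for n = m odd one of their vertices can be left out.
--
-- For the lower bound, let S u = x D u and S′ u′ = x D′ u′ where S, S′ are matrices of
-- the cycles C_n, C_m and D, D′ are invertible diagonal matrices.  Then u ⊗ u′ is a null
-- vector of S ⊗ D′ − D ⊗ S′, which is a matrix of the torus.  It therefore suffices to
-- find on every cycle a symmetric pencil with the eigenvalues 0, 0, 2, 2, 4, 4, ….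
-- Deleting one vertex of C_m leaves a path, hence a Jacobi matrix, which comes from the
-- orthogonal polynomials of a weight on 0, …, m − 2.  Binomial weights on the even nodes
-- make the eigenvectors of the path for even eigenvalues extend by zero to the cycle.
-- The weights on the odd nodes are then chosen (by solving quadratic equations) so that
-- the Schur complement of the path in the pencil is − a ∏ (x − 2i) / ∏ (x − (2i + 1)),
-- which vanishes at the even nodes; this gives the second eigenvectors.
module Submission where

open import Defs
open import Algebra.Bundles using (CommutativeRing)
import Algebra.Properties.AbelianGroup
import Algebra.Properties.Ring
import Algebra.Properties.Semiring.Mult.TCOptimised
import Algebra.Solver.Ring
open import Algebra.Solver.Ring.AlmostCommutativeRing using (fromCommutativeRing; _-Raw-AlmostCommutative⟶_)
open import Algebra.Structures using (IsCommutativeRing)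
open import Data.Bool using (Bool; true; false; _∨_; _∧_)
import Data.Bool.Properties as BoolP
open import Data.Empty using (⊥; ⊥-elim)
open import Data.Fin as Fin using (Fin; toℕ; fromℕ<; remQuot; combine; punchIn; punchOut; _↑ˡ_; _↑ʳ_)
import Data.Fin.Properties as FinP
open import Data.Fin.Subset using (Subset; _∈_; ∣_∣; inside; outside) renaming (⊥ to ∅)
import Data.Fin.Subset.Properties as SubsetP
open import Data.Integer as ℤ using (ℤ; -[1+_]; _⊖_)
import Data.Integer.Properties as ℤP
import Data.Maybe
open import Data.Nat as ℕ using (ℕ; zero; suc; z≤n; s≤s; _≤_; _≡ᵇ_; _%_; _∸_; ⌊_/2⌋)
import Data.Nat.Properties as ℕP
open import Data.Product using (Σ; ∃; _×_; _,_; proj₁; proj₂)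
open import Data.Sum using (_⊎_; inj₁; inj₂; [_,_]′)
open import Data.Unit using (⊤; tt)
open import Data.Vec using ([]; _∷_; here; there)
import Data.Vec.Properties as VecP
open import Function using (_∘_)
open import Function.Bundles using (Equivalence; mk⇔)
open import Level using (0ℓ)
open import Relation.Binary.Definitions using (tri<; tri≈; tri>)
open import Relation.Binary.PropositionalEquality
open import Relation.Nullary using (¬_; Dec; yes; no)
open import Relation.Nullary.Decidable using (¬?; dec⇒maybe; decidable-stable)

-- Why the formula has two cases: each of the n eigenvectors of C_n is paired with the two of C_m
-- for the same eigenvalue, which gives 2n null vectors; for n = m odd the top eigenvalue n - 1 is
-- simple on both cycles, so one pair is lost. All cycles must share one list of eigenvalues, and
-- the diagonal matrices give the freedom for that. Why the nodes are consecutive integers: by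
-- interlacing, deleting a vertex keeps each double eigenvalue 2i once and leaves one eigenvalue
-- between neighbouring ones, here placed at 2i + 1. Why binomials: on the nodes 0, ..., M the last
-- orthogonal polynomial p satisfies w(l) p(l) ~ (-1)^l C(M, l) for every weight w. Taking w(l) =
-- C(M, l) at even l makes p constant there, so one suitable weight on the closing edge cancels the
-- contribution of the other edge at the deleted vertex, for all even nodes at once. The odd weights
-- stay free. Prescribing the residues of the Schur complement gives, with w(l) = θ C(M, l), the
-- equations (1 + θ)² = Y θ. They have positive roots only for Y ≥ 4, which a large scale factor a
-- ensures; here alone square roots are needed.

module ZeroForcing where
  open import Data.Nat using (_+_; _*_; _<_)
  open import Data.Nat.Properties using (≤-trans; ≤-refl; n≤1+n; m≤m+n; +-mono-≤; +-suc)
  open import Data.Vec using (Vec; lookup; concat; replicate; _++_)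

  -- Adjacency in cycles and on the torus

  ≡ᵇ-true⇒≡ : ∀ a b → (a ≡ᵇ b) ≡ true → a ≡ b
  ≡ᵇ-true⇒≡ a b e = ℕP.≡ᵇ⇒≡ a b (Equivalence.from BoolP.T-≡ e)

  ≡⇒≡ᵇ-true : ∀ {a b} → a ≡ b → (a ≡ᵇ b) ≡ true
  ≡⇒≡ᵇ-true {a} {b} e = Equivalence.to BoolP.T-≡ (ℕP.≡⇒≡ᵇ a b e)

  ∨-true : ∀ a {b} → a ∨ b ≡ true → a ≡ true ⊎ b ≡ true
  ∨-true true _ = inj₁ refl
  ∨-true false e = inj₂ e

  ∧-true : ∀ a {b} → a ∧ b ≡ true → a ≡ true × b ≡ true
  ∧-true true e = refl , e

  succMod-cases : ∀ k i → (suc i ≡ k × succMod k i ≡ 0) ⊎ (suc i ≢ k × succMod k i ≡ suc i)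
  succMod-cases k i with suc i ≡ᵇ k in e
  ... | true = inj₁ (≡ᵇ-true⇒≡ (suc i) k e , refl)
  ... | false = inj₂ ((λ p → case (trans (sym e) (≡⇒≡ᵇ-true p))) , refl)
    where
    case : false ≡ true → ⊥
    case ()

  succMod-last : ∀ {k i} → suc i ≡ k → succMod k i ≡ 0
  succMod-last {k} {i} e with succMod-cases k i
  ... | inj₁ (_ , p) = p
  ... | inj₂ (q , _) = ⊥-elim (q e)

  succMod-< : ∀ {k i} → suc i < k → succMod k i ≡ suc i
  succMod-< {k} {i} lt with succMod-cases k i
  ... | inj₁ (q , _) = ⊥-elim (ℕP.<⇒≢ lt q)
  ... | inj₂ (_ , p) = p

  succMod≡suc : ∀ {k i j} → succMod k j ≡ suc i → j ≡ i
  succMod≡suc {k} {i} {j} e with succMod-cases k j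
  ... | inj₁ (_ , p) = ⊥-elim (ℕP.0≢1+n (trans (sym p) e))
  ... | inj₂ (_ , p) = ℕP.suc-injective (trans (sym p) e)

  succMod≡0 : ∀ {k j} → succMod k j ≡ 0 → suc j ≡ k
  succMod≡0 {k} {j} e with succMod-cases k j
  ... | inj₁ (p , _) = p
  ... | inj₂ (_ , p) = ⊥-elim (ℕP.0≢1+n (trans (sym e) p))

  CycleNeighbour : ℕ → ℕ → ℕ → Set
  CycleNeighbour k i j = succMod k i ≡ j ⊎ succMod k j ≡ i

  cycleAdj⇒neighbour : ∀ {k} (i j : Fin k) → cycleAdj k i j ≡ true → CycleNeighbour k (toℕ i) (toℕ j)
  cycleAdj⇒neighbour {k} i j e with ∨-true (succMod k (toℕ i) ≡ᵇ toℕ j) e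
  ... | inj₁ p = inj₁ (≡ᵇ-true⇒≡ _ _ p)
  ... | inj₂ p = inj₂ (≡ᵇ-true⇒≡ _ _ p)

  neighbour⇒cycleAdj : ∀ {k} (i j : Fin k) → CycleNeighbour k (toℕ i) (toℕ j) → cycleAdj k i j ≡ true
  neighbour⇒cycleAdj {k} i j (inj₁ p) = cong (_∨ (succMod k (toℕ j) ≡ᵇ toℕ i)) (≡⇒≡ᵇ-true p)
  neighbour⇒cycleAdj {k} i j (inj₂ p) =
    trans (cong ((succMod k (toℕ i) ≡ᵇ toℕ j) ∨_) (≡⇒≡ᵇ-true p)) (BoolP.∨-zeroʳ _)

  module _ {n m : ℕ} where
    row : Fin (n * m) → ℕ
    row x = toℕ (proj₁ (remQuot {n} m x))

    col : Fin (n * m) → ℕ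
    col x = toℕ (proj₂ (remQuot {n} m x))

    row-combine : ∀ (g : Fin n) (h : Fin m) → row (combine g h) ≡ toℕ g
    row-combine g h = cong (toℕ ∘ proj₁) (FinP.remQuot-combine g h)

    col-combine : ∀ (g : Fin n) (h : Fin m) → col (combine g h) ≡ toℕ h
    col-combine g h = cong (toℕ ∘ proj₂) (FinP.remQuot-combine {n} g h)

    row-col-injective : ∀ {x y} → row x ≡ row y → col x ≡ col y → x ≡ y
    row-col-injective {x} {y} p q = trans (sym (FinP.combine-remQuot {n} m x))
      (trans (cong₂ combine (FinP.toℕ-injective p) (FinP.toℕ-injective q)) (FinP.combine-remQuot {n} m y))

  TorusNeighbour : (n m g h g′ h′ : ℕ) → Set
  TorusNeighbour n m g h g′ h′ = (g ≡ g′ × CycleNeighbour m h h′) ⊎ (h ≡ h′ × CycleNeighbour n g g′)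

  module _ {n m : ℕ} (g : Fin n) (h : Fin m) (g′ : Fin n) (h′ : Fin m) where
    torusAdj : Bool
    torusAdj = ((g ==ᶠ g′) ∧ cycleAdj m h h′) ∨ ((h ==ᶠ h′) ∧ cycleAdj n g g′)

    to-neighbour : torusAdj ≡ true → TorusNeighbour n m (toℕ g) (toℕ h) (toℕ g′) (toℕ h′)
    to-neighbour e with ∨-true ((g ==ᶠ g′) ∧ cycleAdj m h h′) e
    ... | inj₁ p = let a , b = ∧-true (g ==ᶠ g′) p in inj₁ (≡ᵇ-true⇒≡ _ _ a , cycleAdj⇒neighbour h h′ b)
    ... | inj₂ p = let a , b = ∧-true (h ==ᶠ h′) p in inj₂ (≡ᵇ-true⇒≡ _ _ a , cycleAdj⇒neighbour g g′ b)

    from-neighbour : TorusNeighbour n m (toℕ g) (toℕ h) (toℕ g′) (toℕ h′) → torusAdj ≡ true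
    from-neighbour (inj₁ (p , q)) =
      cong₂ (λ a b → (a ∧ b) ∨ ((h ==ᶠ h′) ∧ cycleAdj n g g′)) (≡⇒≡ᵇ-true p) (neighbour⇒cycleAdj h h′ q)
    from-neighbour (inj₂ (p , q)) = trans
      (cong₂ (λ a b → ((g ==ᶠ g′) ∧ cycleAdj m h h′) ∨ (a ∧ b)) (≡⇒≡ᵇ-true p) (neighbour⇒cycleAdj g g′ q))
      (BoolP.∨-zeroʳ ((g ==ᶠ g′) ∧ cycleAdj m h h′))

  torusAdj⇒neighbour : ∀ {n m} x y → adj (Cycle n □ Cycle m) x y ≡ true →
    TorusNeighbour n m (row {n} x) (col {n} x) (row {n} y) (col {n} y)
  torusAdj⇒neighbour {n} {m} x y =
    to-neighbour (proj₁ (remQuot {n} m x)) (proj₂ (remQuot {n} m x)) (proj₁ (remQuot {n} m y)) (proj₂ (remQuot {n} m y))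

  neighbour⇒torusAdj : ∀ {n m} x y →
    TorusNeighbour n m (row {n} x) (col {n} x) (row {n} y) (col {n} y) → adj (Cycle n □ Cycle m) x y ≡ true
  neighbour⇒torusAdj {n} {m} x y =
    from-neighbour (proj₁ (remQuot {n} m x)) (proj₂ (remQuot {n} m x)) (proj₁ (remQuot {n} m y)) (proj₂ (remQuot {n} m y))

  -- The colour-change rule in coordinates

  module Forcing (n m : ℕ) (B : Subset (n * m)) where
    -- Vacuous when (g , h) is out of range.
    BlueAt : ℕ → ℕ → Set
    BlueAt g h = ∀ x → row {n} x ≡ g → col {n} x ≡ h → Blue (Cycle n □ Cycle m) B x

    force-at : ∀ {g h g₁ h₁} → g < n → h < m → BlueAt g h → TorusNeighbour n m g h g₁ h₁ →
      (∀ g′ h′ → TorusNeighbour n m g h g′ h′ → ¬ (g′ ≡ g₁ × h′ ≡ h₁) → BlueAt g′ h′) → BlueAt g₁ h₁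
    force-at {g} {h} {g₁} {h₁} g<n h<m blue nb others w rw cw =
      force {u = u} (blue u ru cu)
        (neighbour⇒torusAdj {n} u w (subst₂ (λ a b → TorusNeighbour n m (row {n} u) (col {n} u) a b) (sym rw) (sym cw)
          (subst₂ (λ a b → TorusNeighbour n m a b g₁ h₁) (sym ru) (sym cu) nb)))
        λ w′ adj′ w′≢w → others (row {n} w′) (col {n} w′)
          (subst₂ (λ a b → TorusNeighbour n m a b (row {n} w′) (col {n} w′)) ru cu (torusAdj⇒neighbour {n} u w′ adj′))
          (λ { (p , q) → w′≢w (row-col-injective {n} (trans p (sym rw)) (trans q (sym cw))) }) w′ refl refl
      where
      u = combine (fromℕ< g<n) (fromℕ< h<m)
      ru : row {n} u ≡ g
      ru = trans (row-combine {n} _ _) (FinP.toℕ-fromℕ< g<n)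
      cu : col {n} u ≡ h
      cu = trans (col-combine {n} _ _) (FinP.toℕ-fromℕ< h<m)

    in-range : ∀ {g h} → (g < n → h < m → BlueAt g h) → BlueAt g h
    in-range f x refl refl = f (FinP.toℕ<n _) (FinP.toℕ<n _) x refl refl

    force-right : ∀ {i j} → suc (suc i) < n → suc (suc j) < m → BlueAt (suc i) (suc j) →
      BlueAt i (suc j) → BlueAt (suc (suc i)) (suc j) → BlueAt (suc i) j → BlueAt (suc i) (suc (suc j))
    force-right {i} {j} i<n j<m at above below before =
      force-at (ℕP.<⇒≤ i<n) (ℕP.<⇒≤ j<m) at (inj₁ (refl , inj₁ (succMod-< j<m)))
        λ { g′ h′ (inj₁ (refl , inj₁ e)) ¬t → ⊥-elim (¬t (refl , trans (sym e) (succMod-< j<m)))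
          ; g′ h′ (inj₁ (refl , inj₂ e)) ¬t → subst (BlueAt (suc i)) (sym (succMod≡suc {m} e)) before
          ; g′ h′ (inj₂ (refl , inj₁ e)) ¬t → subst (λ a → BlueAt a (suc j)) (trans (sym (succMod-< i<n)) e) below
          ; g′ h′ (inj₂ (refl , inj₂ e)) ¬t → subst (λ a → BlueAt a (suc j)) (sym (succMod≡suc {n} e)) above }

    force-left : ∀ {i j} → suc (suc i) < n → suc j < m → BlueAt (suc i) (suc j) →
      BlueAt i (suc j) → BlueAt (suc (suc i)) (suc j) → BlueAt (suc i) (succMod m (suc j)) → BlueAt (suc i) j
    force-left {i} {j} i<n j<m at above below after =
      force-at (ℕP.<⇒≤ i<n) j<m at (inj₁ (refl , inj₂ (succMod-< j<m)))
        λ { g′ h′ (inj₁ (refl , inj₁ e)) ¬t → subst (BlueAt (suc i)) e after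
          ; g′ h′ (inj₁ (refl , inj₂ e)) ¬t → ⊥-elim (¬t (refl , succMod≡suc {m} e))
          ; g′ h′ (inj₂ (refl , inj₁ e)) ¬t → subst (λ a → BlueAt a (suc j)) (trans (sym (succMod-< i<n)) e) below
          ; g′ h′ (inj₂ (refl , inj₂ e)) ¬t → subst (λ a → BlueAt a (suc j)) (sym (succMod≡suc {n} e)) above }

    force-up : ∀ {i j} → suc (suc i) < n → suc (suc j) < m → BlueAt (suc i) (suc j) →
      BlueAt (suc (suc i)) (suc j) → BlueAt (suc i) j → BlueAt (suc i) (suc (suc j)) → BlueAt i (suc j)
    force-up {i} {j} i<n j<m at below before after =
      force-at (ℕP.<⇒≤ i<n) (ℕP.<⇒≤ j<m) at (inj₂ (refl , inj₂ (succMod-< (ℕP.<⇒≤ i<n))))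
        λ { g′ h′ (inj₁ (refl , inj₁ e)) ¬t → subst (BlueAt (suc i)) (trans (sym (succMod-< j<m)) e) after
          ; g′ h′ (inj₁ (refl , inj₂ e)) ¬t → subst (BlueAt (suc i)) (sym (succMod≡suc {m} e)) before
          ; g′ h′ (inj₂ (refl , inj₁ e)) ¬t → subst (λ a → BlueAt a (suc j)) (trans (sym (succMod-< i<n)) e) below
          ; g′ h′ (inj₂ (refl , inj₂ e)) ¬t → ⊥-elim (¬t (succMod≡suc {n} e , refl)) }

    -- The vertical neighbours of a vertex in the later blue column lie in that column and its left
    -- neighbour lies in the earlier one, so only the right neighbour can be white.
    next-column : ∀ {h} → (∀ g → BlueAt g h) → (∀ g → BlueAt g (suc h)) → ∀ g → BlueAt g (suc (suc h))
    next-column {h} before at g = in-range λ g<n h<m →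
      force-at g<n (ℕP.<⇒≤ h<m) (at g) (inj₁ (refl , inj₁ (succMod-< h<m)))
        λ { g′ h′ (inj₁ (refl , inj₁ e)) ¬t → ⊥-elim (¬t (refl , trans (sym e) (succMod-< h<m)))
          ; g′ h′ (inj₁ (refl , inj₂ e)) ¬t → subst (BlueAt g) (sym (succMod≡suc {m} e)) (before g)
          ; g′ h′ (inj₂ (refl , _)) ¬t → at g′ }

    two-columns : (∀ g → BlueAt g 0) → (∀ g → BlueAt g 1) → ∀ h g → BlueAt g h
    two-columns col₀ col₁ zero = col₀
    two-columns col₀ col₁ (suc zero) = col₁
    two-columns col₀ col₁ (suc (suc h)) = next-column (two-columns col₀ col₁ h) (two-columns col₀ col₁ (suc h))

  -- Two adjacent columns without the vertex (0 , 1), for n = m = 2k + 1.  The blue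
  -- region grows to both sides of column 0 as two triangles, which meet in the
  -- columns k and k + 1; from there the diagonal j ↦ (j , j + 1) is forced downwards.
  module OddSquare (k : ℕ) (B : Subset (suc (k + k) * suc (k + k))) where
    n : ℕ
    n = suc (k + k)

    open Forcing n n B

    module _ (col₀ : ∀ g → BlueAt g 0) (col₁ : ∀ g → BlueAt (suc g) 1) where
      i+2<n : ∀ {i j} → suc i + suc (suc j) ≤ n → suc (suc i) < n
      i+2<n {i} {j} p = ≤-trans (s≤s (≤-trans (ℕP.≤-reflexive (ℕP.+-comm 2 i)) (ℕP.+-monoʳ-≤ i (s≤s (s≤s z≤n))))) p

      shift : ∀ {i j} → suc i + suc (suc j) ≤ n → suc (suc i) + suc j ≤ n
      shift {i} {j} = subst (_≤ n) (cong suc (+-suc i (suc j)))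

      shrink : ∀ {i j} → suc i + suc (suc j) ≤ n → suc i + suc j ≤ n
      shrink {i} {j} = ≤-trans (s≤s (ℕP.+-monoʳ-≤ i (n≤1+n (suc j))))

      -- The triangle to the right of column 0: in column j it has the rows from j to n - j. Each
      -- column loses a row at both ends, since a vertex forces sideways only when both its vertical
      -- neighbours are blue. The bounds also keep all rows involved away from the wrap-around.
      right : ∀ j i → j ≤ i → i + j ≤ n → BlueAt i j
      right zero i _ _ = col₀ i
      right (suc zero) (suc i) _ _ = col₁ i
      right (suc (suc j)) (suc i) (s≤s j<i) b = force-right (i+2<n {i} {j} b)
        (≤-trans (s≤s (≤-trans (s≤s j<i) (n≤1+n (suc i)))) (i+2<n {i} {j} b))
        (right (suc j) (suc i) (≤-trans j<i (n≤1+n i)) (shrink {i} {j} b))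
        (right (suc j) i j<i (≤-trans (n≤1+n _) (shrink {i} {j} b)))
        (right (suc j) (suc (suc i)) (≤-trans j<i (≤-trans (n≤1+n i) (n≤1+n (suc i)))) (shift {i} {j} b))
        (right j (suc i) (≤-trans (n≤1+n j) (≤-trans j<i (n≤1+n i)))
          (≤-trans (s≤s (ℕP.+-monoʳ-≤ i (n≤1+n j))) (shrink {i} {j} b)))

      c+1<n : ∀ {c j} → c + suc (suc j) ≡ n → suc c < n
      c+1<n {c} {j} p = subst (suc (suc c) ≤_) (trans (sym (trans (+-suc c (suc j)) (cong suc (+-suc c j)))) p) (s≤s (s≤s (m≤m+n c j)))

      -- The mirror triangle. Column c has distance `suc j` from column 0 around the cycle, which
      -- the equation `c + suc j ≡ n` records without subtraction.
      left : ∀ j i c → c + suc j ≡ n → suc j ≤ i → i + suc j ≤ n → BlueAt i c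
      -- Row 0 is left out: (0 , 0) still has two possibly white neighbours, (0 , 1) and the last
      -- vertex of its row.
      left zero (suc i) c c+1≡n _ b = force-at i<n (s≤s z≤n) (col₀ (suc i)) (inj₁ (refl , inj₂ (succMod-last n≡)))
          λ { g′ h′ (inj₁ (refl , inj₁ e)) ¬t → subst (BlueAt (suc i)) (trans (sym (succMod-< 1<n)) e) (col₁ i)
            ; g′ h′ (inj₁ (refl , inj₂ e)) ¬t → ⊥-elim (¬t (refl , ℕP.suc-injective (trans (succMod≡0 {n} e) (sym n≡))))
            ; g′ h′ (inj₂ (refl , _)) ¬t → col₀ g′ }
        where
        n≡ : suc c ≡ n
        n≡ = trans (ℕP.+-comm 1 c) c+1≡n
        i<n : suc i < n
        i<n = subst (_≤ n) (ℕP.+-comm (suc i) 1) b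
        1<n : 1 < n
        1<n = ≤-trans (s≤s (s≤s z≤n)) i<n
      -- Separate from the general step because the right neighbour of the last column is column 0,
      -- reached by the wrap-around.
      left (suc zero) (suc i) c p (s≤s j<i) b = force-left (i+2<n {i} {0} b) (c+1<n {c} {0} p)
        (left zero (suc i) (suc c) p′ (≤-trans j<i (n≤1+n i)) (shrink {i} {0} b))
        (left zero i (suc c) p′ j<i (≤-trans (n≤1+n _) (shrink {i} {0} b)))
        (left zero (suc (suc i)) (suc c) p′ (≤-trans j<i (≤-trans (n≤1+n i) (n≤1+n (suc i)))) (shift {i} {0} b))
        (subst (BlueAt (suc i)) (sym (succMod-last (trans (ℕP.+-comm 1 (suc c)) p′))) (col₀ (suc i)))
        where
        p′ : suc c + 1 ≡ n
        p′ = trans (sym (+-suc c 1)) p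
      left (suc (suc j)) (suc i) c p (s≤s j<i) b = force-left (i+2<n {i} {suc j} b) (c+1<n {c} {suc j} p)
        (left (suc j) (suc i) (suc c) p′ (≤-trans j<i (n≤1+n i)) (shrink {i} {suc j} b))
        (left (suc j) i (suc c) p′ j<i (≤-trans (n≤1+n _) (shrink {i} {suc j} b)))
        (left (suc j) (suc (suc i)) (suc c) p′ (≤-trans j<i (≤-trans (n≤1+n i) (n≤1+n (suc i)))) (shift {i} {suc j} b))
        (subst (BlueAt (suc i)) (sym (succMod-< (c+1<n {suc c} {j} p′)))
          (left j (suc i) (suc (suc c)) (trans (sym (+-suc (suc c) (suc j))) p′)
            (≤-trans (n≤1+n _) (≤-trans j<i (n≤1+n i))) (shrink {i} {j} (shrink {i} {suc j} b))))
        where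
        p′ : suc c + suc (suc j) ≡ n
        p′ = trans (sym (+-suc c (suc (suc j)))) p

      -- The vertex (j + 1 , j + 1) forces upwards once its right neighbour is blue. That neighbour
      -- is the next diagonal vertex, except when j + 1 = k: then it lies in column k + 1 = n - k
      -- and hence in the left triangle. `d` counts the steps to that point.
      diagonal : ∀ d j → suc j + d ≡ k → BlueAt j (suc j)
      diagonal d j p = force-up j+2<n j+2<n
          (right (suc j) (suc j) ≤-refl (≤-trans (+-mono-≤ j<k j<k) (n≤1+n _)))
          (right (suc j) (suc (suc j)) (n≤1+n _) (s≤s (+-mono-≤ j<k j<k)))
          (right j (suc j) (n≤1+n j) (≤-trans (+-mono-≤ j<k (ℕP.<⇒≤ j<k)) (n≤1+n _)))
          (next d p)
        where
        j<k : suc j ≤ k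
        j<k = subst (suc j ≤_) p (m≤m+n (suc j) d)
        j+2<n : suc (suc j) < n
        j+2<n = s≤s (≤-trans (ℕP.≤-reflexive (ℕP.+-comm 1 (suc j))) (+-mono-≤ j<k (≤-trans (s≤s z≤n) j<k)))
        next : ∀ d → suc j + d ≡ k → BlueAt (suc j) (suc (suc j))
        next zero q = left j (suc j) (suc (suc j)) (cong suc (cong₂ _+_ q′ q′)) ≤-refl
            (≤-trans (+-mono-≤ j<k j<k) (n≤1+n _))
          where
          q′ : suc j ≡ k
          q′ = trans (sym (ℕP.+-identityʳ (suc j))) q
        next (suc d) q = diagonal d (suc j) (trans (sym (+-suc (suc j) d)) q)

      all-blue : 1 ≤ k → ∀ h g → BlueAt g h
      all-blue (s≤s {n = d} _) = two-columns col₀ λ { zero → diagonal d 0 refl ; (suc g) → col₁ g }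

  -- The two zero forcing sets and their sizes

  ∣++∣ : ∀ {a b} (p : Subset a) (q : Subset b) → ∣ p ++ q ∣ ≡ ∣ p ∣ + ∣ q ∣
  ∣++∣ [] q = refl
  ∣++∣ (inside ∷ p) q = cong suc (∣++∣ p q)
  ∣++∣ (outside ∷ p) q = ∣++∣ p q

  ∣concat-replicate∣ : ∀ {a} b (p : Subset a) → ∣ concat (replicate b p) ∣ ≡ b * ∣ p ∣
  ∣concat-replicate∣ zero p = refl
  ∣concat-replicate∣ (suc b) p = trans (∣++∣ p _) (cong (∣ p ∣ +_) (∣concat-replicate∣ b p))

  ∈-concat : ∀ {n m} (rows : Vec (Subset m) n) x →
    lookup (lookup rows (proj₁ (remQuot m x))) (proj₂ (remQuot {n} m x)) ≡ inside → x ∈ concat rows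
  ∈-concat {n} {m} rows x e = VecP.lookup⇒[]= x (concat rows)
    (trans (cong (lookup (concat rows)) (sym (FinP.combine-remQuot {n} m x)))
      (trans (VecP.lookup-concat rows _ _) e))

  firstTwo : ∀ m → Subset (suc (suc m))
  firstTwo m = inside ∷ inside ∷ ∅

  ∣firstTwo∣ : ∀ m → ∣ firstTwo m ∣ ≡ 2
  ∣firstTwo∣ m = cong (suc ∘ suc) (SubsetP.∣⊥∣≡0 m)

  twoColumns : ∀ n m → Subset (n * suc (suc m))
  twoColumns n m = concat (replicate n (firstTwo m))

  ∣twoColumns∣ : ∀ n m → ∣ twoColumns n m ∣ ≡ 2 * n
  ∣twoColumns∣ n m = trans (∣concat-replicate∣ n (firstTwo m)) (trans (cong (n *_) (∣firstTwo∣ m)) (ℕP.*-comm n 2))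

  lookup-firstTwo : ∀ {m} (h : Fin (suc (suc m))) → toℕ h < 2 → lookup (firstTwo m) h ≡ inside
  lookup-firstTwo Fin.zero _ = refl
  lookup-firstTwo (Fin.suc Fin.zero) _ = refl
  lookup-firstTwo (Fin.suc (Fin.suc _)) (s≤s (s≤s ()))

  twoColumns-forcing : ∀ n m → IsZeroForcingSet (Cycle n □ Cycle (suc (suc m))) (twoColumns n m)
  twoColumns-forcing n m v = two-columns (λ g → start (s≤s z≤n)) (λ g → start (s≤s (s≤s z≤n))) _ _ v refl refl
    where
    open Forcing n (suc (suc m)) (twoColumns n m)
    start : ∀ {g h} → h < 2 → BlueAt g h
    start h<2 x refl refl = initial (∈-concat (replicate n (firstTwo m)) x
      (trans (cong (λ r → lookup r (proj₂ (remQuot {n} (suc (suc m)) x)))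
          (VecP.lookup-replicate (proj₁ (remQuot {n} (suc (suc m)) x)) (firstTwo m)))
        (lookup-firstTwo (proj₂ (remQuot {n} (suc (suc m)) x)) h<2)))

  punctured : ∀ n m → Subset (suc n * suc (suc m))
  punctured n m = concat ((inside ∷ outside ∷ ∅) ∷ replicate n (firstTwo m))

  ∣punctured∣ : ∀ n m → ∣ punctured n m ∣ ≡ suc (2 * n)
  ∣punctured∣ n m = trans (∣++∣ (inside ∷ outside ∷ ∅ {m}) (twoColumns n m))
    (cong₂ (λ a b → suc (a + b)) (SubsetP.∣⊥∣≡0 m) (∣twoColumns∣ n m))

  punctured-forcing : ∀ k → let n = suc (suc k + suc k) in
    IsZeroForcingSet (Cycle n □ Cycle n) (punctured (suc k + suc k) (k + suc k))
  punctured-forcing k v = all-blue col₀ col₁ (s≤s z≤n) _ _ v refl refl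
    where
    rows = (inside ∷ outside ∷ ∅) ∷ replicate (suc k + suc k) (firstTwo (k + suc k))
    open OddSquare (suc k) (concat rows)
    open Forcing n n (concat rows)
    lookup-first : ∀ (i : Fin n) (h : Fin n) → toℕ h ≡ 0 → lookup (lookup rows i) h ≡ inside
    lookup-first Fin.zero Fin.zero _ = refl
    lookup-first (Fin.suc i) Fin.zero _ = cong (λ r → lookup r Fin.zero) (VecP.lookup-replicate i _)
    lookup-second : ∀ {g} (i : Fin n) (h : Fin n) → toℕ i ≡ suc g → toℕ h ≡ 1 → lookup (lookup rows i) h ≡ inside
    lookup-second (Fin.suc i) (Fin.suc Fin.zero) _ _ = cong (λ r → lookup r (Fin.suc Fin.zero)) (VecP.lookup-replicate i _)
    col₀ : ∀ g → BlueAt g 0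
    col₀ g x _ c = initial (∈-concat rows x (lookup-first (proj₁ (remQuot n x)) (proj₂ (remQuot {n} n x)) c))
    col₁ : ∀ g → BlueAt (suc g) 1
    col₁ g x r c = initial (∈-concat rows x (lookup-second (proj₁ (remQuot n x)) (proj₂ (remQuot {n} n x)) r c))

open ZeroForcing

-- Parity

Even Odd : ℕ → Set
Even zero = ⊤
Even (suc n) = Odd n
Odd zero = ⊥
Odd (suc n) = Even n

parity : ∀ n → Even n ⊎ Odd n
parity zero = inj₁ tt
parity (suc n) with parity n
... | inj₁ e = inj₂ e
... | inj₂ o = inj₁ o

Even⇒¬Odd : ∀ {n} → Even n → ¬ Odd n
Even⇒¬Odd {suc n} e o = Even⇒¬Odd {n} o e

ev : ℕ → ℕ
ev zero = zero
ev (suc zero) = zero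
ev (suc (suc c)) = suc (suc (ev c))

ev-Even : ∀ c → Even (ev c)
ev-Even zero = tt
ev-Even (suc zero) = tt
ev-Even (suc (suc c)) = ev-Even c

Even⇒ev : ∀ c → Even c → ev c ≡ c
Even⇒ev zero _ = refl
Even⇒ev (suc (suc c)) e = cong (suc ∘ suc) (Even⇒ev c e)

Odd⇒ev : ∀ c → Odd c → suc (ev c) ≡ c
Odd⇒ev (suc zero) _ = refl
Odd⇒ev (suc (suc c)) o = cong (suc ∘ suc) (Odd⇒ev c o)

par : ℕ → ℕ
par zero = 0
par (suc zero) = 1
par (suc (suc l)) = par l

par≤1 : ∀ l → par l ℕ.≤ 1
par≤1 zero = z≤n
par≤1 (suc zero) = s≤s z≤n
par≤1 (suc (suc l)) = par≤1 l

par+2half : ∀ l → par l ℕ.+ 2 ℕ.* ⌊ l /2⌋ ≡ l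
par+2half zero = refl
par+2half (suc zero) = refl
par+2half (suc (suc l)) = trans (cong (par l ℕ.+_) (ℕP.*-suc 2 ⌊ l /2⌋))
  (trans (ℕP.+-suc (par l) _) (cong suc (trans (ℕP.+-suc (par l) _) (cong suc (par+2half l)))))

ev-suc : ∀ x → Even x → ev (suc x) ≡ x
ev-suc zero _ = refl
ev-suc (suc (suc x)) evx = cong (suc ∘ suc) (ev-suc x evx)

ev≤ : ∀ c → ev c ℕ.≤ c
ev≤ zero = z≤n
ev≤ (suc zero) = z≤n
ev≤ (suc (suc c)) = s≤s (s≤s (ev≤ c))

-- The l-th null vector is the tensor product of the eigenvectors ⌊ l /2⌋ of C_n and
-- partner l of C_m, the latter running through the two for the same eigenvalue.
partner : ℕ → ℕ
partner l = par l ℕ.+ ev ⌊ l /2⌋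

ev-partner : ∀ l → ev ⌊ l /2⌋ ≡ ev (partner l)
ev-partner l with par l | par≤1 l
... | zero | _ = sym (Even⇒ev (ev ⌊ l /2⌋) (ev-Even ⌊ l /2⌋))
... | suc zero | _ = sym (ev-suc (ev ⌊ l /2⌋) (ev-Even ⌊ l /2⌋))
... | suc (suc _) | s≤s ()

partner-injective : ∀ l l′ → ⌊ l /2⌋ ≡ ⌊ l′ /2⌋ → partner l ≡ partner l′ → l ≡ l′
partner-injective l l′ p q = trans (sym (par+2half l))
  (trans (cong₂ (λ a b → a ℕ.+ 2 ℕ.* b) par≡ p) (par+2half l′))
  where
  par≡ : par l ≡ par l′
  par≡ = ℕP.+-cancelʳ-≡ (ev ⌊ l /2⌋) (par l) (par l′) (trans q (cong (λ z → par l′ ℕ.+ ev z) (sym p)))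

partner≤ : ∀ l → partner l ℕ.≤ suc ⌊ l /2⌋
partner≤ l = ℕP.+-mono-≤ (par≤1 l) (ev≤ ⌊ l /2⌋)

half< : ∀ {l n} → l ℕ.< 2 ℕ.* n → ⌊ l /2⌋ ℕ.< n
half< {l} {n} l<2n = ℕP.*-cancelˡ-< 2 _ _ (ℕP.≤-<-trans (ℕP.≤-trans (ℕP.m≤n+m _ (par l)) (ℕP.≤-reflexive (par+2half l))) l<2n)

partner<-longer : ∀ {n m l} → n ℕ.< m → l ℕ.< 2 ℕ.* n → partner l ℕ.< m
partner<-longer {l = l} n<m l<2n = ℕP.≤-<-trans (ℕP.≤-trans (partner≤ l) (half< l<2n)) n<m

-- The index `suc (ev c)` could only reach n if n were odd: for n even every eigenvalue of the list
-- is double.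
partner<-even : ∀ {n l} → Even n → l ℕ.< 2 ℕ.* n → partner l ℕ.< n
partner<-even {n} {l} even-n l<2n with par l | par≤1 l
... | zero | _ = ℕP.≤-<-trans (ev≤ ⌊ l /2⌋) (half< l<2n)
... | suc zero | _ = ℕP.≤∧≢⇒< (ℕP.≤-<-trans (ev≤ ⌊ l /2⌋) (half< l<2n))
        (λ e → Even⇒¬Odd {n} even-n (subst Odd e (ev-Even ⌊ l /2⌋)))
... | suc (suc _) | s≤s ()

-- The bound 2n - 1 cannot be raised for odd n: l = 2n - 1 would ask for a second eigenvector to the
-- eigenvalue n - 1, with index n. An odd l below the bound has half less than n - 1.
partner<-odd : ∀ {n l} → l ℕ.< 2 ℕ.* n ∸ 1 → partner l ℕ.< n
partner<-odd {n} {l} l<k with par l | par≤1 l | par+2half l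
... | zero | _ | _ = ℕP.≤-<-trans (ev≤ ⌊ l /2⌋) (half< (ℕP.<-≤-trans l<k (ℕP.m∸n≤m _ 1)))
... | suc zero | _ | e = ℕP.≤-<-trans (s≤s (ev≤ ⌊ l /2⌋)) (ℕP.*-cancelˡ-< 2 _ _ (subst (ℕ._< 2 ℕ.* n) (trans (cong suc (sym e)) (sym (ℕP.*-suc 2 ⌊ l /2⌋))) (shift l<k)))
  where
  shift : ∀ {k} → l ℕ.< k ∸ 1 → suc l ℕ.< k
  shift {suc k} q = s≤s q
... | suc (suc _) | s≤s () | _

Even⇒%2 : ∀ n → Even n → n % 2 ≡ 0
Even⇒%2 zero _ = refl
Even⇒%2 (suc (suc n)) evn = Even⇒%2 n evn

Odd⇒%2 : ∀ n → Odd n → n % 2 ≡ 1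
Odd⇒%2 (suc zero) _ = refl
Odd⇒%2 (suc (suc n)) odn = Odd⇒%2 n odn

odd≥3 : ∀ {n} → Odd n → 3 ℕ.≤ n → ∃ λ k → n ≡ suc (suc k ℕ.+ suc k)
odd≥3 {suc zero} _ (s≤s ())
odd≥3 {suc (suc (suc zero))} _ _ = 0 , refl
odd≥3 {suc (suc (suc (suc (suc n))))} odn _ with odd≥3 {suc (suc (suc n))} odn (s≤s (s≤s (s≤s z≤n)))
... | k , e = suc k , cong (suc ∘ suc) (trans e (cong suc (sym (ℕP.+-suc k (suc k)))))

isEqualOdd-true : ∀ n m → isEqualOdd n m ≡ true → m ≡ n × Odd n
isEqualOdd-true n m e with ∧-true (m ≡ᵇ n) e | parity n
... | p , _ | inj₂ odn = ≡ᵇ-true⇒≡ m n p , odn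
... | _ , q | inj₁ evn = ⊥-elim (ℕP.0≢1+n (trans (sym (Even⇒%2 n evn)) (≡ᵇ-true⇒≡ (n % 2) 1 q)))

isEqualOdd-false : ∀ n m → n ℕ.≤ m → isEqualOdd n m ≡ false → n ℕ.< m ⊎ (m ≡ n × Even n)
isEqualOdd-false n m n≤m e with ℕP.m≤n⇒m<n∨m≡n n≤m | parity n
... | inj₁ n<m | _ = inj₁ n<m
... | inj₂ refl | inj₁ evn = inj₂ (refl , evn)
... | inj₂ refl | inj₂ odn = ⊥-elim (BoolP.not-¬ e (cong₂ _∧_ (≡⇒≡ᵇ-true {n} refl) (≡⇒≡ᵇ-true (Odd⇒%2 n odn))))

module _ (R : RealField) where
  open RealField R
  open ≡-Reasoning

  -- Arithmetic in a Dedekind-complete ordered field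

  infixl 6 _−_
  _−_ : ℝ → ℝ → ℝ
  x − y = x + (- y)

  +-identityʳ : ∀ x → x + 0# ≡ x
  +-identityʳ x = trans (+-comm x 0#) (+-identityˡ x)

  isCommutativeRing : IsCommutativeRing _≡_ _+_ _*_ -_ 0# 1#
  isCommutativeRing = record
    { isRing = record
      { +-isAbelianGroup = record
        { isGroup = record
          { isMonoid = record
            { isSemigroup = record
              { isMagma = record { isEquivalence = isEquivalence ; ∙-cong = cong₂ _+_ }
              ; assoc = +-assoc }
            ; identity = +-identityˡ , +-identityʳ }
          ; inverse = -‿inverseˡ , λ x → trans (+-comm x _) (-‿inverseˡ x)
          ; ⁻¹-cong = cong -_ }
        ; comm = +-comm }
      ; *-cong = cong₂ _*_
      ; *-assoc = *-assoc
      ; *-identity = *-identityˡ , λ x → trans (*-comm x 1#) (*-identityˡ x)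
      ; distrib = distribˡ , λ x y z →
          trans (*-comm (y + z) x) (trans (distribˡ x y z) (cong₂ _+_ (*-comm x y) (*-comm x z)))
      }
    ; *-comm = *-comm }

  commutativeRing : CommutativeRing 0ℓ 0ℓ
  commutativeRing = record { isCommutativeRing = isCommutativeRing }

  module Integers where
    open CommutativeRing commutativeRing using (ring; semiring; +-abelianGroup; -‿inverseʳ)
    open Algebra.Properties.Ring ring using (-‿distribˡ-*; -‿distribʳ-*; -0#≈0#; -‿involutive)
    open Algebra.Properties.AbelianGroup +-abelianGroup using (⁻¹-∙-comm)
    open Algebra.Properties.Semiring.Mult.TCOptimised semiring
      renaming (_×_ to _·_) using (×-homo-+; ×1-homo-*; 1+×)

    ⟦_⟧ᶻ : ℤ → ℝ
    ⟦ ℤ.+ n ⟧ᶻ = n · 1#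
    ⟦ -[1+ n ] ⟧ᶻ = - (suc n · 1#)

    ⟦⊖⟧ᶻ : ∀ a b → ⟦ a ⊖ b ⟧ᶻ ≡ a · 1# − b · 1#
    ⟦⊖⟧ᶻ a zero = sym (trans (cong ((a · 1#) +_) -0#≈0#) (+-identityʳ _))
    ⟦⊖⟧ᶻ zero (suc b) = sym (+-identityˡ _)
    ⟦⊖⟧ᶻ (suc a) (suc b) = begin
      ⟦ suc a ⊖ suc b ⟧ᶻ ≡⟨ cong ⟦_⟧ᶻ (ℤP.[1+m]⊖[1+n]≡m⊖n a b) ⟩
      ⟦ a ⊖ b ⟧ᶻ ≡⟨ ⟦⊖⟧ᶻ a b ⟩
      a · 1# − b · 1# ≡⟨ sym (+-identityˡ _) ⟩
      0# + (a · 1# − b · 1#) ≡⟨ cong (_+ (a · 1# − b · 1#)) (sym (-‿inverseʳ 1#)) ⟩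
      (1# − 1#) + (a · 1# − b · 1#) ≡⟨ +-assoc _ _ _ ⟩
      1# + (- 1# + (a · 1# − b · 1#)) ≡⟨ cong (1# +_) (trans (sym (+-assoc _ _ _)) (trans (cong (λ z → z + - (b · 1#)) (+-comm _ _)) (+-assoc _ _ _))) ⟩
      1# + (a · 1# + (- 1# − b · 1#)) ≡⟨ sym (+-assoc _ _ _) ⟩
      (1# + a · 1#) + (- 1# − b · 1#) ≡⟨ cong₂ _+_ (sym (1+× a 1#)) (trans (⁻¹-∙-comm _ _) (cong -_ (sym (1+× b 1#)))) ⟩
      suc a · 1# − suc b · 1# ∎

    +-homo : ∀ i j → ⟦ i ℤ.+ j ⟧ᶻ ≡ ⟦ i ⟧ᶻ + ⟦ j ⟧ᶻ
    +-homo (ℤ.+ a) (ℤ.+ b) = ×-homo-+ 1# a b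
    +-homo (ℤ.+ a) -[1+ b ] = ⟦⊖⟧ᶻ a (suc b)
    +-homo -[1+ a ] (ℤ.+ b) = trans (⟦⊖⟧ᶻ b (suc a)) (+-comm _ _)
    +-homo -[1+ a ] -[1+ b ] =
      trans (cong (λ k → - (k · 1#)) (sym (cong suc (ℕP.+-suc a b))))
        (trans (cong -_ (×-homo-+ 1# (suc a) (suc b))) (sym (⁻¹-∙-comm _ _)))

    -‿homo : ∀ i → ⟦ ℤ.- i ⟧ᶻ ≡ - ⟦ i ⟧ᶻ
    -‿homo (ℤ.+ zero) = sym -0#≈0#
    -‿homo (ℤ.+ suc n) = refl
    -‿homo -[1+ n ] = sym (-‿involutive _)

    pos-*-homo : ∀ a j → ⟦ ℤ.+ a ℤ.* j ⟧ᶻ ≡ a · 1# * ⟦ j ⟧ᶻ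
    pos-*-homo a (ℤ.+ b) = trans (cong ⟦_⟧ᶻ (sym (ℤP.pos-* a b))) (×1-homo-* a b)
    pos-*-homo a -[1+ b ] = begin
      ⟦ ℤ.+ a ℤ.* -[1+ b ] ⟧ᶻ ≡⟨ cong ⟦_⟧ᶻ (sym (ℤP.neg-distribʳ-* (ℤ.+ a) (ℤ.+ suc b))) ⟩
      ⟦ ℤ.- (ℤ.+ a ℤ.* ℤ.+ suc b) ⟧ᶻ ≡⟨ -‿homo (ℤ.+ a ℤ.* ℤ.+ suc b) ⟩
      - ⟦ ℤ.+ a ℤ.* ℤ.+ suc b ⟧ᶻ ≡⟨ cong -_ (pos-*-homo a (ℤ.+ suc b)) ⟩
      - (a · 1# * suc b · 1#) ≡⟨ -‿distribʳ-* _ _ ⟩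
      a · 1# * - (suc b · 1#) ∎

    *-homo : ∀ i j → ⟦ i ℤ.* j ⟧ᶻ ≡ ⟦ i ⟧ᶻ * ⟦ j ⟧ᶻ
    *-homo (ℤ.+ a) j = pos-*-homo a j
    *-homo -[1+ a ] j = begin
      ⟦ -[1+ a ] ℤ.* j ⟧ᶻ ≡⟨ cong ⟦_⟧ᶻ (sym (ℤP.neg-distribˡ-* (ℤ.+ suc a) j)) ⟩
      ⟦ ℤ.- (ℤ.+ suc a ℤ.* j) ⟧ᶻ ≡⟨ -‿homo (ℤ.+ suc a ℤ.* j) ⟩
      - ⟦ ℤ.+ suc a ℤ.* j ⟧ᶻ ≡⟨ cong -_ (pos-*-homo (suc a) j) ⟩
      - (suc a · 1# * ⟦ j ⟧ᶻ) ≡⟨ -‿distribˡ-* _ _ ⟩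
      - (suc a · 1#) * ⟦ j ⟧ᶻ ∎

    morphism : CommutativeRing.rawRing ℤP.+-*-commutativeRing -Raw-AlmostCommutative⟶ fromCommutativeRing commutativeRing
    morphism = record
      { ⟦_⟧ = ⟦_⟧ᶻ ; +-homo = +-homo ; *-homo = *-homo ; -‿homo = -‿homo ; 0-homo = refl ; 1-homo = refl }

    open Algebra.Solver.Ring (CommutativeRing.rawRing ℤP.+-*-commutativeRing)
      (fromCommutativeRing commutativeRing) morphism
      (λ i j → Data.Maybe.map (cong ⟦_⟧ᶻ) (dec⇒maybe (i ℤ.≟ j))) public
      using (Polynomial; solve; _:=_; _:+_; _:*_; :-_; _:-_; con)

    κ : ∀ {k} → ℕ → Polynomial k
    κ n = con (ℤ.+ n)

  open Integers public using (solve; _:=_; _:+_; _:*_; :-_; _:-_; κ)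

  +-congˡ : ∀ {x y z} → y ≡ z → x + y ≡ x + z
  +-congˡ refl = refl

  zeroˡ : ∀ x → 0# * x ≡ 0#
  zeroˡ = solve 1 (λ x → κ 0 :* x := κ 0) refl

  zeroʳ : ∀ x → x * 0# ≡ 0#
  zeroʳ = solve 1 (λ x → x :* κ 0 := κ 0) refl

  -‿inverseʳ : ∀ x → x − x ≡ 0#
  -‿inverseʳ = solve 1 (λ x → x :- x := κ 0) refl

  −≡0⇒≡ : ∀ {x y} → x − y ≡ 0# → x ≡ y
  −≡0⇒≡ {x} {y} p = begin
    x ≡⟨ solve 2 (λ x y → x := (x :- y) :+ y) refl x y ⟩
    (x − y) + y ≡⟨ cong (_+ y) p ⟩
    0# + y ≡⟨ +-identityˡ y ⟩
    y ∎

  ≤⇒0≤− : ∀ {x y} → x ≤ᵣ y → 0# ≤ᵣ y − x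
  ≤⇒0≤− {x} {y} p = subst (_≤ᵣ y − x) (-‿inverseʳ x) (+-mono (- x) p)

  ≤-by : ∀ {x y} d → 0# ≤ᵣ d → y ≡ x + d → x ≤ᵣ y
  ≤-by {x} d p refl = subst₂ _≤ᵣ_ (+-identityˡ x) (+-comm d x) (+-mono x p)

  +-nonneg : ∀ {x y} → 0# ≤ᵣ x → 0# ≤ᵣ y → 0# ≤ᵣ x + y
  +-nonneg {x} {y} p q = ≤-trans p (≤-by y q refl)

  neg-nonneg : ∀ {x} → x ≤ᵣ 0# → 0# ≤ᵣ - x
  neg-nonneg {x} p = subst (0# ≤ᵣ_) (+-identityˡ (- x)) (≤⇒0≤− p)

  square-nonneg : ∀ x → 0# ≤ᵣ x * x
  square-nonneg x with ≤-total 0# x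
  ... | inj₁ p = *-nonneg p p
  ... | inj₂ p = subst (0# ≤ᵣ_) (solve 1 (λ x → :- x :* :- x := x :* x) refl x)
                   (*-nonneg (neg-nonneg p) (neg-nonneg p))

  0≤1 : 0# ≤ᵣ 1#
  0≤1 = subst (0# ≤ᵣ_) (*-identityˡ 1#) (square-nonneg 1#)

  1≰0 : ¬ (1# ≤ᵣ 0#)
  1≰0 p = 0≢1 (≤-antisym 0≤1 p)

  -- If x is not nonzero then no multiple of x exceeds 1, and the supremum s of
  -- all multiples satisfies s ≤ s − x and s ≤ s + x.
  ≡0-stable : ∀ {x} → ¬ (x ≢ 0#) → x ≡ 0#
  ≡0-stable {x} ¬¬p = ≤-antisym
      (≤-by (- x) (subst (0# ≤ᵣ_) (solve 2 (λ x s → (s :- x) :- s := :- x) refl x s) (≤⇒0≤− (least _ λ y → λ { (z , refl) →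
        ≤-by _ (≤⇒0≤− (upper _ (z + 1# , refl))) (solve 3 (λ x z s → s :- x := x :* z :+ (s :- x :* (z :+ κ 1))) refl x z s) })))
        (sym (-‿inverseʳ x)))
      (subst (0# ≤ᵣ_) (solve 2 (λ x s → (s :+ x) :- s := x) refl x s) (≤⇒0≤− (least _ λ y → λ { (z , refl) →
        ≤-by _ (≤⇒0≤− (upper _ (z − 1# , refl))) (solve 3 (λ x z s → s :+ x := x :* z :+ (s :- x :* (z :- κ 1))) refl x z s) })))
    where
    P : ℝ → Set
    P y = ∃ λ z → y ≡ x * z
    bounded : ∀ y → P y → y ≤ᵣ 1#
    bounded y (z , refl) with ≤-total y 1#
    ... | inj₁ p = p
    ... | inj₂ p = ⊥-elim (¬¬p λ x≡0 → 1≰0 (subst (1# ≤ᵣ_) (trans (cong (_* z) x≡0) (zeroˡ z)) p))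
    supremum = sup P (x * 1# , 1# , refl) (1# , bounded)
    s = proj₁ supremum
    upper = proj₁ (proj₂ supremum)
    least = proj₂ (proj₂ supremum)

  -- The supremum of {0} ∪ {1 | x ≠ 0} is compared with 1/2.
  ≡0-dec : ∀ x → Dec (x ≡ 0#)
  ≡0-dec x = decide (≤-total (s + s) 1#)
    where
    P : ℝ → Set
    P y = (y ≡ 0#) ⊎ (y ≡ 1# × x ≢ 0#)
    bounded : ∀ y → P y → y ≤ᵣ 1#
    bounded y (inj₁ refl) = 0≤1
    bounded y (inj₂ (refl , _)) = ≤-refl 1#
    supremum = sup P (0# , inj₁ refl) (1# , bounded)
    s = proj₁ supremum
    upper = proj₁ (proj₂ supremum)
    least = proj₂ (proj₂ supremum)
    decide : (s + s ≤ᵣ 1#) ⊎ (1# ≤ᵣ s + s) → Dec (x ≡ 0#)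
    decide (inj₁ p) = yes (≡0-stable λ x≢0 → let q = upper 1# (inj₂ (refl , x≢0)) in
      1≰0 (≤-by _ (+-nonneg (≤⇒0≤− p) (+-nonneg (≤⇒0≤− q) (≤⇒0≤− q)))
        (solve 1 (λ s → κ 0 := κ 1 :+ ((κ 1 :- (s :+ s)) :+ ((s :- κ 1) :+ (s :- κ 1)))) refl s)))
    decide (inj₂ p) = no λ x≡0 → let q = least 0# (λ { y (inj₁ refl) → ≤-refl 0# ; y (inj₂ (_ , x≢0)) → ⊥-elim (x≢0 x≡0) }) in
      1≰0 (≤-by _ (+-nonneg (≤⇒0≤− p) (+-nonneg (≤⇒0≤− q) (≤⇒0≤− q)))
        (solve 1 (λ s → κ 0 := κ 1 :+ (((s :+ s) :- κ 1) :+ ((κ 0 :- s) :+ (κ 0 :- s)))) refl s))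

  infix 4 _≟0
  infix 8 _⁻¹

  abstract
    _≟0 : ∀ x → Dec (x ≡ 0#)
    x ≟0 = ≡0-dec x

    -- Total, with value 0 at 0, so that sums over all nodes need no side conditions. In the partial
    -- fractions and in `τ`, at the even points where they are evaluated, a vanishing difference
    -- always comes with a vanishing coefficient.
    _⁻¹ : ℝ → ℝ
    x ⁻¹ with x ≟0
    ... | yes _ = 0#
    ... | no p = inv x p

    ⁻¹-inverseʳ : ∀ {x} → x ≢ 0# → x * x ⁻¹ ≡ 1#
    ⁻¹-inverseʳ {x} p with x ≟0
    ... | yes q = ⊥-elim (p q)
    ... | no q = inv-inverse x q

  *-cancelˡ-≡0 : ∀ {x y} → x ≢ 0# → x * y ≡ 0# → y ≡ 0#
  *-cancelˡ-≡0 {x} {y} p q = begin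
    y ≡⟨ sym (*-identityˡ y) ⟩
    1# * y ≡⟨ cong (_* y) (sym (⁻¹-inverseʳ p)) ⟩
    x * x ⁻¹ * y ≡⟨ solve 3 (λ x i y → x :* i :* y := i :* (x :* y)) refl x (x ⁻¹) y ⟩
    x ⁻¹ * (x * y) ≡⟨ trans (cong (x ⁻¹ *_) q) (zeroʳ _) ⟩
    0# ∎

  *-≢0 : ∀ {x y} → x ≢ 0# → y ≢ 0# → x * y ≢ 0#
  *-≢0 p q r = q (*-cancelˡ-≡0 p r)

  ⁻¹-≢0 : ∀ {x} → x ≢ 0# → x ⁻¹ ≢ 0#
  ⁻¹-≢0 {x} p q = 0≢1 (trans (sym (zeroʳ x)) (trans (cong (x *_) (sym q)) (⁻¹-inverseʳ p)))

  neg-≢0 : ∀ {x} → x ≢ 0# → - x ≢ 0#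
  neg-≢0 {x} p q = p (trans (solve 1 (λ x → x := :- (:- x)) refl x)
    (trans (cong -_ q) (solve 0 (:- κ 0 := κ 0) refl)))

  Pos : ℝ → Set
  Pos x = 0# ≤ᵣ x × x ≢ 0#

  Pos-1 : Pos 1#
  Pos-1 = 0≤1 , λ p → 0≢1 (sym p)

  nonneg+Pos : ∀ {x y} → 0# ≤ᵣ x → Pos y → Pos (x + y)
  nonneg+Pos {x} {y} p (q , r) = +-nonneg p q , λ e →
    r (≤-antisym (≤-by x p (trans (sym e) (+-comm x y))) q)

  Pos-+ : ∀ {x y} → Pos x → Pos y → Pos (x + y)
  Pos-+ (p , _) q = nonneg+Pos p q

  Pos-* : ∀ {x y} → Pos x → Pos y → Pos (x * y)
  Pos-* (p , p′) (q , q′) = *-nonneg p q , *-≢0 p′ q′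

  Pos-⁻¹ : ∀ {x} → Pos x → Pos (x ⁻¹)
  Pos-⁻¹ {x} (p , q) = subst (0# ≤ᵣ_) eq (*-nonneg p (square-nonneg (x ⁻¹))) , ⁻¹-≢0 q
    where
    eq : x * (x ⁻¹ * x ⁻¹) ≡ x ⁻¹
    eq = trans (sym (*-assoc _ _ _)) (trans (cong (_* x ⁻¹) (⁻¹-inverseʳ q)) (*-identityˡ _))

  ¬Pos-neg : ∀ {x} → Pos x → ¬ (0# ≤ᵣ - x)
  ¬Pos-neg {x} (p , q) r = q (≤-antisym (≤-by _ r (solve 1 (λ x → κ 0 := x :+ :- x) refl x)) p)

  -- The root is the supremum of all z ≥ 0 with z² ≤ a. If its square were too small, a slightly
  -- larger z would still qualify; if too big, a slightly smaller number would still be an upper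
  -- bound.
  √ : ∀ {a} → 0# ≤ᵣ a → ∃ λ s → 0# ≤ᵣ s × s * s ≡ a
  √ {a} 0≤a = s , 0≤s , root (s * s − a ≟0) (≤-total (s * s) a)
    where
    P : ℝ → Set
    P z = 0# ≤ᵣ z × z * z ≤ᵣ a
    bounded : ∀ z → P z → z ≤ᵣ a + 1#
    bounded z (0≤z , z²≤a) with ≤-total z (a + 1#)
    ... | inj₁ p = p
    ... | inj₂ p = ⊥-elim (¬Pos-neg
            (nonneg+Pos (+-nonneg (*-nonneg (≤⇒0≤− p) (+-nonneg (+-nonneg 0≤z 0≤a) 0≤1)) (+-nonneg (*-nonneg 0≤a 0≤a) 0≤a)) Pos-1)
            (subst (0# ≤ᵣ_) (solve 2 (λ z a → a :- z :* z :=
               :- ((z :- (a :+ κ 1)) :* (z :+ a :+ κ 1) :+ (a :* a :+ a) :+ κ 1)) refl z a) (≤⇒0≤− z²≤a)))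
    supremum = sup P (0# , ≤-refl 0# , subst (_≤ᵣ a) (sym (zeroˡ 0#)) 0≤a) (a + 1# , bounded)
    s = proj₁ supremum
    upper = proj₁ (proj₂ supremum)
    least = proj₂ (proj₂ supremum)
    0≤s : 0# ≤ᵣ s
    0≤s = upper 0# (≤-refl 0# , subst (_≤ᵣ a) (sym (zeroˡ 0#)) 0≤a)

    too-small : Pos (a − s * s) → ⊥
    too-small δ>0 = ¬Pos-neg ε>0 (subst (0# ≤ᵣ_) (solve 2 (λ s e → s :- (s :+ e) := :- e) refl s ε)
        (≤⇒0≤− (upper (s + ε) (+-nonneg 0≤s (proj₁ ε>0) ,
          ≤-by (δ * ε + ε * (1# − ε)) (+-nonneg (*-nonneg (proj₁ δ>0) (proj₁ ε>0)) (*-nonneg (proj₁ ε>0) 0≤1−ε))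
            (begin
              a ≡⟨ solve 2 (λ a s → a := (a :- s :* s) :+ s :* s) refl a s ⟩
              δ + s * s ≡⟨ cong (_+ s * s) δ≡ ⟩
              D * ε + s * s ≡⟨ solve 3 (λ s e d → (s :+ s :+ κ 1 :+ d) :* e :+ s :* s :=
                   (s :+ e) :* (s :+ e) :+ (d :* e :+ e :* (κ 1 :- e))) refl s ε δ ⟩
              (s + ε) * (s + ε) + (δ * ε + ε * (1# − ε)) ∎)))))
      where
      δ = a − s * s
      D = s + s + 1# + δ
      D>0 : Pos D
      D>0 = nonneg+Pos (+-nonneg (+-nonneg 0≤s 0≤s) 0≤1) δ>0
      -- Chosen so that (2s + 1 + δ) ε = δ and ε ≤ 1. Then a - (s + ε)² = δ ε + ε (1 - ε) is
      -- nonnegative, so s + ε is still in the set.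
      ε = δ * D ⁻¹
      ε>0 : Pos ε
      ε>0 = Pos-* δ>0 (Pos-⁻¹ D>0)
      δ≡ : δ ≡ D * ε
      δ≡ = sym (trans (solve 3 (λ x y z → x :* (y :* z) := (x :* z) :* y) refl D δ (D ⁻¹))
        (trans (cong (_* δ) (⁻¹-inverseʳ (proj₂ D>0))) (*-identityˡ δ)))
      0≤1−ε : 0# ≤ᵣ 1# − ε
      0≤1−ε = subst (0# ≤ᵣ_)
        (trans (solve 3 (λ s d i → (s :+ s :+ κ 1) :* i := (s :+ s :+ κ 1 :+ d) :* i :- d :* i) refl s δ (D ⁻¹))
          (cong (_− ε) (⁻¹-inverseʳ (proj₂ D>0))))
        (*-nonneg (+-nonneg (+-nonneg 0≤s 0≤s) 0≤1) (proj₁ (Pos-⁻¹ D>0)))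

    too-big : Pos (s * s − a) → ⊥
    too-big δ>0 = ¬Pos-neg ε>0 (subst (0# ≤ᵣ_) (solve 2 (λ s e → (s :- e) :- s := :- e) refl s ε)
        (≤⇒0≤− (least (s − ε) bound)))
      where
      δ = s * s − a
      s≢0 : s ≢ 0#
      s≢0 p = ¬Pos-neg δ>0 (subst (0# ≤ᵣ_) (trans (solve 1 (λ a → a := :- (κ 0 :* κ 0 :- a)) refl a)
        (cong (λ z → - (z * z − a)) (sym p))) 0≤a)
      2s>0 : Pos (s + s)
      2s>0 = Pos-+ (0≤s , s≢0) (0≤s , s≢0)
      ε = δ * (s + s) ⁻¹
      ε>0 : Pos ε
      ε>0 = Pos-* δ>0 (Pos-⁻¹ 2s>0)
      δ≡ : (s + s) * ε ≡ δ
      δ≡ = trans (solve 3 (λ x y z → x :* (y :* z) := (x :* z) :* y) refl (s + s) δ ((s + s) ⁻¹))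
        (trans (cong (_* δ) (⁻¹-inverseʳ (proj₂ 2s>0))) (*-identityˡ δ))
      -- s − ε = (s² + a) / 2s
      0≤s−ε : 0# ≤ᵣ s − ε
      0≤s−ε = subst (0# ≤ᵣ_) (begin
        (s * s + a) * (s + s) ⁻¹ ≡⟨ solve 3 (λ s a i → (s :* s :+ a) :* i := s :* ((s :+ s) :* i) :- (s :* s :- a) :* i) refl s a ((s + s) ⁻¹) ⟩
        s * ((s + s) * (s + s) ⁻¹) − ε ≡⟨ cong (λ z → s * z − ε) (⁻¹-inverseʳ (proj₂ 2s>0)) ⟩
        s * 1# − ε ≡⟨ solve 2 (λ s e → s :* κ 1 :- e := s :- e) refl s ε ⟩
        s − ε ∎) (*-nonneg (+-nonneg (square-nonneg s) 0≤a) (proj₁ (Pos-⁻¹ 2s>0)))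
      bound : ∀ z → P z → z ≤ᵣ s − ε
      bound z (0≤z , z²≤a) with ≤-total z (s − ε)
      ... | inj₁ p = p
      ... | inj₂ p = ⊥-elim (¬Pos-neg
          (nonneg+Pos (*-nonneg (≤⇒0≤− p) (+-nonneg 0≤z 0≤s−ε)) (Pos-* ε>0 ε>0))
          (subst (0# ≤ᵣ_) (begin
            a − z * z ≡⟨ solve 3 (λ a s z → a :- z :* z := (s :* s :- z :* z) :- (s :* s :- a)) refl a s z ⟩
            s * s − z * z − δ ≡⟨ cong (s * s − z * z −_) (sym δ≡) ⟩
            s * s − z * z − (s + s) * ε ≡⟨ solve 3 (λ s z e → s :* s :- z :* z :- (s :+ s) :* e :=
                :- ((z :- (s :- e)) :* (z :+ (s :- e)) :+ e :* e)) refl s z ε ⟩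
            - ((z − (s − ε)) * (z + (s − ε)) + ε * ε) ∎) (≤⇒0≤− z²≤a)))

    root : Dec (s * s − a ≡ 0#) → (s * s ≤ᵣ a) ⊎ (a ≤ᵣ s * s) → s * s ≡ a
    root (yes p) _ = −≡0⇒≡ p
    root (no p) (inj₁ q) = ⊥-elim (too-small (≤⇒0≤− q , λ e → p (trans (solve 2 (λ s a → s :* s :- a := :- (a :- s :* s)) refl s a) (trans (cong -_ e) (solve 0 (:- κ 0 := κ 0) refl)))))
    root (no p) (inj₂ q) = ⊥-elim (too-big (≤⇒0≤− q , p))

  -- Finite sums and linear systems

  ι : ℕ → ℝ
  ι zero = 0#
  ι (suc n) = 1# + ι n

  ι-nonneg : ∀ n → 0# ≤ᵣ ι n
  ι-nonneg zero = ≤-refl 0#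
  ι-nonneg (suc n) = +-nonneg 0≤1 (ι-nonneg n)

  ι-suc-Pos : ∀ n → Pos (ι (suc n))
  ι-suc-Pos n = subst Pos (+-comm _ _) (nonneg+Pos (ι-nonneg n) Pos-1)

  ι-<-Pos : ∀ {i j} → i ℕ.< j → Pos (ι j − ι i)
  ι-<-Pos {zero} {suc j} _ = subst Pos (solve 1 (λ x → x := x :- κ 0) refl (ι (suc j))) (ι-suc-Pos j)
  ι-<-Pos {suc i} {suc j} (s≤s p) = subst Pos
    (solve 2 (λ x y → x :- y := (κ 1 :+ x) :- (κ 1 :+ y)) refl (ι j) (ι i)) (ι-<-Pos p)

  ι-≢ : ∀ {i j} → i ≢ j → ι i − ι j ≢ 0#
  ι-≢ {i} {j} p with ℕP.<-cmp i j
  ... | tri< i<j _ _ = λ q → proj₂ (ι-<-Pos i<j)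
          (trans (solve 2 (λ x y → y :- x := :- (x :- y)) refl (ι i) (ι j))
            (trans (cong -_ q) (solve 0 (:- κ 0 := κ 0) refl)))
  ... | tri≈ _ i≡j _ = ⊥-elim (p i≡j)
  ... | tri> _ _ i>j = proj₂ (ι-<-Pos i>j)

  -- Opaque, so that the summand can be inferred from the sum.
  abstract
    ∑ : ∀ {k} → (Fin k → ℝ) → ℝ
    ∑ = Σᶠ R

    ∑-cong : ∀ {k} {f g : Fin k → ℝ} → (∀ i → f i ≡ g i) → ∑ f ≡ ∑ g
    ∑-cong {zero} p = refl
    ∑-cong {suc k} p = cong₂ _+_ (p Fin.zero) (∑-cong (p ∘ Fin.suc))

    ∑-zero : ∀ {k} {f : Fin k → ℝ} → (∀ i → f i ≡ 0#) → ∑ f ≡ 0#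
    ∑-zero {zero} p = refl
    ∑-zero {suc k} p = trans (cong₂ _+_ (p Fin.zero) (∑-zero (p ∘ Fin.suc))) (+-identityˡ 0#)

    ∑-+ : ∀ {k} (f g : Fin k → ℝ) → ∑ (λ i → f i + g i) ≡ ∑ f + ∑ g
    ∑-+ {zero} f g = sym (+-identityˡ 0#)
    ∑-+ {suc k} f g = trans (+-congˡ (∑-+ (f ∘ Fin.suc) (g ∘ Fin.suc)))
      (solve 4 (λ a b c d → (a :+ b) :+ (c :+ d) := (a :+ c) :+ (b :+ d)) refl
        (f Fin.zero) (g Fin.zero) (∑ (f ∘ Fin.suc)) (∑ (g ∘ Fin.suc)))

    ∑-*ˡ : ∀ {k} c (f : Fin k → ℝ) → ∑ (λ i → c * f i) ≡ c * ∑ f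
    ∑-*ˡ {zero} c f = sym (zeroʳ c)
    ∑-*ˡ {suc k} c f = trans (+-congˡ (∑-*ˡ c (f ∘ Fin.suc))) (sym (distribˡ _ _ _))

    ∑-*ʳ : ∀ {k} c (f : Fin k → ℝ) → ∑ (λ i → f i * c) ≡ ∑ f * c
    ∑-*ʳ c f = trans (∑-cong (λ i → *-comm (f i) c)) (trans (∑-*ˡ c f) (*-comm c _))

    ∑-− : ∀ {k} (f g : Fin k → ℝ) → ∑ (λ i → f i − g i) ≡ ∑ f − ∑ g
    ∑-− f g = begin
      ∑ (λ i → f i − g i) ≡⟨ ∑-cong (λ i → solve 2 (λ x y → x :- y := x :+ (:- κ 1) :* y) refl (f i) (g i)) ⟩
      ∑ (λ i → f i + (- 1#) * g i) ≡⟨ ∑-+ f _ ⟩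
      ∑ f + ∑ (λ i → (- 1#) * g i) ≡⟨ cong (∑ f +_) (∑-*ˡ (- 1#) g) ⟩
      ∑ f + (- 1#) * ∑ g ≡⟨ solve 2 (λ x y → x :+ (:- κ 1) :* y := x :- y) refl (∑ f) (∑ g) ⟩
      ∑ f − ∑ g ∎

    ∑-swap : ∀ {k l} (f : Fin k → Fin l → ℝ) → ∑ (λ i → ∑ (λ j → f i j)) ≡ ∑ (λ j → ∑ (λ i → f i j))
    ∑-swap {zero} {l} f = sym (∑-zero {l} (λ _ → refl))
    ∑-swap {suc k} f = trans (+-congˡ (∑-swap (f ∘ Fin.suc))) (sym (∑-+ (f Fin.zero) (λ j → ∑ (λ i → f (Fin.suc i) j))))

    ∑-single : ∀ {k} {f : Fin k → ℝ} i → (∀ j → j ≢ i → f j ≡ 0#) → ∑ f ≡ f i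
    ∑-single Fin.zero p = trans (+-congˡ (∑-zero (λ i → p (Fin.suc i) λ ()))) (+-identityʳ _)
    ∑-single (Fin.suc i) p = trans (cong₂ _+_ (p Fin.zero λ ()) (∑-single i (λ j q → p (Fin.suc j) (q ∘ FinP.suc-injective)))) (+-identityˡ _)

    ∑-nonneg : ∀ {k} {f : Fin k → ℝ} → (∀ i → 0# ≤ᵣ f i) → 0# ≤ᵣ ∑ f
    ∑-nonneg {zero} p = ≤-refl 0#
    ∑-nonneg {suc k} p = +-nonneg (p Fin.zero) (∑-nonneg (p ∘ Fin.suc))

    +-nonneg-≡0 : ∀ {x y} → 0# ≤ᵣ x → 0# ≤ᵣ y → x + y ≡ 0# → x ≡ 0#
    +-nonneg-≡0 {x} {y} p q e = ≤-antisym (≤-by y q (sym e)) p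

    ∑-nonneg-≡0 : ∀ {k} {f : Fin k → ℝ} → (∀ i → 0# ≤ᵣ f i) → ∑ f ≡ 0# → ∀ i → f i ≡ 0#
    ∑-nonneg-≡0 p e Fin.zero = +-nonneg-≡0 (p Fin.zero) (∑-nonneg (p ∘ Fin.suc)) e
    ∑-nonneg-≡0 p e (Fin.suc i) = ∑-nonneg-≡0 (p ∘ Fin.suc)
      (+-nonneg-≡0 (∑-nonneg (p ∘ Fin.suc)) (p Fin.zero) (trans (+-comm _ _) e)) i

    ∑-↑ : ∀ {a b} (f : Fin (a ℕ.+ b) → ℝ) → ∑ f ≡ ∑ (λ i → f (i ↑ˡ b)) + ∑ (λ j → f (a ↑ʳ j))
    ∑-↑ {zero} f = sym (+-identityˡ _)
    ∑-↑ {suc a} f = trans (+-congˡ (∑-↑ {a} (f ∘ Fin.suc))) (sym (+-assoc _ _ _))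

    ∑-combine : ∀ {a b} (f : Fin (a ℕ.* b) → ℝ) → ∑ f ≡ ∑ (λ i → ∑ (λ j → f (combine {a} {b} i j)))
    ∑-combine {zero} f = refl
    ∑-combine {suc a} {b} f = trans (∑-↑ {b} f) (+-congˡ (∑-combine {a} (λ i → f (b ↑ʳ i))))

    ∑-suc : ∀ {k} (f : Fin (suc k) → ℝ) → ∑ f ≡ f Fin.zero + ∑ (f ∘ Fin.suc)
    ∑-suc f = refl

    ∑≡Σᶠ : ∀ {k} (f : Fin k → ℝ) → ∑ f ≡ Σᶠ R f
    ∑≡Σᶠ f = refl

  module Elimination {p q} (A : Fin (suc p) → Fin (suc q) → ℝ) (r : Fin (suc p)) (pivot : A r Fin.zero ≢ 0#) where
    a : ℝ
    a = A r Fin.zero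
    reduced : Fin p → Fin q → ℝ
    reduced i l = A (punchIn r i) (Fin.suc l) − A (punchIn r i) Fin.zero * a ⁻¹ * A r (Fin.suc l)
    module _ (c : Fin q → ℝ) (sat : ∀ i → ∑ (λ l → reduced i l * c l) ≡ 0#) where
      t : ℝ
      t = ∑ (λ l → A r (Fin.suc l) * c l)
      extended : Fin (suc q) → ℝ
      extended Fin.zero = - (a ⁻¹ * t)
      extended (Fin.suc l) = c l

      extended-pivot : ∑ (λ l → A r l * extended l) ≡ 0#
      extended-pivot = begin
        ∑ (λ l → A r l * extended l) ≡⟨ ∑-suc _ ⟩
        a * - (a ⁻¹ * t) + t ≡⟨ solve 3 (λ a b t → a :* :- (b :* t) :+ t := t :- (a :* b) :* t) refl a (a ⁻¹) t ⟩
        t − a * a ⁻¹ * t ≡⟨ cong (λ z → t − z * t) (⁻¹-inverseʳ pivot) ⟩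
        t − 1# * t ≡⟨ solve 1 (λ t → t :- κ 1 :* t := κ 0) refl t ⟩
        0# ∎

      extended-other : ∀ i → ∑ (λ l → A (punchIn r i) l * extended l) ≡ 0#
      extended-other i = begin
        ∑ (λ l → A (punchIn r i) l * extended l) ≡⟨ ∑-suc _ ⟩
        b * - (a ⁻¹ * t) + u ≡⟨ solve 4 (λ b a t u → b :* :- (a :* t) :+ u := u :- b :* a :* t) refl b (a ⁻¹) t u ⟩
        u − b * a ⁻¹ * t ≡⟨ cong (u −_) (sym (∑-*ˡ (b * a ⁻¹) _)) ⟩
        u − ∑ (λ l → b * a ⁻¹ * (A r (Fin.suc l) * c l))
          ≡⟨ sym (∑-− _ _) ⟩
        ∑ (λ l → A (punchIn r i) (Fin.suc l) * c l − b * a ⁻¹ * (A r (Fin.suc l) * c l))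
          ≡⟨ ∑-cong (λ l → solve 4 (λ x y z w → x :* w :- y :* (z :* w) := (x :- y :* z) :* w) refl
               (A (punchIn r i) (Fin.suc l)) (b * a ⁻¹) (A r (Fin.suc l)) (c l)) ⟩
        ∑ (λ l → reduced i l * c l) ≡⟨ sat i ⟩
        0# ∎
        where
        b = A (punchIn r i) Fin.zero
        u = ∑ (λ l → A (punchIn r i) (Fin.suc l) * c l)

      extended-sat : ∀ i → ∑ (λ l → A i l * extended l) ≡ 0#
      extended-sat i with r FinP.≟ i
      ... | yes refl = extended-pivot
      ... | no r≢i = subst (λ i → ∑ (λ l → A i l * extended l) ≡ 0#) (FinP.punchIn-punchOut r≢i) (extended-other (punchOut r≢i))

  NontrivialSolution : ∀ {p q} → (Fin p → Fin q → ℝ) → Set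
  NontrivialSolution {q = q} A = Σ (Fin q → ℝ) λ c → (∃ λ l → c l ≢ 0#) × (∀ i → ∑ (λ l → A i l * c l) ≡ 0#)

  unit : ∀ {q} → Fin (suc q) → ℝ
  unit Fin.zero = 1#
  unit (Fin.suc _) = 0#

  zero-column : ∀ {p q} (A : Fin p → Fin (suc q) → ℝ) → (∀ i → A i Fin.zero ≡ 0#) → NontrivialSolution A
  zero-column A col = unit , (Fin.zero , λ e → 0≢1 (sym e)) , λ i →
    trans (∑-single Fin.zero λ { Fin.zero z → ⊥-elim (z refl) ; (Fin.suc j) _ → zeroʳ _ })
      (trans (cong (_* 1#) (col i)) (zeroˡ 1#))

  underdetermined : ∀ {p q} → p ℕ.< q → (A : Fin p → Fin q → ℝ) → NontrivialSolution A
  underdetermined {zero} {suc q} _ A = zero-column A λ ()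
  underdetermined {suc p} {suc q} (s≤s p<q) A = go (FinP.any? (λ i → ¬? (A i Fin.zero ≟0)))
    where
    go : Dec (∃ λ i → A i Fin.zero ≢ 0#) → NontrivialSolution A
    go (no none) = zero-column A λ i → ≡0-stable λ z → none (i , z)
    go (yes (r , pivot)) =
      let open Elimination A r pivot
          c , (l , cl≢0) , sat = underdetermined p<q reduced
      in extended c sat , (Fin.suc l , cl≢0) , extended-sat c sat

  -- Nullity and zero forcing

  -- When u forces w, row u of the null equation contains only blue vertices besides w, so a single
  -- term survives and its coefficient is nonzero.
  blue-zero : ∀ {G A B} {v : Fin (N G) → ℝ} → InS R G A → (∀ i → Σᶠ R (λ j → A i j * v j) ≡ 0#) →
    (∀ {j} → j ∈ B → v j ≡ 0#) → ∀ {x} → Blue G B x → v x ≡ 0#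
  blue-zero {G} {A} {B} {v} A∈S null zero-on-B = go
    where
    go : ∀ {x} → Blue G B x → v x ≡ 0#
    go (initial x∈B) = zero-on-B x∈B
    go (force {u} {w} bu u~w others) with u FinP.≟ w
    -- A `Graph` may have loops, and diagonal entries are unrestricted; but if u = w then w is
    -- already blue.
    ... | yes refl = go bu
    ... | no u≢w = *-cancelˡ-≡0 (Equivalence.from (proj₂ A∈S u w u≢w) u~w)
                     (trans (sym (∑-single w rest)) (trans (∑≡Σᶠ _) (null u)))
      where
      rest : ∀ j → j ≢ w → A u j * v j ≡ 0#
      rest j j≢w with u FinP.≟ j | adj G u j BoolP.≟ true
      ... | yes refl | _ = trans (cong (A u j *_) (go bu)) (zeroʳ _)
      ... | no _ | yes u~j = trans (cong (A u j *_) (go (others j u~j j≢w))) (zeroʳ _)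
      ... | no u≢j | no u≁j = trans (cong (_* v j) (≡0-stable λ z → u≁j (Equivalence.to (proj₂ A∈S u j u≢j) z))) (zeroˡ _)

  enumerate : ∀ {n} (B : Subset n) → Fin ∣ B ∣ → Fin n
  enumerate (inside ∷ B) Fin.zero = Fin.zero
  enumerate (inside ∷ B) (Fin.suc i) = Fin.suc (enumerate B i)
  enumerate (outside ∷ B) i = Fin.suc (enumerate B i)

  enumerate-surjective : ∀ {n} (B : Subset n) {j} → j ∈ B → ∃ λ i → enumerate B i ≡ j
  enumerate-surjective (inside ∷ B) here = Fin.zero , refl
  enumerate-surjective (inside ∷ B) (there j∈B) = let i , e = enumerate-surjective B j∈B in Fin.suc i , cong Fin.suc e
  enumerate-surjective (outside ∷ B) (there j∈B) = let i , e = enumerate-surjective B j∈B in i , cong Fin.suc e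

  -- With more independent null vectors than vertices in B, some nontrivial combination vanishes on
  -- B. It is then zero everywhere, against independence.
  nullity≤∣zeroForcing∣ : ∀ {G A k} → InS R G A → NullityAtLeast R A k →
    ∀ B → IsZeroForcingSet G B → k ℕ.≤ ∣ B ∣
  nullity≤∣zeroForcing∣ {G} {A} {k} A∈S (v , null , independent) B forcing =
    ℕP.≮⇒≥ λ ∣B∣<k →
      let c , (l , cl≢0) , sat = underdetermined ∣B∣<k (λ i l → v l (enumerate B i))
          combination : Fin (N G) → ℝ
          combination j = ∑ (λ l → c l * v l j)
          on-B : ∀ {j} → j ∈ B → combination j ≡ 0#
          on-B j∈B = let i , e = enumerate-surjective B j∈B in
            subst (λ j → combination j ≡ 0#) e (trans (∑-cong (λ l → *-comm (c l) _)) (sat i))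
          combination-null : ∀ i → Σᶠ R (λ j → A i j * combination j) ≡ 0#
          combination-null i = begin
            Σᶠ R (λ j → A i j * combination j) ≡⟨ sym (∑≡Σᶠ _) ⟩
            ∑ (λ j → A i j * ∑ (λ l → c l * v l j)) ≡⟨ ∑-cong (λ j → sym (∑-*ˡ (A i j) _)) ⟩
            ∑ (λ j → ∑ (λ l → A i j * (c l * v l j))) ≡⟨ ∑-swap _ ⟩
            ∑ (λ l → ∑ (λ j → A i j * (c l * v l j)))
              ≡⟨ ∑-cong (λ l → trans (∑-cong (λ j → solve 3 (λ a c v → a :* (c :* v) := c :* (a :* v)) refl (A i j) (c l) (v l j)))
                   (trans (∑-*ˡ (c l) _) (trans (cong (c l *_) (trans (∑≡Σᶠ _) (null l i))) (zeroʳ _)))) ⟩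
            ∑ (λ (l : Fin k) → 0#) ≡⟨ ∑-zero {k} (λ _ → refl) ⟩
            0# ∎
      in cl≢0 (independent c (λ j → trans (sym (∑≡Σᶠ _)) (blue-zero {v = combination} A∈S combination-null on-B (forcing j))) l)

  -- Sums over ranges and partial fractions

  abstract
    Sum : ℕ → (ℕ → ℝ) → ℝ
    Sum k f = ∑ {k} (f ∘ toℕ)

    Sum≡∑ : ∀ k f → Sum k f ≡ ∑ {k} (f ∘ toℕ)
    Sum≡∑ k f = refl

    Sum-cong : ∀ {k f g} → (∀ i → i ℕ.< k → f i ≡ g i) → Sum k f ≡ Sum k g
    Sum-cong p = ∑-cong (λ i → p (toℕ i) (FinP.toℕ<n i))

    Sum-zero : ∀ {k f} → (∀ i → i ℕ.< k → f i ≡ 0#) → Sum k f ≡ 0#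
    Sum-zero p = ∑-zero (λ i → p (toℕ i) (FinP.toℕ<n i))

    Sum-+ : ∀ {k} f g → Sum k (λ i → f i + g i) ≡ Sum k f + Sum k g
    Sum-+ {k} f g = ∑-+ {k} (f ∘ toℕ) (g ∘ toℕ)

    Sum-− : ∀ {k} f g → Sum k (λ i → f i − g i) ≡ Sum k f − Sum k g
    Sum-− {k} f g = ∑-− {k} (f ∘ toℕ) (g ∘ toℕ)

    Sum-*ˡ : ∀ {k} c f → Sum k (λ i → c * f i) ≡ c * Sum k f
    Sum-*ˡ {k} c f = ∑-*ˡ {k} c (f ∘ toℕ)

    Sum-swap : ∀ {k l} (f : ℕ → ℕ → ℝ) → Sum k (λ i → Sum l (λ j → f i j)) ≡ Sum l (λ j → Sum k (λ i → f i j))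
    Sum-swap {k} {l} f = ∑-swap {k} {l} (λ i j → f (toℕ i) (toℕ j))

    Sum-single : ∀ {k} f i → i ℕ.< k → (∀ j → j ≢ i → f j ≡ 0#) → Sum k f ≡ f i
    Sum-single f i i<k p = trans
      (∑-single (fromℕ< i<k) (λ j j≢i → p (toℕ j) λ e → j≢i (FinP.toℕ-injective (trans e (sym (FinP.toℕ-fromℕ< i<k))))))
      (cong f (FinP.toℕ-fromℕ< i<k))

    Sum-nonneg-≡0 : ∀ {k f} → (∀ i → i ℕ.< k → 0# ≤ᵣ f i) → Sum k f ≡ 0# → ∀ i → i ℕ.< k → f i ≡ 0#
    Sum-nonneg-≡0 {k} {f} p e i i<k = subst (λ i → f i ≡ 0#) (FinP.toℕ-fromℕ< i<k)
      (∑-nonneg-≡0 (λ i → p (toℕ i) (FinP.toℕ<n i)) e (fromℕ< i<k))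

    Sum-nonneg : ∀ {k f} → (∀ i → i ℕ.< k → 0# ≤ᵣ f i) → 0# ≤ᵣ Sum k f
    Sum-nonneg p = ∑-nonneg (λ i → p (toℕ i) (FinP.toℕ<n i))

    Sum-suc : ∀ k f → Sum (suc k) f ≡ f 0 + Sum k (f ∘ suc)
    Sum-suc k f = ∑-suc {k} (f ∘ toℕ)

  Sum-0 : ∀ f → Sum 0 f ≡ 0#
  Sum-0 f = Sum-zero λ _ ()

  Sum-last : ∀ k f → Sum (suc k) f ≡ Sum k f + f k
  Sum-last zero f = begin
    Sum 1 f ≡⟨ Sum-suc 0 f ⟩
    f 0 + Sum 0 (f ∘ suc) ≡⟨ +-congˡ (trans (Sum-0 _) (sym (Sum-0 f))) ⟩
    f 0 + Sum 0 f ≡⟨ +-comm _ _ ⟩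
    Sum 0 f + f 0 ∎
  Sum-last (suc k) f = begin
    Sum (suc (suc k)) f ≡⟨ Sum-suc (suc k) f ⟩
    f 0 + Sum (suc k) (f ∘ suc) ≡⟨ +-congˡ (Sum-last k (f ∘ suc)) ⟩
    f 0 + (Sum k (f ∘ suc) + f (suc k)) ≡⟨ sym (+-assoc _ _ _) ⟩
    f 0 + Sum k (f ∘ suc) + f (suc k) ≡⟨ cong (_+ f (suc k)) (sym (Sum-suc k f)) ⟩
    Sum (suc k) f + f (suc k) ∎

  -- With u = x - N and v = N - l this splits a product of two simple poles, which keeps the
  -- expansion in partial fractions when a new pole at N is introduced.
  ⁻¹-split : ∀ {u v} → u ≢ 0# → v ≢ 0# → u + v ≢ 0# →
    (u + v) ⁻¹ * u ⁻¹ + v ⁻¹ * (u + v) ⁻¹ ≡ v ⁻¹ * u ⁻¹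
  ⁻¹-split {u} {v} p q r = begin
    i * j + k * i ≡⟨ solve 3 (λ i j k → i :* j :+ k :* i := i :* (j :* κ 1 :+ k :* κ 1)) refl i j k ⟩
    i * (j * 1# + k * 1#) ≡⟨ cong₂ (λ a b → i * (j * a + k * b)) (sym (⁻¹-inverseʳ q)) (sym (⁻¹-inverseʳ p)) ⟩
    i * (j * (v * k) + k * (u * j)) ≡⟨ solve 5 (λ i j k u v → i :* (j :* (v :* k) :+ k :* (u :* j)) := ((u :+ v) :* i) :* (k :* j)) refl i j k u v ⟩
    (u + v) * i * (k * j) ≡⟨ cong (_* (k * j)) (⁻¹-inverseʳ r) ⟩
    1# * (k * j) ≡⟨ *-identityˡ _ ⟩
    k * j ∎
    where
    i = (u + v) ⁻¹
    j = u ⁻¹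
    k = v ⁻¹

  -- F(x) = ∏_{i even ≤ N} (x − i) / ∏_{l odd < N} (x − l), in partial fractions
  -- x − b − ∑ₗ eₗ / (x − l).
  record PartialFractions (N : ℕ) : Set where
    field
      e : ℕ → ℝ
      b : ℝ
    F : ℕ → ℝ
    F x = ι x − b − Sum N (λ l → e l * (ι x − ι l) ⁻¹)
    field
      e-even : ∀ l → Even l → e l ≡ 0#
      e-beyond : ∀ l → N ℕ.≤ l → e l ≡ 0#
      e-odd : ∀ l → l ℕ.< N → Odd l → Pos (e l)
      F-even : ∀ x → Even x → x ℕ.≤ N → F x ≡ 0#
      F-odd : ∀ y → Odd y → N ℕ.≤ y → Pos (F y)

  partialFractions-0 : PartialFractions 0
  partialFractions-0 = record
    { e = λ _ → 0# ; b = 0#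
    ; e-even = λ _ _ → refl ; e-beyond = λ _ _ → refl ; e-odd = λ _ ()
    ; F-even = λ { zero _ z≤n → trans (cong (λ s → 0# − 0# − s) (Sum-0 _)) (solve 0 (κ 0 :- κ 0 :- κ 0 := κ 0) refl) }
    ; F-odd = λ { (suc y) _ _ → subst Pos
        (trans (solve 1 (λ x → x := x :- κ 0 :- κ 0) refl (ι (suc y))) (cong (λ s → ι (suc y) − 0# − s) (sym (Sum-0 _))))
        (ι-suc-Pos y) } }

  module EvenStep {N} (even-N : Even N) (P : PartialFractions N) where
    open PartialFractions P
    F-suc : ∀ x → ι x − b − Sum (suc N) (λ l → e l * (ι x − ι l) ⁻¹) ≡ F x
    F-suc x = cong (λ s → ι x − b − s) (begin
      Sum (suc N) (λ l → e l * (ι x − ι l) ⁻¹) ≡⟨ Sum-last N _ ⟩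
      Sum N (λ l → e l * (ι x − ι l) ⁻¹) + e N * (ι x − ι N) ⁻¹
        ≡⟨ +-congˡ (trans (cong (_* (ι x − ι N) ⁻¹) (e-beyond N ℕP.≤-refl)) (zeroˡ _)) ⟩
      Sum N (λ l → e l * (ι x − ι l) ⁻¹) + 0# ≡⟨ +-identityʳ _ ⟩
      Sum N (λ l → e l * (ι x − ι l) ⁻¹) ∎)

    pred-≤ : ∀ {x} → Even x → x ℕ.≤ suc N → x ℕ.≤ N
    pred-≤ ev x≤ with ℕP.m≤n⇒m<n∨m≡n x≤
    ... | inj₁ (s≤s p) = p
    ... | inj₂ refl = ⊥-elim (Even⇒¬Odd {N} even-N ev)

    pred-< : ∀ {l} → Odd l → l ℕ.< suc N → l ℕ.< N
    pred-< od l< with ℕP.m≤n⇒m<n∨m≡n l<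
    ... | inj₁ (s≤s p) = p
    ... | inj₂ refl = ⊥-elim (Even⇒¬Odd {N} even-N od)

    step : PartialFractions (suc N)
    step = record
      { e = e ; b = b
      ; e-even = e-even
      ; e-beyond = λ l N<l → e-beyond l (ℕP.<⇒≤ N<l)
      ; e-odd = λ l l<N od → e-odd l (pred-< od l<N) od
      ; F-even = λ x ev x≤N → trans (F-suc x) (F-even x ev (pred-≤ ev x≤N))
      ; F-odd = λ y od N<y → subst Pos (sym (F-suc y)) (F-odd y od (ℕP.<⇒≤ N<y)) }

  -- F is multiplied by (x − (N + 1)) / (x − N) = 1 − 1 / (x − N).
  module OddStep {N} (odd-N : Odd N) (P : PartialFractions N) where
    open PartialFractions P
    -- The negated residues after the multiplication. At an old pole l the factor is (l - N - 1) /
    -- (l - N) = 1 + 1 / (N - l); at the new pole N the factor contributes -1, which leaves the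
    -- value of the old F.
    e′ : ℕ → ℝ
    e′ l with l ℕ.≟ N
    ... | yes _ = F N
    ... | no _ = e l * (1# + (ι N − ι l) ⁻¹)

    e′-N : e′ N ≡ F N
    e′-N with N ℕ.≟ N
    ... | yes _ = refl
    ... | no q = ⊥-elim (q refl)

    e′-≢ : ∀ {l} → l ≢ N → e′ l ≡ e l * (1# + (ι N − ι l) ⁻¹)
    e′-≢ {l} q with l ℕ.≟ N
    ... | yes p = ⊥-elim (q p)
    ... | no _ = refl

    F′ : ℕ → ℝ
    F′ x = ι x − (b + 1#) − Sum (suc N) (λ l → e′ l * (ι x − ι l) ⁻¹)

    -- The last hypothesis says that x is not a true pole. At an even x the sum does contain the
    -- index l = x, but with coefficient 0.
    F′≡ : ∀ x → x ≢ N → (∀ l → l ℕ.< N → l ≢ x ⊎ e l ≡ 0#) → F′ x ≡ F x * (1# − (ι x − ι N) ⁻¹)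
    F′≡ x x≢N ok = begin
      ι x − (b + 1#) − Sum (suc N) (λ l → e′ l * A l) ≡⟨ cong (λ s → ι x − (b + 1#) − s) expand ⟩
      ι x − (b + 1#) − ((1# − r) * σ + r * τ + (ι N − b − τ) * r)
        ≡⟨ solve 6 (λ x b r σ τ n → x :- (b :+ κ 1) :- ((κ 1 :- r) :* σ :+ r :* τ :+ (n :- b :- τ) :* r) :=
             (x :- b :- σ) :* (κ 1 :- r) :+ ((x :- n) :* r :- κ 1)) refl (ι x) b r σ τ (ι N) ⟩
      F x * (1# − r) + ((ι x − ι N) * r − 1#) ≡⟨ +-congˡ (trans (cong (_− 1#) (⁻¹-inverseʳ (ι-≢ x≢N))) (-‿inverseʳ 1#)) ⟩
      F x * (1# − r) + 0# ≡⟨ +-identityʳ _ ⟩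
      F x * (1# − r) ∎
      where
      A : ℕ → ℝ
      A l = (ι x − ι l) ⁻¹
      B : ℕ → ℝ
      B l = (ι N − ι l) ⁻¹
      r = (ι x − ι N) ⁻¹
      σ = Sum N (λ l → e l * A l)
      τ = Sum N (λ l → e l * B l)
      term : ∀ l → l ℕ.< N → e′ l * A l ≡ (1# − r) * (e l * A l) + r * (e l * B l)
      term l l<N with ok l l<N
      ... | inj₂ e≡0 = begin
        e′ l * A l ≡⟨ cong (_* A l) (trans (e′-≢ (ℕP.<⇒≢ l<N)) (trans (cong (_* (1# + B l)) e≡0) (zeroˡ _))) ⟩
        0# * A l ≡⟨ solve 3 (λ a b r → κ 0 :* a := (κ 1 :- r) :* (κ 0 :* a) :+ r :* (κ 0 :* b)) refl (A l) (B l) r ⟩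
        (1# − r) * (0# * A l) + r * (0# * B l) ≡⟨ cong (λ z → (1# − r) * (z * A l) + r * (z * B l)) (sym e≡0) ⟩
        (1# − r) * (e l * A l) + r * (e l * B l) ∎
      ... | inj₁ l≢x = begin
        e′ l * A l ≡⟨ cong (_* A l) (e′-≢ (ℕP.<⇒≢ l<N)) ⟩
        e l * (1# + B l) * A l ≡⟨ solve 4 (λ e a b r → e :* (κ 1 :+ b) :* a := (κ 1 :- r) :* (e :* a) :+ e :* (a :* r :+ b :* a)) refl (e l) (A l) (B l) r ⟩
        (1# − r) * (e l * A l) + e l * (A l * r + B l * A l) ≡⟨ +-congˡ (cong (e l *_) split) ⟩
        (1# − r) * (e l * A l) + e l * (B l * r) ≡⟨ +-congˡ (solve 3 (λ e b r → e :* (b :* r) := r :* (e :* b)) refl (e l) (B l) r) ⟩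
        (1# − r) * (e l * A l) + r * (e l * B l) ∎
        where
        sum≡ : (ι x − ι N) + (ι N − ι l) ≡ ι x − ι l
        sum≡ = solve 3 (λ x n l → (x :- n) :+ (n :- l) := x :- l) refl (ι x) (ι N) (ι l)
        split : A l * r + B l * A l ≡ B l * r
        split = subst (λ z → z ⁻¹ * r + B l * z ⁻¹ ≡ B l * r) sum≡
          (⁻¹-split (ι-≢ x≢N) (ι-≢ (λ p → ℕP.<⇒≢ l<N (sym p))) (λ z → ι-≢ (l≢x ∘ sym) (trans (sym sum≡) z)))
      expand : Sum (suc N) (λ l → e′ l * A l) ≡ (1# − r) * σ + r * τ + (ι N − b − τ) * r
      expand = begin
        Sum (suc N) (λ l → e′ l * A l) ≡⟨ Sum-last N _ ⟩
        Sum N (λ l → e′ l * A l) + e′ N * A N ≡⟨ cong₂ _+_ (Sum-cong term) (cong (_* A N) e′-N) ⟩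
        Sum N (λ l → (1# − r) * (e l * A l) + r * (e l * B l)) + F N * r ≡⟨ cong (_+ F N * r) (Sum-+ _ _) ⟩
        Sum N (λ l → (1# − r) * (e l * A l)) + Sum N (λ l → r * (e l * B l)) + F N * r
          ≡⟨ cong₂ (λ y z → y + z + F N * r) (Sum-*ˡ _ _) (Sum-*ˡ _ _) ⟩
        (1# − r) * σ + r * τ + F N * r ∎

    step : PartialFractions (suc N)
    step = record
      { e = e′ ; b = b + 1#
      ; e-even = λ l ev → trans (e′-≢ (λ { refl → Even⇒¬Odd {N} ev odd-N })) (trans (cong (_* _) (e-even l ev)) (zeroˡ _))
      ; e-beyond = λ l N<l → trans (e′-≢ (λ { refl → ℕP.<-irrefl refl N<l })) (trans (cong (_* _) (e-beyond l (ℕP.<⇒≤ N<l))) (zeroˡ _))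
      ; e-odd = e′-odd
      ; F-even = F′-even
      ; F-odd = F′-odd }
      where
      e′-odd : ∀ l → l ℕ.< suc N → Odd l → Pos (e′ l)
      e′-odd l l<N od with ℕP.m≤n⇒m<n∨m≡n l<N
      -- The new coefficient is F N. It is positive because N exceeds all zeros and poles so far;
      -- this is what `F-odd` is carried along for.
      ... | inj₂ refl = subst Pos (sym e′-N) (F-odd N odd-N ℕP.≤-refl)
      ... | inj₁ (s≤s p) = subst Pos (sym (e′-≢ (ℕP.<⇒≢ p))) (Pos-* (e-odd l p od) (Pos-+ Pos-1 (Pos-⁻¹ (ι-<-Pos p))))
      F′-even : ∀ x → Even x → x ℕ.≤ suc N → F′ x ≡ 0#
      F′-even x ev x≤N = trans (F′≡ x (λ { refl → Even⇒¬Odd {N} ev odd-N }) safe) (vanish (ℕP.m≤n⇒m<n∨m≡n x≤N))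
        where
        safe : ∀ l → l ℕ.< N → l ≢ x ⊎ e l ≡ 0#
        safe l _ with l ℕ.≟ x
        ... | yes refl = inj₂ (e-even l ev)
        ... | no q = inj₁ q
        vanish : x ℕ.< suc N ⊎ x ≡ suc N → F x * (1# − (ι x − ι N) ⁻¹) ≡ 0#
        vanish (inj₁ (s≤s p)) = trans (cong (_* (1# − (ι x − ι N) ⁻¹)) (F-even x ev p)) (zeroˡ _)
        vanish (inj₂ refl) = trans (cong (F x *_) (begin
          1# − (ι (suc N) − ι N) ⁻¹ ≡⟨ cong (λ z → 1# − z ⁻¹) one ⟩
          1# − 1# ⁻¹ ≡⟨ cong (1# −_) (trans (sym (*-identityˡ _)) (⁻¹-inverseʳ (proj₂ Pos-1))) ⟩
          1# − 1# ≡⟨ -‿inverseʳ 1# ⟩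
          0# ∎)) (zeroʳ _)
          where
          one : ι (suc N) − ι N ≡ 1#
          one = solve 1 (λ n → (κ 1 :+ n) :- n := κ 1) refl (ι N)
      F′-odd : ∀ y → Odd y → suc N ℕ.≤ y → Pos (F′ y)
      F′-odd y od N<y = subst Pos (sym (F′≡ y (λ e → ℕP.<⇒≢ N<y (sym e)) (λ l l<N → inj₁ (ℕP.<⇒≢ (ℕP.<-trans l<N N<y)))))
          (Pos-* (F-odd y od (ℕP.<⇒≤ N<y)) (subst Pos factor (Pos-* (ι-<-Pos (ℕP.≤∧≢⇒< N<y (λ { refl → Even⇒¬Odd {suc N} odd-N od }))) (Pos-⁻¹ gap))))
        where
        gap : Pos (ι y − ι N)
        gap = ι-<-Pos N<y
        factor : (ι y − ι (suc N)) * (ι y − ι N) ⁻¹ ≡ 1# − (ι y − ι N) ⁻¹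
        factor = begin
          (ι y − (1# + ι N)) * (ι y − ι N) ⁻¹ ≡⟨ solve 3 (λ y n i → (y :- (κ 1 :+ n)) :* i := (y :- n) :* i :- i) refl (ι y) (ι N) ((ι y − ι N) ⁻¹) ⟩
          (ι y − ι N) * (ι y − ι N) ⁻¹ − (ι y − ι N) ⁻¹ ≡⟨ cong (_− (ι y − ι N) ⁻¹) (⁻¹-inverseʳ (proj₂ gap)) ⟩
          1# − (ι y − ι N) ⁻¹ ∎

  partialFractions : ∀ N → PartialFractions N
  partialFractions zero = partialFractions-0
  partialFractions (suc N) with parity N
  ... | inj₁ ev = EvenStep.step ev (partialFractions N)
  ... | inj₂ od = OddStep.step od (partialFractions N)

  -- Solving for the odd weights

  four : ℝ
  four = 1# + 1# + 1# + 1#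

  -- θ and 1/θ are the roots of t² − (Y − 2) t + 1.
  reciprocal-pair : ∀ Y → ∃ λ θ → Pos θ × (four ≤ᵣ Y → (1# + θ) * (1# + θ) ≡ Y * θ)
  reciprocal-pair Y with ≤-total four Y
  -- A default, so that θ is defined and positive for every Y. If `four ≤ᵣ Y` also holds then Y = 4,
  -- and 1 is the double root.
  ... | inj₂ Y≤4 = 1# , Pos-1 , λ 4≤Y → trans (solve 0 ((κ 1 :+ κ 1) :* (κ 1 :+ κ 1) := κ 4 :* κ 1) refl) (cong (_* 1#) (≤-antisym 4≤Y Y≤4))
  ... | inj₁ 4≤Y = θ , Pos-* (subst Pos (+-comm s y) (nonneg+Pos 0≤s y>0)) u>0 , λ _ → −≡0⇒≡ (begin
      (1# + θ) * (1# + θ) − Y * θ ≡⟨ solve 3 (λ Y s u → let y = Y :- κ 2 ; θ = (y :+ s) :* u in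
          (κ 1 :+ θ) :* (κ 1 :+ θ) :- Y :* θ := κ 1 :+ θ :* (s :* u :+ y :* (u :- κ 1))) refl Y s u ⟩
      1# + θ * (s * u + y * (u − 1#)) ≡⟨ cong (λ z → 1# + θ * (s * u + y * (u − z))) (sym 2u≡1) ⟩
      1# + θ * (s * u + y * (u − (1# + 1#) * u)) ≡⟨ solve 3 (λ Y s u → let y = Y :- κ 2 ; θ = (y :+ s) :* u in
          κ 1 :+ θ :* (s :* u :+ y :* (u :- (κ 1 :+ κ 1) :* u)) := κ 1 :+ (s :* s :- y :* y) :* (u :* u)) refl Y s u ⟩
      1# + (s * s − y * y) * (u * u) ≡⟨ cong (λ z → 1# + (z − y * y) * (u * u)) s²≡ ⟩
      1# + (Y * (Y − four) − y * y) * (u * u) ≡⟨ solve 2 (λ Y u → κ 1 :+ (Y :* (Y :- κ 4) :- (Y :- κ 2) :* (Y :- κ 2)) :* (u :* u) :=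
          κ 1 :- ((κ 1 :+ κ 1) :* u) :* ((κ 1 :+ κ 1) :* u)) refl Y u ⟩
      1# − ((1# + 1#) * u) * ((1# + 1#) * u) ≡⟨ cong (λ z → 1# − z * z) 2u≡1 ⟩
      1# − 1# * 1# ≡⟨ solve 0 (κ 1 :- κ 1 :* κ 1 := κ 0) refl ⟩
      0# ∎)
    where
    y = Y − (1# + 1#)
    u = (1# + 1#) ⁻¹
    2>0 : Pos (1# + 1#)
    2>0 = Pos-+ Pos-1 Pos-1
    2u≡1 : (1# + 1#) * u ≡ 1#
    2u≡1 = ⁻¹-inverseʳ (proj₂ 2>0)
    u>0 : Pos u
    u>0 = Pos-⁻¹ 2>0
    y>0 : Pos y
    y>0 = subst Pos (solve 1 (λ Y → (Y :- κ 4) :+ κ 2 := Y :- κ 2) refl Y) (nonneg+Pos (≤⇒0≤− 4≤Y) 2>0)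
    Y≥0 : 0# ≤ᵣ Y
    Y≥0 = subst (0# ≤ᵣ_) (solve 1 (λ Y → (Y :- κ 2) :+ κ 2 := Y) refl Y) (+-nonneg (proj₁ y>0) (proj₁ 2>0))
    root = √ (*-nonneg Y≥0 (≤⇒0≤− 4≤Y))
    s = proj₁ root
    0≤s = proj₁ (proj₂ root)
    s²≡ : s * s ≡ Y * (Y − four)
    s²≡ = proj₂ (proj₂ root)
    θ = (y + s) * u

  upper-bound : ∀ N (f : ℕ → ℝ) → ∃ λ a → Pos a × (∀ l → l ℕ.< N → f l ≤ᵣ a)
  upper-bound zero f = 1# , Pos-1 , λ _ ()
  upper-bound (suc N) f with upper-bound N f
  ... | a , a>0 , below with ≤-total (f N) a
  ...   | inj₁ p = a , a>0 , λ l l<N → [ below l , (λ { refl → p }) ]′ (ℕP.m≤n⇒m<n∨m≡n (ℕP.≤-pred l<N))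
  ...   | inj₂ p = f N , subst Pos (solve 2 (λ f a → (f :- a) :+ a := f) refl (f N) a) (nonneg+Pos (≤⇒0≤− p) a>0) ,
          λ l l<N → [ (λ q → ≤-trans (below l q) p) , (λ { refl → ≤-refl (f N) }) ]′ (ℕP.m≤n⇒m<n∨m≡n (ℕP.≤-pred l<N))

  -- Orthogonal polynomials on the nodes 0 , … , M

  ∇ : ℕ → (ℕ → ℝ) → ℕ → ℝ
  ∇ zero f x = f x
  ∇ (suc d) f x = ∇ d f x − ∇ d f (suc x)

  ∇-cong : ∀ d {f g} → (∀ x → f x ≡ g x) → ∀ x → ∇ d f x ≡ ∇ d g x
  ∇-cong zero p x = p x
  ∇-cong (suc d) p x = cong₂ _−_ (∇-cong d p x) (∇-cong d p (suc x))

  ∇-− : ∀ d f g x → ∇ d (λ l → f l − g l) x ≡ ∇ d f x − ∇ d g x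
  ∇-− zero f g x = refl
  ∇-− (suc d) f g x = trans (cong₂ _−_ (∇-− d f g x) (∇-− d f g (suc x)))
    (solve 4 (λ a b c d → (a :- b) :- (c :- d) := (a :- c) :- (b :- d)) refl (∇ d f x) (∇ d g x) (∇ d f (suc x)) (∇ d g (suc x)))

  ∇-*ˡ : ∀ d c f x → ∇ d (λ l → c * f l) x ≡ c * ∇ d f x
  ∇-*ˡ zero c f x = refl
  ∇-*ˡ (suc d) c f x = trans (cong₂ _−_ (∇-*ˡ d c f x) (∇-*ˡ d c f (suc x)))
    (solve 3 (λ c a b → c :* a :- c :* b := c :* (a :- b)) refl c (∇ d f x) (∇ d f (suc x)))

  -- Leibniz rule: the first difference of the identity is the constant -1, so only two terms
  -- remain.
  ∇-ι* : ∀ d f x → ∇ (suc d) (λ l → ι l * f l) x ≡ (ι x + ι (suc d)) * ∇ (suc d) f x − ι (suc d) * ∇ d f x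
  ∇-ι* zero f x = solve 3 (λ x a b → x :* a :- (κ 1 :+ x) :* b := (x :+ (κ 1 :+ κ 0)) :* (a :- b) :- (κ 1 :+ κ 0) :* a) refl (ι x) (f x) (f (suc x))
  ∇-ι* (suc d) f x = trans (cong₂ _−_ (∇-ι* d f x) (∇-ι* d f (suc x)))
    (solve 5 (λ x d a b c → ((x :+ (κ 1 :+ d)) :* (a :- b) :- (κ 1 :+ d) :* a) :- (((κ 1 :+ x) :+ (κ 1 :+ d)) :* (b :- c) :- (κ 1 :+ d) :* b)
       := (x :+ (κ 1 :+ (κ 1 :+ d))) :* ((a :- b) :- (b :- c)) :- (κ 1 :+ (κ 1 :+ d)) :* (a :- b)) refl
       (ι x) (ι d) (∇ d f x) (∇ d f (suc x)) (∇ d f (suc (suc x))))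

  ∇-zero : ∀ d {f : ℕ → ℝ} → (∀ x → f x ≡ 0#) → ∀ x → ∇ d f x ≡ 0#
  ∇-zero zero p x = p x
  ∇-zero (suc d) p x = trans (cong₂ _−_ (∇-zero d p x) (∇-zero d p (suc x))) (-‿inverseʳ 0#)

  ∇-beyond : ∀ {d e f a} → (∀ x → ∇ d f x ≡ a) → d ℕ.< e → ∀ x → ∇ e f x ≡ 0#
  ∇-beyond {d} {suc e} {f} {a} p (s≤s d≤e) x with ℕP.m≤n⇒m<n∨m≡n d≤e
  ... | inj₂ refl = trans (cong₂ _−_ (p x) (p (suc x))) (-‿inverseʳ a)
  ... | inj₁ d<e = trans (cong₂ _−_ (∇-beyond {f = f} p d<e x) (∇-beyond {f = f} p d<e (suc x))) (-‿inverseʳ 0#)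

  sgn : ℕ → ℝ
  sgn zero = 1#
  sgn (suc l) = - sgn l

  binomial : ℕ → ℕ → ℝ
  binomial zero zero = 1#
  binomial zero (suc l) = 0#
  binomial (suc d) zero = binomial d zero
  binomial (suc d) (suc l) = binomial d l + binomial d (suc l)

  binomial-beyond : ∀ d l → d ℕ.< l → binomial d l ≡ 0#
  binomial-beyond zero (suc l) _ = refl
  binomial-beyond (suc d) (suc l) (s≤s p) =
    trans (cong₂ _+_ (binomial-beyond d l p) (binomial-beyond d (suc l) (ℕP.m<n⇒m<1+n p))) (+-identityˡ 0#)

  binomial-nonneg : ∀ d l → 0# ≤ᵣ binomial d l
  binomial-nonneg zero zero = 0≤1
  binomial-nonneg zero (suc l) = ≤-refl 0#
  binomial-nonneg (suc d) zero = binomial-nonneg d zero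
  binomial-nonneg (suc d) (suc l) = +-nonneg (binomial-nonneg d l) (binomial-nonneg d (suc l))

  binomial-Pos : ∀ d l → l ℕ.≤ d → Pos (binomial d l)
  binomial-Pos zero zero _ = Pos-1
  binomial-Pos (suc d) zero _ = binomial-Pos d zero z≤n
  binomial-Pos (suc d) (suc l) (s≤s p) = subst Pos (+-comm _ _) (nonneg+Pos (binomial-nonneg d (suc l)) (binomial-Pos d l p))

  ∇-binomial : ∀ d f x → ∇ d f x ≡ Sum (suc d) (λ l → sgn l * binomial d l * f (x ℕ.+ l))
  ∇-binomial zero f x = sym (begin
    Sum 1 (λ l → sgn l * binomial 0 l * f (x ℕ.+ l)) ≡⟨ Sum-last 0 _ ⟩
    Sum 0 (λ l → sgn l * binomial 0 l * f (x ℕ.+ l)) + 1# * 1# * f (x ℕ.+ 0) ≡⟨ cong₂ (λ s y → s + 1# * 1# * f y) (Sum-0 _) (ℕP.+-identityʳ x) ⟩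
    0# + 1# * 1# * f x ≡⟨ solve 1 (λ y → κ 0 :+ κ 1 :* κ 1 :* y := y) refl (f x) ⟩
    f x ∎)
  ∇-binomial (suc d) f x = begin
    ∇ d f x − ∇ d f (suc x) ≡⟨ cong₂ _−_ (∇-binomial d f x) (∇-binomial d f (suc x)) ⟩
    Sum (suc d) a − Sum (suc d) b ≡⟨ cong (_− Sum (suc d) b) (begin
      Sum (suc d) a ≡⟨ sym (+-identityʳ _) ⟩
      Sum (suc d) a + 0# ≡⟨ +-congˡ (sym (trans (cong (λ z → sgn (suc d) * z * f (x ℕ.+ suc d)) (binomial-beyond d (suc d) ℕP.≤-refl))
         (solve 2 (λ s y → s :* κ 0 :* y := κ 0) refl (sgn (suc d)) (f (x ℕ.+ suc d))))) ⟩
      Sum (suc d) a + a (suc d) ≡⟨ sym (Sum-last (suc d) a) ⟩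
      Sum (suc (suc d)) a ≡⟨ Sum-suc (suc d) a ⟩
      a 0 + Sum (suc d) (a ∘ suc) ∎) ⟩
    a 0 + Sum (suc d) (a ∘ suc) − Sum (suc d) b ≡⟨ +-assoc _ _ _ ⟩
    a 0 + (Sum (suc d) (a ∘ suc) − Sum (suc d) b) ≡⟨ +-congˡ (sym (Sum-− (a ∘ suc) b)) ⟩
    a 0 + Sum (suc d) (λ l → a (suc l) − b l) ≡⟨ +-congˡ (Sum-cong λ l _ →
      trans (cong (λ y → a (suc l) − sgn l * binomial d l * f y) (sym (ℕP.+-suc x l)))
        (solve 4 (λ s p q y → :- s :* q :* y :- s :* p :* y := :- s :* (p :+ q) :* y) refl (sgn l) (binomial d l) (binomial d (suc l)) (f (x ℕ.+ suc l)))) ⟩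
    c 0 + Sum (suc d) (c ∘ suc) ≡⟨ sym (Sum-suc (suc d) c) ⟩
    Sum (suc (suc d)) c ∎
    where
    a b c : ℕ → ℝ
    a l = sgn l * binomial d l * f (x ℕ.+ l)
    b l = sgn l * binomial d l * f (suc x ℕ.+ l)
    c l = sgn l * binomial (suc d) l * f (x ℕ.+ l)

  -- The indices are shifted by one: p (suc j) is the monic orthogonal polynomial of
  -- degree j, and p 0 = 0 starts the recurrence.
  module Orthogonal (M : ℕ) (w : ℕ → ℝ) (w>0 : ∀ l → l ℕ.≤ M → Pos (w l)) where
    n : ℕ
    n = suc M

    ⟨_,_⟩ : (ℕ → ℝ) → (ℕ → ℝ) → ℝ
    ⟨ f , g ⟩ = Sum n (λ l → w l * (f l * g l))

    X : (ℕ → ℝ) → ℕ → ℝ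
    X f l = ι l * f l

    ⟨⟩-comm : ∀ f g → ⟨ f , g ⟩ ≡ ⟨ g , f ⟩
    ⟨⟩-comm f g = Sum-cong λ l _ → cong (w l *_) (*-comm (f l) (g l))

    ⟨⟩-X : ∀ f g → ⟨ f , X g ⟩ ≡ ⟨ X f , g ⟩
    ⟨⟩-X f g = Sum-cong λ l _ → solve 4 (λ w x f g → w :* (f :* (x :* g)) := w :* ((x :* f) :* g)) refl (w l) (ι l) (f l) (g l)

    ⟨⟩-zeroˡ : ∀ {f} g → (∀ l → l ℕ.< n → f l ≡ 0#) → ⟨ f , g ⟩ ≡ 0#
    ⟨⟩-zeroˡ g p = Sum-zero λ l l<N → trans (cong (λ z → w l * (z * g l)) (p l l<N)) (solve 2 (λ w g → w :* (κ 0 :* g) := κ 0) refl (w l) (g l))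

    ⟨⟩-three : ∀ f g₁ g₂ g₃ b c → ⟨ f , (λ l → g₁ l − b * g₂ l − c * g₃ l) ⟩ ≡ ⟨ f , g₁ ⟩ − b * ⟨ f , g₂ ⟩ − c * ⟨ f , g₃ ⟩
    ⟨⟩-three f g₁ g₂ g₃ b c = begin
      Sum n (λ l → w l * (f l * (g₁ l − b * g₂ l − c * g₃ l)))
        ≡⟨ Sum-cong (λ l _ → solve 7 (λ w f x y z b c → w :* (f :* (x :- b :* y :- c :* z)) := w :* (f :* x) :- b :* (w :* (f :* y)) :- c :* (w :* (f :* z)))
             refl (w l) (f l) (g₁ l) (g₂ l) (g₃ l) b c) ⟩
      Sum n (λ l → w l * (f l * g₁ l) − b * (w l * (f l * g₂ l)) − c * (w l * (f l * g₃ l))) ≡⟨ Sum-− _ _ ⟩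
      Sum n (λ l → w l * (f l * g₁ l) − b * (w l * (f l * g₂ l))) − Sum n (λ l → c * (w l * (f l * g₃ l)))
        ≡⟨ cong₂ _−_ (trans (Sum-− _ _) (+-congˡ (cong -_ (Sum-*ˡ b _)))) (Sum-*ˡ c _) ⟩
      ⟨ f , g₁ ⟩ − b * ⟨ f , g₂ ⟩ − c * ⟨ f , g₃ ⟩ ∎

    definite : ∀ {f} → ⟨ f , f ⟩ ≡ 0# → ∀ l → l ℕ.< n → f l ≡ 0#
    definite {f} e l l<N = ≡0-stable λ fl≢0 → *-≢0 (proj₂ (w>0 l (ℕP.≤-pred l<N))) (*-≢0 fl≢0 fl≢0)
      (Sum-nonneg-≡0 (λ l l<N → *-nonneg (proj₁ (w>0 l (ℕP.≤-pred l<N))) (square-nonneg (f l))) e l l<N)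

    mean : (ℕ → ℝ) → ℝ
    mean f = ⟨ X f , f ⟩ * ⟨ f , f ⟩ ⁻¹

    ratio : (ℕ → ℝ) → (ℕ → ℝ) → ℝ
    ratio f g = ⟨ f , f ⟩ * ⟨ g , g ⟩ ⁻¹

    p : ℕ → ℕ → ℝ
    p zero l = 0#
    p (suc zero) l = 1#
    -- For j = 0 the ratio contains the inverse of ⟨ p 0 , p 0 ⟩ = 0; its value does not matter, as
    -- it multiplies p 0 = 0.
    p (suc (suc j)) l = ι l * p (suc j) l − mean (p (suc j)) * p (suc j) l − ratio (p (suc j)) (p j) * p j l

    h : ℕ → ℝ
    h j = ⟨ p j , p j ⟩

    -- (-1)^d d!, the d-th difference of every monic polynomial of degree d.
    lead : ℕ → ℝ
    lead zero = 1#
    lead (suc d) = - (ι (suc d) * lead d)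

    lead≢0 : ∀ d → lead d ≢ 0#
    lead≢0 zero = proj₂ Pos-1
    lead≢0 (suc d) = neg-≢0 (*-≢0 (proj₂ (ι-suc-Pos d)) (lead≢0 d))

    -- This replaces degree and leading coefficient: the p j are mere functions on ℕ, and constant
    -- differences record that p (suc d) is monic of degree d. In the recurrence only the product
    -- with the variable survives the d-th difference.
    ∇-lead : ∀ d x → ∇ d (p (suc d)) x ≡ lead d
    ∇-vanish : ∀ j {e} → j ℕ.≤ e → ∀ x → ∇ e (p j) x ≡ 0#
    ∇-vanish zero {e} _ x = ∇-zero e (λ _ → refl) x
    ∇-vanish (suc d) d<e x = ∇-beyond {f = p (suc d)} (∇-lead d) d<e x
    ∇-lead zero x = refl
    ∇-lead (suc d) x = begin
      ∇ (suc d) (λ l → ι l * p (suc d) l − b * p (suc d) l − c * p d l) x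
        ≡⟨ ∇-− (suc d) (λ l → ι l * p (suc d) l − b * p (suc d) l) (λ l → c * p d l) x ⟩
      ∇ (suc d) (λ l → ι l * p (suc d) l − b * p (suc d) l) x − ∇ (suc d) (λ l → c * p d l) x
        ≡⟨ cong₂ _−_ (∇-− (suc d) (λ l → ι l * p (suc d) l) (λ l → b * p (suc d) l) x) (∇-*ˡ (suc d) c (p d) x) ⟩
      ∇ (suc d) (λ l → ι l * p (suc d) l) x − ∇ (suc d) (λ l → b * p (suc d) l) x − c * ∇ (suc d) (p d) x
        ≡⟨ cong₂ (λ y z → y − z − c * ∇ (suc d) (p d) x) (∇-ι* d (p (suc d)) x) (∇-*ˡ (suc d) b (p (suc d)) x) ⟩
      ((ι x + ι (suc d)) * ∇ (suc d) (p (suc d)) x − ι (suc d) * ∇ d (p (suc d)) x) − b * ∇ (suc d) (p (suc d)) x − c * ∇ (suc d) (p d) x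
        ≡⟨ cong₂ (λ y z → ((ι x + ι (suc d)) * y − ι (suc d) * ∇ d (p (suc d)) x) − b * y − c * z)
             (∇-vanish (suc d) ℕP.≤-refl x) (∇-vanish d (ℕP.n≤1+n d) x) ⟩
      ((ι x + ι (suc d)) * 0# − ι (suc d) * ∇ d (p (suc d)) x) − b * 0# − c * 0#
        ≡⟨ cong (λ y → ((ι x + ι (suc d)) * 0# − ι (suc d) * y) − b * 0# − c * 0#) (∇-lead d x) ⟩
      ((ι x + ι (suc d)) * 0# − ι (suc d) * lead d) − b * 0# − c * 0#
        ≡⟨ solve 5 (λ x d L b c → ((x :+ d) :* κ 0 :- d :* L) :- b :* κ 0 :- c :* κ 0 := :- (d :* L)) refl (ι x) (ι (suc d)) (lead d) b c ⟩
      - (ι (suc d) * lead d) ∎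
      where
      b = mean (p (suc d))
      c = ratio (p (suc d)) (p d)

    -- If the norm vanished, so would p (suc j) at all nodes. Its j-th difference at 0 only involves
    -- the nodes 0, ..., j, yet equals `lead j`.
    h≢0 : ∀ j → j ℕ.< n → h (suc j) ≢ 0#
    h≢0 j j<N e = lead≢0 j (trans (sym (∇-lead j 0)) (trans (∇-binomial j (p (suc j)) 0)
      (Sum-zero λ l l≤j → trans (cong (sgn l * binomial j l *_) (definite e l (ℕP.≤-trans l≤j j<N))) (zeroʳ _))))

    h>0 : ∀ j → j ℕ.< n → Pos (h (suc j))
    h>0 j j<N = Sum-nonneg (λ l l<N → *-nonneg (proj₁ (w>0 l (ℕP.≤-pred l<N))) (square-nonneg (p (suc j) l))) , h≢0 j j<N

    ⟨Xp,⟩ : ∀ i f → ⟨ X (p (suc i)) , f ⟩ ≡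
      ⟨ p (suc (suc i)) , f ⟩ + mean (p (suc i)) * ⟨ p (suc i) , f ⟩ + ratio (p (suc i)) (p i) * ⟨ p i , f ⟩
    ⟨Xp,⟩ i f = begin
      ⟨ X (p (suc i)) , f ⟩ ≡⟨ ⟨⟩-comm _ f ⟩
      ⟨ f , X (p (suc i)) ⟩ ≡⟨ solve 3 (λ x y z → x := (x :- y :- z) :+ y :+ z) refl ⟨ f , X (p (suc i)) ⟩ (b * ⟨ f , p (suc i) ⟩) (c * ⟨ f , p i ⟩) ⟩
      (⟨ f , X (p (suc i)) ⟩ − b * ⟨ f , p (suc i) ⟩ − c * ⟨ f , p i ⟩) + b * ⟨ f , p (suc i) ⟩ + c * ⟨ f , p i ⟩
        ≡⟨ cong (λ z → z + b * ⟨ f , p (suc i) ⟩ + c * ⟨ f , p i ⟩) (sym (⟨⟩-three f (X (p (suc i))) (p (suc i)) (p i) b c)) ⟩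
      ⟨ f , p (suc (suc i)) ⟩ + b * ⟨ f , p (suc i) ⟩ + c * ⟨ f , p i ⟩
        ≡⟨ cong₂ _+_ (cong₂ (λ y z → y + b * z) (⟨⟩-comm f (p (suc (suc i)))) (⟨⟩-comm f (p (suc i)))) (cong (c *_) (⟨⟩-comm f (p i))) ⟩
      ⟨ p (suc (suc i)) , f ⟩ + b * ⟨ p (suc i) , f ⟩ + c * ⟨ p i , f ⟩ ∎
      where
      b = mean (p (suc i))
      c = ratio (p (suc i)) (p i)

    -- Multiplication by the variable is self-adjoint, so it can be moved to p (suc i), where it
    -- raises the degree by one. Against lower degrees everything vanishes by induction; the two
    -- remaining cases i = j and i + 1 = j are cancelled by the choice of `mean` and `ratio`.
    orthogonal-step : ∀ j → j ℕ.< n → (∀ i → i ℕ.< suc j → ⟨ p i , p (suc j) ⟩ ≡ 0#) → (∀ i → i ℕ.< j → ⟨ p i , p j ⟩ ≡ 0#) →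
      ∀ i → i ℕ.≤ j → ⟨ p (suc i) , p (suc (suc j)) ⟩ ≡ 0#
    orthogonal-step j j<N previous before i i≤j = begin
      ⟨ p (suc i) , p (suc (suc j)) ⟩ ≡⟨ ⟨⟩-three (p (suc i)) (X (p (suc j))) (p (suc j)) (p j) b c ⟩
      ⟨ p (suc i) , X (p (suc j)) ⟩ − b * ⟨ p (suc i) , p (suc j) ⟩ − c * ⟨ p (suc i) , p j ⟩ ≡⟨ cases (ℕP.m≤n⇒m<n∨m≡n i≤j) ⟩
      0# ∎
      where
      b = mean (p (suc j))
      c = ratio (p (suc j)) (p j)
      cases : i ℕ.< j ⊎ i ≡ j → ⟨ p (suc i) , X (p (suc j)) ⟩ − b * ⟨ p (suc i) , p (suc j) ⟩ − c * ⟨ p (suc i) , p j ⟩ ≡ 0#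
      cases (inj₂ refl) = begin
        ⟨ p (suc j) , X (p (suc j)) ⟩ − b * h (suc j) − c * ⟨ p (suc j) , p j ⟩
          ≡⟨ cong₂ (λ y z → y − b * h (suc j) − c * z) (⟨⟩-X (p (suc j)) (p (suc j)))
               (trans (⟨⟩-comm (p (suc j)) (p j)) (previous j ℕP.≤-refl)) ⟩
        x − x * h (suc j) ⁻¹ * h (suc j) − c * 0#
          ≡⟨ solve 4 (λ x i h c → x :- x :* i :* h :- c :* κ 0 := x :* (κ 1 :- h :* i)) refl x (h (suc j) ⁻¹) (h (suc j)) c ⟩
        x * (1# − h (suc j) * h (suc j) ⁻¹) ≡⟨ cong (λ z → x * (1# − z)) (⁻¹-inverseʳ (h≢0 j j<N)) ⟩
        x * (1# − 1#) ≡⟨ solve 1 (λ x → x :* (κ 1 :- κ 1) := κ 0) refl x ⟩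
        0# ∎
        where x = ⟨ X (p (suc j)) , p (suc j) ⟩
      cases (inj₁ i<j) = begin
        ⟨ p (suc i) , X (p (suc j)) ⟩ − b * ⟨ p (suc i) , p (suc j) ⟩ − c * ⟨ p (suc i) , p j ⟩
          ≡⟨ cong₂ (λ y z → y − b * z − c * ⟨ p (suc i) , p j ⟩) expand (previous (suc i) (s≤s i<j)) ⟩
        ⟨ p (suc (suc i)) , p (suc j) ⟩ − b * 0# − c * ⟨ p (suc i) , p j ⟩ ≡⟨ last (ℕP.m≤n⇒m<n∨m≡n i<j) ⟩
        0# ∎
        where
        expand : ⟨ p (suc i) , X (p (suc j)) ⟩ ≡ ⟨ p (suc (suc i)) , p (suc j) ⟩
        expand = begin
          ⟨ p (suc i) , X (p (suc j)) ⟩ ≡⟨ ⟨⟩-X (p (suc i)) (p (suc j)) ⟩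
          ⟨ X (p (suc i)) , p (suc j) ⟩ ≡⟨ ⟨Xp,⟩ i (p (suc j)) ⟩
          ⟨ p (suc (suc i)) , p (suc j) ⟩ + mean (p (suc i)) * ⟨ p (suc i) , p (suc j) ⟩ + ratio (p (suc i)) (p i) * ⟨ p i , p (suc j) ⟩
            ≡⟨ cong₂ (λ y z → ⟨ p (suc (suc i)) , p (suc j) ⟩ + mean (p (suc i)) * y + ratio (p (suc i)) (p i) * z)
                 (previous (suc i) (s≤s i<j)) (previous i (ℕP.m<n⇒m<1+n i<j)) ⟩
          ⟨ p (suc (suc i)) , p (suc j) ⟩ + mean (p (suc i)) * 0# + ratio (p (suc i)) (p i) * 0#
            ≡⟨ solve 3 (λ x y z → x :+ y :* κ 0 :+ z :* κ 0 := x) refl ⟨ p (suc (suc i)) , p (suc j) ⟩ (mean (p (suc i))) (ratio (p (suc i)) (p i)) ⟩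
          ⟨ p (suc (suc i)) , p (suc j) ⟩ ∎
        last : suc i ℕ.< j ⊎ suc i ≡ j → ⟨ p (suc (suc i)) , p (suc j) ⟩ − b * 0# − c * ⟨ p (suc i) , p j ⟩ ≡ 0#
        last (inj₁ q) = trans (cong₂ (λ y z → y − b * 0# − c * z) (previous (suc (suc i)) (s≤s q)) (before (suc i) q))
          (solve 2 (λ b c → κ 0 :- b :* κ 0 :- c :* κ 0 := κ 0) refl b c)
        last (inj₂ refl) = begin
          h (suc j) − b * 0# − h (suc j) * h j ⁻¹ * h j
            ≡⟨ solve 4 (λ x b i y → x :- b :* κ 0 :- x :* i :* y := x :* (κ 1 :- y :* i)) refl (h (suc j)) b (h j ⁻¹) (h j) ⟩
          h (suc j) * (1# − h j * h j ⁻¹) ≡⟨ cong (λ z → h (suc j) * (1# − z)) (⁻¹-inverseʳ (h≢0 i (ℕP.<⇒≤ j<N))) ⟩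
          h (suc j) * (1# − 1#) ≡⟨ solve 1 (λ x → x :* (κ 1 :- κ 1) := κ 0) refl (h (suc j)) ⟩
          0# ∎

    orthogonal : ∀ j → j ℕ.≤ suc n → ∀ i → i ℕ.< j → ⟨ p i , p j ⟩ ≡ 0#
    orthogonal j _ zero _ = ⟨⟩-zeroˡ (p j) (λ _ _ → refl)
    orthogonal (suc zero) _ (suc i) (s≤s ())
    orthogonal (suc (suc j)) (s≤s j<N) (suc i) (s≤s (s≤s i≤j)) = orthogonal-step j j<N
      (orthogonal (suc j) (ℕP.m≤n⇒m≤1+n j<N)) (orthogonal j (ℕP.m≤n⇒m≤1+n (ℕP.<⇒≤ j<N))) i i≤j

    orthogonal-≢ : ∀ {i j} → i ℕ.≤ suc n → j ℕ.≤ suc n → i ≢ j → ⟨ p i , p j ⟩ ≡ 0#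
    orthogonal-≢ {i} {j} i≤ j≤ i≢j with ℕP.≤-total i j
    ... | inj₁ q = orthogonal j j≤ i (ℕP.≤∧≢⇒< q i≢j)
    ... | inj₂ q = trans (⟨⟩-comm (p i) (p j)) (orthogonal i i≤ j (ℕP.≤∧≢⇒< q (i≢j ∘ sym)))

    -- The n + 1 functions g, p 1, ..., p n on n nodes are linearly dependent. Pairing a dependency
    -- with each p j kills the coefficient of p j, so only a nonzero multiple of g is left.
    complete : ∀ g → (∀ j → 1 ℕ.≤ j → j ℕ.≤ n → ⟨ g , p j ⟩ ≡ 0#) → ∀ l → l ℕ.< n → g l ≡ 0#
    complete g g⊥p l l<N = *-cancelˡ-≡0 c₀≢0 (begin
        c Fin.zero * g l ≡⟨ cong (λ y → c Fin.zero * g y) (sym (FinP.toℕ-fromℕ< l<N)) ⟩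
        c Fin.zero * g (toℕ (fromℕ< l<N)) ≡⟨ *-comm _ _ ⟩
        column 0 (toℕ (fromℕ< l<N)) * c Fin.zero ≡⟨ sym (∑-single Fin.zero λ
           { Fin.zero q → ⊥-elim (q refl) ; (Fin.suc k) _ → trans (cong (_ *_) (c≡0 k)) (zeroʳ _) }) ⟩
        ∑ (λ k → column (toℕ k) (toℕ (fromℕ< l<N)) * c k) ≡⟨ sat (fromℕ< l<N) ⟩
        0# ∎)
      where
      column : ℕ → ℕ → ℝ
      column zero = g
      column (suc j) = p (suc j)
      solution : NontrivialSolution {n} {suc n} (λ l k → column (toℕ k) (toℕ l))
      solution = underdetermined ℕP.≤-refl _
      c = proj₁ solution
      sat = proj₂ (proj₂ solution)
      column⊥ : ∀ (i : Fin n) (k : Fin (suc n)) → k ≢ Fin.suc i → ⟨ column (toℕ k) , p (suc (toℕ i)) ⟩ ≡ 0#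
      column⊥ i Fin.zero _ = g⊥p (suc (toℕ i)) (s≤s z≤n) (FinP.toℕ<n i)
      column⊥ i (Fin.suc k) q = orthogonal-≢ (ℕP.m≤n⇒m≤1+n (FinP.toℕ<n k)) (ℕP.m≤n⇒m≤1+n (FinP.toℕ<n i))
        (λ e → q (cong Fin.suc (FinP.toℕ-injective (ℕP.suc-injective e))))
      c≡0 : ∀ (i : Fin n) → c (Fin.suc i) ≡ 0#
      c≡0 i = *-cancelˡ-≡0 (h≢0 (toℕ i) (FinP.toℕ<n i)) (begin
        h (suc (toℕ i)) * c (Fin.suc i) ≡⟨ sym (∑-single (Fin.suc i) (λ k q → trans (cong (_* c k) (column⊥ i k q)) (zeroˡ _))) ⟩
        ∑ (λ k → ⟨ column (toℕ k) , p (suc (toℕ i)) ⟩ * c k)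
          ≡⟨ ∑-cong (λ k → trans (cong (_* c k) (Sum≡∑ n _)) (sym (∑-*ʳ (c k) _))) ⟩
        ∑ (λ k → ∑ {n} (λ l → w (toℕ l) * (column (toℕ k) (toℕ l) * p (suc (toℕ i)) (toℕ l)) * c k)) ≡⟨ ∑-swap _ ⟩
        ∑ {n} (λ l → ∑ (λ k → w (toℕ l) * (column (toℕ k) (toℕ l) * p (suc (toℕ i)) (toℕ l)) * c k))
          ≡⟨ ∑-cong (λ l → trans (∑-cong (λ k → solve 4 (λ w x y z → w :* (x :* y) :* z := (w :* y) :* (x :* z)) refl
                (w (toℕ l)) (column (toℕ k) (toℕ l)) (p (suc (toℕ i)) (toℕ l)) (c k)))
              (trans (∑-*ˡ _ _) (trans (cong (w (toℕ l) * p (suc (toℕ i)) (toℕ l) *_) (sat l)) (zeroʳ _)))) ⟩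
        ∑ {n} (λ l → 0#) ≡⟨ ∑-zero {n} (λ _ → refl) ⟩
        0# ∎)
      c₀≢0 : c Fin.zero ≢ 0#
      c₀≢0 e with proj₁ (proj₂ solution)
      ... | Fin.zero , q = q e
      ... | Fin.suc k , q = q (c≡0 k)

    -- The degree n equals the number of nodes, so this is the node polynomial. The recurrence
    -- therefore stops after p n, which turns it into a finite Jacobi matrix with the nodes as
    -- eigenvalues.
    p-vanish : ∀ l → l ℕ.< n → p (suc n) l ≡ 0#
    p-vanish = complete (p (suc n)) λ j _ j≤N →
      orthogonal-≢ ℕP.≤-refl (ℕP.m≤n⇒m≤1+n j≤N) (λ e → ℕP.<-irrefl (sym e) (s≤s j≤N))

    -- Fixed by pairing the signed binomials with p n: the M-th difference of p n is `lead M`, while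
    -- the norm of p n is `h n`.
    K : ℝ
    K = lead M * h n ⁻¹

    K≢0 : K ≢ 0#
    K≢0 = *-≢0 (lead≢0 M) (⁻¹-≢0 (h≢0 M ℕP.≤-refl))

    -- Both sides pair to zero with all polynomials of degree less than M, the left
    -- one by orthogonality and the right one as an M-th difference.
    last-values : ∀ l → l ℕ.< n → K * (w l * p n l) ≡ sgn l * binomial M l
    last-values l l<N = begin
      K * (w l * p n l) ≡⟨ solve 3 (λ k w y → k :* (w :* y) := w :* (k :* y)) refl K (w l) (p n l) ⟩
      w l * (K * p n l) ≡⟨ cong (w l *_) (sym (−≡0⇒≡ (complete g g⊥p l l<N))) ⟩
      w l * (s l * w l ⁻¹) ≡⟨ solve 3 (λ w s i → w :* (s :* i) := s :* (w :* i)) refl (w l) (s l) (w l ⁻¹) ⟩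
      s l * (w l * w l ⁻¹) ≡⟨ cong (s l *_) (⁻¹-inverseʳ (proj₂ (w>0 l (ℕP.≤-pred l<N)))) ⟩
      s l * 1# ≡⟨ trans (*-comm _ _) (*-identityˡ _) ⟩
      s l ∎
      where
      s g : ℕ → ℝ
      s l = sgn l * binomial M l
      g l = s l * w l ⁻¹ − K * p n l
      pairing : ∀ f → ⟨ g , f ⟩ ≡ ∇ M f 0 − K * ⟨ p n , f ⟩
      pairing f = begin
        Sum n (λ l → w l * (g l * f l)) ≡⟨ Sum-cong (λ l l<N → begin
            w l * ((s l * w l ⁻¹ − K * p n l) * f l)
              ≡⟨ solve 6 (λ w s i k y f → w :* ((s :* i :- k :* y) :* f) := (w :* i) :* (s :* f) :- k :* (w :* (y :* f))) refl (w l) (s l) (w l ⁻¹) K (p n l) (f l) ⟩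
            w l * w l ⁻¹ * (s l * f l) − K * (w l * (p n l * f l))
              ≡⟨ cong (_− K * (w l * (p n l * f l))) (trans (cong (_* (s l * f l)) (⁻¹-inverseʳ (proj₂ (w>0 l (ℕP.≤-pred l<N))))) (*-identityˡ _)) ⟩
            s l * f l − K * (w l * (p n l * f l)) ∎) ⟩
        Sum n (λ l → s l * f l − K * (w l * (p n l * f l))) ≡⟨ Sum-− _ _ ⟩
        Sum n (λ l → s l * f l) − Sum n (λ l → K * (w l * (p n l * f l)))
          ≡⟨ cong₂ _−_ (sym (∇-binomial M f 0)) (Sum-*ˡ K _) ⟩
        ∇ M f 0 − K * ⟨ p n , f ⟩ ∎
      g⊥p : ∀ j → 1 ℕ.≤ j → j ℕ.≤ n → ⟨ g , p j ⟩ ≡ 0#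
      g⊥p j 1≤j j≤N with ℕP.m≤n⇒m<n∨m≡n j≤N
      ... | inj₁ (s≤s j≤M) = trans (pairing (p j)) (trans (cong₂ (λ y z → y − K * z) (∇-vanish j j≤M 0)
              (orthogonal-≢ (ℕP.n≤1+n n) (ℕP.m≤n⇒m≤1+n j≤N) (λ e → ℕP.<-irrefl (sym e) (s≤s j≤M))))
              (solve 1 (λ k → κ 0 :- k :* κ 0 := κ 0) refl K))
      ... | inj₂ refl = begin
        ⟨ g , p n ⟩ ≡⟨ pairing (p n) ⟩
        ∇ M (p n) 0 − lead M * h n ⁻¹ * h n ≡⟨ cong (_− lead M * h n ⁻¹ * h n) (∇-lead M 0) ⟩
        lead M − lead M * h n ⁻¹ * h n ≡⟨ solve 3 (λ L i h → L :- L :* i :* h := L :* (κ 1 :- h :* i)) refl (lead M) (h n ⁻¹) (h n) ⟩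
        lead M * (1# − h n * h n ⁻¹) ≡⟨ cong (λ z → lead M * (1# − z)) (⁻¹-inverseʳ (h≢0 M ℕP.≤-refl)) ⟩
        lead M * (1# − 1#) ≡⟨ solve 1 (λ x → x :* (κ 1 :- κ 1) := κ 0) refl (lead M) ⟩
        0# ∎

  -- Pencils on cycles with double eigenvalues

  δ : ℕ → ℕ → ℝ
  δ i j with i ℕ.≟ j
  ... | yes _ = 1#
  ... | no _ = 0#

  δ-≡ : ∀ {i j} → i ≡ j → δ i j ≡ 1#
  δ-≡ {i} {j} p with i ℕ.≟ j
  ... | yes _ = refl
  ... | no q = ⊥-elim (q p)

  δ-≢ : ∀ {i j} → i ≢ j → δ i j ≡ 0#
  δ-≢ {i} {j} p with i ℕ.≟ j
  ... | yes q = ⊥-elim (p q)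
  ... | no _ = refl

  Sum-δ : ∀ {k} i (f : ℕ → ℝ) → i ℕ.< k → Sum k (λ j → δ i j * f j) ≡ f i
  Sum-δ i f i<k = trans (Sum-single (λ j → δ i j * f j) i i<k (λ j q → trans (cong (_* f j) (δ-≢ (q ∘ sym))) (zeroˡ _)))
    (trans (cong (_* f i) (δ-≡ {i} refl)) (*-identityˡ _))

  δ-*-cong : ∀ i j (f : ℕ → ℝ) → f i * δ i j ≡ f j * δ j i
  δ-*-cong i j f with i ℕ.≟ j | j ℕ.≟ i
  ... | yes refl | yes _ = refl
  ... | yes refl | no q = ⊥-elim (q refl)
  ... | no q | yes refl = ⊥-elim (q refl)
  ... | no _ | no _ = trans (zeroʳ _) (sym (zeroʳ _))

  -- u is an eigenbasis of the pencil S − x D for the eigenvalues 0, 0, 2, 2, 4, 4, ….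
  record CyclePencil (m : ℕ) : Set where
    field
      S : ℕ → ℕ → ℝ
      D : ℕ → ℝ
      u : ℕ → ℕ → ℝ
      S-sym : ∀ i j → S i j ≡ S j i
      S-neighbour : ∀ {i j} → i ℕ.< m → j ℕ.< m → CycleNeighbour m i j → S i j ≢ 0#
      S-other : ∀ {i j} → i ℕ.< m → j ℕ.< m → i ≢ j → ¬ CycleNeighbour m i j → S i j ≡ 0#
      D≢0 : ∀ i → i ℕ.< m → D i ≢ 0#
      eigen : ∀ c i → c ℕ.< m → i ℕ.< m → Sum m (λ j → S i j * u c j) ≡ ι (ev c) * (D i * u c i)
      u-orthogonal : ∀ c d → c ℕ.< m → d ℕ.< m → c ≢ d → Sum m (λ i → D i * (u c i * u d i)) ≡ 0#
      u-norm : ∀ c → c ℕ.< m → Sum m (λ i → D i * (u c i * u c i)) ≢ 0#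

  -- The eigenvalue equation of one vector is only needed on the support of the other.
  pencil-orthogonal : ∀ {m x y} (S : ℕ → ℕ → ℝ) (D u v : ℕ → ℝ) → (∀ i j → S i j ≡ S j i) → x − y ≢ 0# →
    (∀ i → i ℕ.< m → v i * Sum m (λ j → S i j * u j) ≡ v i * (x * (D i * u i))) →
    (∀ i → i ℕ.< m → u i * Sum m (λ j → S i j * v j) ≡ u i * (y * (D i * v i))) →
    Sum m (λ i → D i * (u i * v i)) ≡ 0#
  pencil-orthogonal {m} {x} {y} S D u v S-sym x≢y eq-u eq-v = *-cancelˡ-≡0 x≢y (begin
    (x − y) * B ≡⟨ solve 3 (λ x y b → (x :- y) :* b := x :* b :- y :* b) refl x y B ⟩
    x * B − y * B ≡⟨ cong₂ _−_ (sym lhs) (sym rhs) ⟩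
    Sum m (λ i → v i * Sum m (λ j → S i j * u j)) − Sum m (λ i → u i * Sum m (λ j → S i j * v j))
      ≡⟨ cong (_− Sum m (λ i → u i * Sum m (λ j → S i j * v j))) symmetric ⟩
    Sum m (λ i → u i * Sum m (λ j → S i j * v j)) − Sum m (λ i → u i * Sum m (λ j → S i j * v j)) ≡⟨ -‿inverseʳ _ ⟩
    0# ∎)
    where
    B = Sum m (λ i → D i * (u i * v i))
    lhs : Sum m (λ i → v i * Sum m (λ j → S i j * u j)) ≡ x * B
    lhs = trans (Sum-cong λ i i<m → trans (eq-u i i<m)
      (solve 4 (λ v x d u → v :* (x :* (d :* u)) := x :* (d :* (u :* v))) refl (v i) x (D i) (u i))) (Sum-*ˡ x _)
    rhs : Sum m (λ i → u i * Sum m (λ j → S i j * v j)) ≡ y * B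
    rhs = trans (Sum-cong λ i i<m → trans (eq-v i i<m)
      (solve 4 (λ u y d v → u :* (y :* (d :* v)) := y :* (d :* (u :* v))) refl (u i) y (D i) (v i))) (Sum-*ˡ y _)
    symmetric : Sum m (λ i → v i * Sum m (λ j → S i j * u j)) ≡ Sum m (λ i → u i * Sum m (λ j → S i j * v j))
    symmetric = begin
      Sum m (λ i → v i * Sum m (λ j → S i j * u j)) ≡⟨ Sum-cong (λ i _ → sym (Sum-*ˡ (v i) _)) ⟩
      Sum m (λ i → Sum m (λ j → v i * (S i j * u j))) ≡⟨ Sum-swap _ ⟩
      Sum m (λ j → Sum m (λ i → v i * (S i j * u j))) ≡⟨ Sum-cong (λ j _ → trans
          (Sum-cong λ i _ → trans (cong (λ s → v i * (s * u j)) (S-sym i j))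
            (solve 3 (λ v s u → v :* (s :* u) := u :* (s :* v)) refl (v i) (S j i) (u j)))
          (Sum-*ˡ (u j) _)) ⟩
      Sum m (λ j → u j * Sum m (λ i → S j i * v i)) ∎

  -- The vertex suc j carries p (suc j).  The vertex 0 is joined to 1 and n with weights 1
  -- and − K, and S − x D has the Schur complement − a F(x) at 0.
  module Bordered (M : ℕ) (M≥1 : 1 ℕ.≤ M) (w : ℕ → ℝ) (w>0 : ∀ l → l ℕ.≤ M → Pos (w l))
    (PF : PartialFractions (suc M)) (a : ℝ) (a>0 : Pos a) where
    open Orthogonal M w w>0
    open PartialFractions PF

    m : ℕ
    m = suc n

    -- The defect in row 0 when the path eigenvector for the node l is extended by 0 to the vertex
    -- 0, since the neighbours of that vertex carry p 1 = 1 and p n. The extension is an eigenvector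
    -- of the cycle exactly when this vanishes.
    ε : ℕ → ℝ
    ε l = 1# − K * p n l

    -- Dividing the recurrence for p (suc j) by h (suc j) makes it symmetric, because `ratio` is a
    -- quotient of consecutive h. This keeps the monic normalisation and avoids the square roots of
    -- orthonormal polynomials; the price is the diagonal D of inverse norms. At the vertex 0 the
    -- pencil has the entry a (b - x), the polynomial part of - a F(x).
    diag up D : ℕ → ℝ
    diag zero = a * b
    diag (suc j) = mean (p (suc j)) * h (suc j) ⁻¹
    up zero = 1#
    up (suc j) = h (suc j) ⁻¹
    D zero = a
    D (suc j) = h (suc j) ⁻¹

    S : ℕ → ℕ → ℝ
    S i j = diag i * δ i j + (up i * δ (suc i) j + up j * δ (suc j) i) + - K * (δ 0 i * δ n j + δ 0 j * δ n i)

    S-sym : ∀ i j → S i j ≡ S j i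
    S-sym i j = cong₂ _+_ (cong₂ _+_ (δ-*-cong i j diag) (+-comm _ _)) (cong (- K *_) (+-comm _ _))

    up≢0 : ∀ i → i ℕ.< n → up i ≢ 0#
    up≢0 zero _ = proj₂ Pos-1
    up≢0 (suc i) i<n = ⁻¹-≢0 (h≢0 i (ℕP.<⇒≤ i<n))

    D>0 : ∀ i → i ℕ.< m → Pos (D i)
    D>0 zero _ = a>0
    D>0 (suc i) (s≤s i<n) = Pos-⁻¹ (h>0 i i<n)

    S-next : ∀ i → i ℕ.< n → S i (suc i) ≢ 0#
    S-next i i<n e = up≢0 i i<n (trans (sym eq) e)
      where
      wrap : ∀ i → δ 0 i * δ n (suc i) ≡ 0#
      -- For n = 1 the closing edge would coincide with the edge from 0 to 1; `M≥1` excludes this.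
      wrap zero = trans (cong (δ 0 0 *_) (δ-≢ (λ q → ℕP.<-irrefl (sym q) (s≤s M≥1)))) (zeroʳ _)
      wrap (suc i) = trans (cong (_* δ n (suc (suc i))) (δ-≢ {0} {suc i} λ ())) (zeroˡ _)
      eq : S i (suc i) ≡ up i
      eq = begin
        S i (suc i) ≡⟨ cong₂ (λ y z → diag i * y + (up i * z + up (suc i) * δ (suc (suc i)) i) + - K * (δ 0 i * δ n (suc i) + δ 0 (suc i) * δ n i))
             (δ-≢ {i} {suc i} λ ()) (δ-≡ {suc i} refl) ⟩
        diag i * 0# + (up i * 1# + up (suc i) * δ (suc (suc i)) i) + - K * (δ 0 i * δ n (suc i) + δ 0 (suc i) * δ n i)
          ≡⟨ cong₂ (λ y z → diag i * 0# + (up i * 1# + up (suc i) * y) + - K * z) (δ-≢ {suc (suc i)} {i} λ ())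
               (cong₂ _+_ (wrap i) (trans (cong (_* δ n i) (δ-≢ {0} {suc i} λ ())) (zeroˡ _))) ⟩
        diag i * 0# + (up i * 1# + up (suc i) * 0#) + - K * (0# + 0#)
          ≡⟨ solve 4 (λ d u v k → d :* κ 0 :+ (u :* κ 1 :+ v :* κ 0) :+ :- k :* (κ 0 :+ κ 0) := u) refl (diag i) (up i) (up (suc i)) K ⟩
        up i ∎

    S-wrap : S n 0 ≢ 0#
    S-wrap e = neg-≢0 K≢0 (trans (sym eq) e)
      where
      eq : S n 0 ≡ - K
      eq = begin
        S n 0 ≡⟨ cong₂ (λ y z → diag n * y + (up n * z + up 0 * δ 1 n) + - K * (δ 0 n * δ n 0 + δ 0 0 * δ n n))
             (δ-≢ {n} {0} λ ()) (δ-≢ {suc n} {0} λ ()) ⟩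
        diag n * 0# + (up n * 0# + up 0 * δ 1 n) + - K * (δ 0 n * δ n 0 + δ 0 0 * δ n n)
          ≡⟨ cong₂ (λ y z → diag n * 0# + (up n * 0# + up 0 * y) + - K * z) (δ-≢ {1} {n} (λ q → ℕP.<-irrefl q (s≤s M≥1)))
               (cong₂ _+_ (trans (cong (_* δ n 0) (δ-≢ {0} {n} λ ())) (zeroˡ _)) (cong₂ _*_ (δ-≡ {0} refl) (δ-≡ {n} refl))) ⟩
        diag n * 0# + (up n * 0# + up 0 * 0#) + - K * (0# + 1# * 1#)
          ≡⟨ solve 4 (λ d u v k → d :* κ 0 :+ (u :* κ 0 :+ v :* κ 0) :+ :- k :* (κ 0 :+ κ 1 :* κ 1) := :- k) refl (diag n) (up n) (up 0) K ⟩
        - K ∎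

    S-successor : ∀ {i j} → i ℕ.< m → succMod m i ≡ j → S i j ≢ 0#
    S-successor {i} i<m refl with succMod-cases m i
    ... | inj₁ (refl , q) = subst (λ j → S i j ≢ 0#) (sym q) S-wrap
    ... | inj₂ (i≢n , q) = subst (λ j → S i j ≢ 0#) (sym q) (S-next i (ℕP.≤∧≢⇒< (ℕP.≤-pred i<m) (i≢n ∘ cong suc)))

    S-neighbour : ∀ {i j} → i ℕ.< m → j ℕ.< m → CycleNeighbour m i j → S i j ≢ 0#
    S-neighbour i<m _ (inj₁ q) = S-successor i<m q
    S-neighbour {i} {j} _ j<m (inj₂ q) = subst (_≢ 0#) (S-sym j i) (S-successor j<m q)

    S-other : ∀ {i j} → i ℕ.< m → j ℕ.< m → i ≢ j → ¬ CycleNeighbour m i j → S i j ≡ 0#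
    S-other {i} {j} i<m j<m i≢j ¬nb = begin
      S i j ≡⟨ cong₂ _+_ (cong₂ (λ y z → diag i * y + z) (δ-≢ i≢j)
          (cong₂ (λ y z → up i * y + up j * z)
            (δ-≢ λ q → ¬nb (inj₁ (trans (succMod-< (subst (ℕ._< m) (sym q) j<m)) q)))
            (δ-≢ λ q → ¬nb (inj₂ (trans (succMod-< (subst (ℕ._< m) (sym q) i<m)) q)))))
          (cong (- K *_) (cong₂ _+_ (wrap i j (λ { refl refl → ¬nb (inj₂ (succMod-last refl)) })) (wrap j i (λ { refl refl → ¬nb (inj₁ (succMod-last refl)) })))) ⟩
      diag i * 0# + (up i * 0# + up j * 0#) + - K * (0# + 0#)
        ≡⟨ solve 4 (λ d u v k → d :* κ 0 :+ (u :* κ 0 :+ v :* κ 0) :+ :- k :* (κ 0 :+ κ 0) := κ 0) refl (diag i) (up i) (up j) K ⟩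
      0# ∎
      where
      wrap : ∀ i j → (0 ≡ i → n ≡ j → ⊥) → δ 0 i * δ n j ≡ 0#
      wrap i j q with 0 ℕ.≟ i
      ... | yes z = trans (cong (_ *_) (δ-≢ (q z))) (zeroʳ _)
      ... | no _ = zeroˡ _

    S-column₀ : ∀ j → S (suc j) 0 ≡ δ 1 (suc j) − K * δ n (suc j)
    S-column₀ j = begin
      S (suc j) 0 ≡⟨ cong₂ (λ y z → diag (suc j) * y + (up (suc j) * z + 1# * δ 1 (suc j)) + - K * (δ 0 (suc j) * δ n 0 + δ 0 0 * δ n (suc j)))
          (δ-≢ {suc j} {0} λ ()) (δ-≢ {suc (suc j)} {0} λ ()) ⟩
      diag (suc j) * 0# + (up (suc j) * 0# + 1# * δ 1 (suc j)) + - K * (δ 0 (suc j) * δ n 0 + δ 0 0 * δ n (suc j))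
        ≡⟨ cong₂ (λ y z → diag (suc j) * 0# + (up (suc j) * 0# + 1# * δ 1 (suc j)) + - K * (y * δ n 0 + z * δ n (suc j)))
             (δ-≢ {0} {suc j} λ ()) (δ-≡ {0} refl) ⟩
      diag (suc j) * 0# + (up (suc j) * 0# + 1# * δ 1 (suc j)) + - K * (0# * δ n 0 + 1# * δ n (suc j))
        ≡⟨ solve 6 (λ d u x k y z → d :* κ 0 :+ (u :* κ 0 :+ κ 1 :* x) :+ :- k :* (κ 0 :* y :+ κ 1 :* z) := x :- k :* z) refl
             (diag (suc j)) (up (suc j)) (δ 1 (suc j)) K (δ n 0) (δ n (suc j)) ⟩
      δ 1 (suc j) − K * δ n (suc j) ∎

    S-00 : S 0 0 ≡ a * b
    S-00 = begin
      S 0 0 ≡⟨ cong₂ (λ y z → a * b * y + (1# * z + 1# * z) + - K * (δ 0 0 * δ n 0 + δ 0 0 * δ n 0)) (δ-≡ {0} refl) (δ-≢ {1} {0} λ ()) ⟩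
      a * b * 1# + (1# * 0# + 1# * 0#) + - K * (δ 0 0 * δ n 0 + δ 0 0 * δ n 0)
        ≡⟨ cong (λ z → a * b * 1# + (1# * 0# + 1# * 0#) + - K * (δ 0 0 * z + δ 0 0 * z)) (δ-≢ {n} {0} λ ()) ⟩
      a * b * 1# + (1# * 0# + 1# * 0#) + - K * (δ 0 0 * 0# + δ 0 0 * 0#)
        ≡⟨ solve 3 (λ x k y → x :* κ 1 :+ (κ 1 :* κ 0 :+ κ 1 :* κ 0) :+ :- k :* (y :* κ 0 :+ y :* κ 0) := x) refl (a * b) K (δ 0 0) ⟩
      a * b ∎

    previous : ℕ → (ℕ → ℝ) → ℝ
    previous zero v = 0#
    previous (suc i) v = up i * v i

    -- The condition `v m ≡ 0#` gives the last row the same formula as the others, although its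
    -- successor lies outside the cycle. For the path eigenvectors it is `p-vanish`.
    S-row : ∀ i (v : ℕ → ℝ) → i ℕ.< m → v m ≡ 0# →
      Sum m (λ j → S i j * v j) ≡ diag i * v i + (up i * v (suc i) + previous i v) + - K * (δ 0 i * v n + δ n i * v 0)
    S-row i v i<m v≡0 = begin
      Sum m (λ j → S i j * v j) ≡⟨ Sum-cong (λ j _ → solve 11 (λ d x u y t z k o q r v →
          (d :* x :+ (u :* y :+ t :* z) :+ :- k :* (o :* q :+ r)) :* v :=
          d :* (x :* v) :+ (u :* (y :* v) :+ z :* (t :* v)) :+ :- k :* (o :* (q :* v) :+ r :* v)) refl
          (diag i) (δ i j) (up i) (δ (suc i) j) (up j) (δ (suc j) i) K (δ 0 i) (δ n j) (δ 0 j * δ n i) (v j)) ⟩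
      Sum m (λ j → diag i * (δ i j * v j) + (up i * (δ (suc i) j * v j) + δ (suc j) i * (up j * v j)) + - K * (δ 0 i * (δ n j * v j) + δ 0 j * δ n i * v j))
        ≡⟨ trans (Sum-+ _ _) (cong₂ _+_ (trans (Sum-+ _ _) (cong₂ _+_ part₁ (trans (Sum-+ _ _) (cong₂ _+_ part₂ (part₃ i i<m))))) part₄) ⟩
      diag i * v i + (up i * v (suc i) + previous i v) + - K * (δ 0 i * v n + δ n i * v 0) ∎
      where
      part₁ : Sum m (λ j → diag i * (δ i j * v j)) ≡ diag i * v i
      part₁ = trans (Sum-*ˡ (diag i) _) (cong (diag i *_) (Sum-δ i v i<m))
      shifted : Sum m (λ j → δ (suc i) j * v j) ≡ v (suc i)
      shifted with ℕP.m≤n⇒m<n∨m≡n i<m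
      ... | inj₁ q = Sum-δ (suc i) v q
      ... | inj₂ refl = trans (Sum-zero λ j j<m → trans (cong (_* v j) (δ-≢ λ q → ℕP.<⇒≢ j<m (sym q))) (zeroˡ _)) (sym v≡0)
      part₂ : Sum m (λ j → up i * (δ (suc i) j * v j)) ≡ up i * v (suc i)
      part₂ = trans (Sum-*ˡ (up i) _) (cong (up i *_) shifted)
      part₃ : ∀ i → i ℕ.< m → Sum m (λ j → δ (suc j) i * (up j * v j)) ≡ previous i v
      part₃ zero _ = Sum-zero λ j _ → trans (cong (_* (up j * v j)) (δ-≢ {suc j} {0} λ ())) (zeroˡ _)
      part₃ (suc k) i<m = trans (Sum-single (λ j → δ (suc j) (suc k) * (up j * v j)) k (ℕP.<⇒≤ i<m)
              (λ j q → trans (cong (_* (up j * v j)) (δ-≢ {suc j} {suc k} (q ∘ ℕP.suc-injective))) (zeroˡ _)))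
            (trans (cong (_* (up k * v k)) (δ-≡ {suc k} refl)) (*-identityˡ _))
      part₄ : Sum m (λ j → - K * (δ 0 i * (δ n j * v j) + δ 0 j * δ n i * v j)) ≡ - K * (δ 0 i * v n + δ n i * v 0)
      part₄ = trans (Sum-*ˡ (- K) _) (cong (- K *_) (trans (Sum-+ _ _) (cong₂ _+_
        (trans (Sum-*ˡ (δ 0 i) _) (cong (δ 0 i *_) (Sum-δ n v ℕP.≤-refl)))
        (trans (Sum-cong λ j _ → solve 3 (λ x y z → x :* y :* z := y :* (x :* z)) refl (δ 0 j) (δ n i) (v j))
          (trans (Sum-*ˡ (δ n i) _) (cong (δ n i *_) (Sum-δ 0 v (s≤s z≤n))))))))

    V : ℕ → ℕ → ℝ
    V l j = p j l

    -- At j = 0 the two factors come from different sources, the edge weight 1 and the inverse of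
    -- the zero norm `h 0`; they agree after multiplication by p 0 = 0.
    up-p : ∀ j l → up j * p j l ≡ h j ⁻¹ * p j l
    up-p zero l = trans (zeroʳ _) (sym (zeroʳ _))
    up-p (suc j) l = refl

    V-row : ∀ l j → l ℕ.< n → j ℕ.< n → Sum m (λ i → S (suc j) i * V l i) ≡ ι l * (D (suc j) * V l (suc j))
    V-row l j l<n j<n = begin
      Sum m (λ i → S (suc j) i * V l i) ≡⟨ S-row (suc j) (V l) (s≤s j<n) (p-vanish l l<n) ⟩
      μ * g * y + (g * p (suc (suc j)) l + up j * p j l) + - K * (δ 0 (suc j) * p n l + δ n (suc j) * 0#)
        ≡⟨ cong₂ (λ s t → μ * g * y + (g * p (suc (suc j)) l + s) + - K * (t * p n l + δ n (suc j) * 0#)) (up-p j l) (δ-≢ {0} {suc j} λ ()) ⟩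
      μ * g * y + (g * (ι l * y − μ * y − h (suc j) * h j ⁻¹ * p j l) + h j ⁻¹ * p j l) + - K * (0# * p n l + δ n (suc j) * 0#)
        ≡⟨ solve 10 (λ μ g y x h i q k s t →
             μ :* g :* y :+ (g :* (x :* y :- μ :* y :- h :* i :* q) :+ i :* q) :+ :- k :* (κ 0 :* s :+ t :* κ 0) :=
             x :* (g :* y) :+ (κ 1 :- h :* g) :* (i :* q)) refl μ g y (ι l) (h (suc j)) (h j ⁻¹) (p j l) K (p n l) (δ n (suc j)) ⟩
      ι l * (g * y) + (1# − h (suc j) * g) * (h j ⁻¹ * p j l)
        ≡⟨ cong (λ z → ι l * (g * y) + (1# − z) * (h j ⁻¹ * p j l)) (⁻¹-inverseʳ (h≢0 j j<n)) ⟩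
      ι l * (g * y) + (1# − 1#) * (h j ⁻¹ * p j l) ≡⟨ solve 2 (λ x z → x :+ (κ 1 :- κ 1) :* z := x) refl (ι l * (g * y)) (h j ⁻¹ * p j l) ⟩
      ι l * (g * y) ∎
      where
      μ = mean (p (suc j))
      g = h (suc j) ⁻¹
      y = p (suc j) l

    V-row₀ : ∀ l → l ℕ.< n → Sum m (λ i → S 0 i * V l i) ≡ ε l
    V-row₀ l l<n = begin
      Sum m (λ i → S 0 i * V l i) ≡⟨ S-row 0 (V l) (s≤s z≤n) (p-vanish l l<n) ⟩
      a * b * 0# + (1# * 1# + 0#) + - K * (δ 0 0 * p n l + δ n 0 * 0#)
        ≡⟨ cong (λ z → a * b * 0# + (1# * 1# + 0#) + - K * (z * p n l + δ n 0 * 0#)) (δ-≡ {0} refl) ⟩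
      a * b * 0# + (1# * 1# + 0#) + - K * (1# * p n l + δ n 0 * 0#)
        ≡⟨ solve 4 (λ x k y z → x :* κ 0 :+ (κ 1 :* κ 1 :+ κ 0) :+ :- k :* (κ 1 :* y :+ z :* κ 0) := κ 1 :- k :* y) refl (a * b) K (p n l) (δ n 0) ⟩
      1# − K * p n l ∎

    V-orthogonal : ∀ {l k} → l ℕ.< n → k ℕ.< n → l ≢ k → Sum m (λ i → D i * (V l i * V k i)) ≡ 0#
    V-orthogonal {l} {k} l<n k<n l≢k = pencil-orthogonal S D (V l) (V k) S-sym (ι-≢ l≢k) (weak k l l<n) (weak l k k<n)
      where
      weak : ∀ k l → l ℕ.< n → ∀ i → i ℕ.< m → V k i * Sum m (λ j → S i j * V l j) ≡ V k i * (ι l * (D i * V l i))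
      -- Row 0 need not be an eigenvalue equation for an odd node, but the other vector is 0 at that
      -- vertex.
      weak k l l<n zero _ = trans (zeroˡ _) (sym (zeroˡ _))
      weak k l l<n (suc i) (s≤s i<n) = cong (V k (suc i) *_) (V-row l i l<n i<n)

    module Eigenvectors (ε-even : ∀ l → l ℕ.< n → Even l → ε l ≡ 0#)
                        (ε-odd : ∀ l → l ℕ.< n → w l * ε l * ε l ≡ a * e l) where
      -- By `border`, the column of S below the vertex 0 is D applied to the vector with
      -- coefficients w l * ε l in the path eigenvectors. Solving the path rows of the pencil at x
      -- divides each coefficient by x - l.
      τ : ℕ → ℕ → ℝ
      τ x l = w l * ε l * (ι x − ι l) ⁻¹

      τ-even : ∀ x {l} → l ℕ.< n → Even l → τ x l ≡ 0#
      τ-even x {l} l<n evl = trans (cong (λ z → w l * z * (ι x − ι l) ⁻¹) (ε-even l l<n evl))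
        (solve 2 (λ w i → w :* κ 0 :* i := κ 0) refl (w l) ((ι x − ι l) ⁻¹))

      Z : ℕ → ℕ → ℝ
      Z x j = δ 0 j + Sum n (λ l → τ x l * V l j)

      Z-0 : ∀ x → Z x 0 ≡ 1#
      Z-0 x = trans (cong₂ _+_ (δ-≡ {0} refl) (Sum-zero λ l _ → zeroʳ _)) (+-identityʳ 1#)

      Z-suc : ∀ x j → Z x (suc j) ≡ Sum n (λ l → τ x l * V l (suc j))
      Z-suc x j = trans (cong (_+ Sum n (λ l → τ x l * V l (suc j))) (δ-≢ {0} {suc j} λ ())) (+-identityˡ _)

      pair-Z : ∀ x (f : ℕ → ℝ) → Sum m (λ j → f j * Z x j) ≡ f 0 + Sum n (λ l → τ x l * Sum m (λ j → f j * V l j))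
      pair-Z x f = begin
        Sum m (λ j → f j * Z x j) ≡⟨ Sum-cong (λ j _ → trans (distribˡ (f j) (δ 0 j) _) (cong₂ _+_ (*-comm (f j) (δ 0 j)) (sym (Sum-*ˡ (f j) _)))) ⟩
        Sum m (λ j → δ 0 j * f j + Sum n (λ l → f j * (τ x l * V l j))) ≡⟨ Sum-+ _ _ ⟩
        Sum m (λ j → δ 0 j * f j) + Sum m (λ j → Sum n (λ l → f j * (τ x l * V l j))) ≡⟨ cong₂ _+_ (Sum-δ 0 f (s≤s z≤n)) (Sum-swap _) ⟩
        f 0 + Sum n (λ l → Sum m (λ j → f j * (τ x l * V l j)))
          ≡⟨ +-congˡ (Sum-cong λ l _ → trans (Sum-cong λ j _ → solve 3 (λ f t v → f :* (t :* v) := t :* (f :* v)) refl (f j) (τ x l) (V l j)) (Sum-*ˡ (τ x l) _)) ⟩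
        f 0 + Sum n (λ l → τ x l * Sum m (λ j → f j * V l j)) ∎

      τ-clear : ∀ x → Even x → ∀ l → l ℕ.< n → τ x l * (ι x − ι l) ≡ w l * ε l
      τ-clear x ev-x l l<n with x ℕ.≟ l
      -- At the node l = x the division is meaningless, but there ε vanishes and so do both sides.
      ... | yes refl = trans (cong (_* (ι x − ι x)) (τ-even x l<n ev-x)) (trans (zeroˡ _)
              (sym (trans (cong (w l *_) (ε-even l l<n ev-x)) (zeroʳ _))))
      ... | no x≢l = trans (solve 3 (λ t i d → t :* i :* d := t :* (d :* i)) refl (w l * ε l) ((ι x − ι l) ⁻¹) (ι x − ι l))
              (trans (cong (w l * ε l *_) (⁻¹-inverseʳ (ι-≢ x≢l))) (trans (*-comm _ _) (*-identityˡ _)))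

      normalised : ∀ {i} j → i ℕ.≤ n → j ℕ.< n → h (suc j) ⁻¹ * ⟨ p i , p (suc j) ⟩ ≡ δ i (suc j)
      normalised {i} j i≤n j<n with i ℕ.≟ suc j
      ... | yes refl = trans (*-comm _ _) (⁻¹-inverseʳ (h≢0 j j<n))
      ... | no q = trans (cong (h (suc j) ⁻¹ *_) (orthogonal-≢ (ℕP.m≤n⇒m≤1+n i≤n) (ℕP.m≤n⇒m≤1+n j<n) q)) (zeroʳ _)

      -- Since ε is p 1 - K p n, orthogonality leaves only the components at 1 and n, and these are
      -- the neighbours of the vertex 0 with their edge weights.
      border : ∀ j → j ℕ.< n → D (suc j) * Sum n (λ l → w l * ε l * p (suc j) l) ≡ S (suc j) 0
      border j j<n = begin
        g * Sum n (λ l → w l * ε l * p (suc j) l)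
          ≡⟨ cong (g *_) (Sum-cong λ l _ → solve 4 (λ w k y z → w :* (κ 1 :- k :* y) :* z := w :* (κ 1 :* z) :- k :* (w :* (y :* z))) refl (w l) K (p n l) (p (suc j) l)) ⟩
        g * Sum n (λ l → w l * (1# * p (suc j) l) − K * (w l * (p n l * p (suc j) l))) ≡⟨ cong (g *_) (trans (Sum-− _ _) (+-congˡ (cong -_ (Sum-*ˡ K _)))) ⟩
        g * (⟨ p 1 , p (suc j) ⟩ − K * ⟨ p n , p (suc j) ⟩)
          ≡⟨ solve 4 (λ g x k y → g :* (x :- k :* y) := g :* x :- k :* (g :* y)) refl g ⟨ p 1 , p (suc j) ⟩ K ⟨ p n , p (suc j) ⟩ ⟩
        g * ⟨ p 1 , p (suc j) ⟩ − K * (g * ⟨ p n , p (suc j) ⟩)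
          ≡⟨ cong₂ (λ y z → y − K * z) (normalised j (s≤s z≤n) j<n) (normalised j ℕP.≤-refl j<n) ⟩
        δ 1 (suc j) − K * δ n (suc j) ≡⟨ sym (S-column₀ j) ⟩
        S (suc j) 0 ∎
        where g = h (suc j) ⁻¹

      Z-row : ∀ x j → Even x → j ℕ.< n → Sum m (λ i → S (suc j) i * Z x i) ≡ ι x * (D (suc j) * Z x (suc j))
      Z-row x j ev-x j<n = begin
        Sum m (λ i → S (suc j) i * Z x i) ≡⟨ pair-Z x (S (suc j)) ⟩
        S (suc j) 0 + Sum n (λ l → τ x l * Sum m (λ i → S (suc j) i * V l i))
          ≡⟨ cong₂ _+_ (sym (border j j<n)) (Sum-cong λ l l<n → cong (τ x l *_) (V-row l j l<n j<n)) ⟩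
        g * Sum n (λ l → w l * ε l * p (suc j) l) + Sum n (λ l → τ x l * (ι l * (g * p (suc j) l))) ≡⟨ cong (_+ Sum n (λ l → τ x l * (ι l * (g * p (suc j) l)))) (sym (Sum-*ˡ g _)) ⟩
        Sum n (λ l → g * (w l * ε l * p (suc j) l)) + Sum n (λ l → τ x l * (ι l * (g * p (suc j) l))) ≡⟨ sym (Sum-+ _ _) ⟩
        Sum n (λ l → g * (w l * ε l * p (suc j) l) + τ x l * (ι l * (g * p (suc j) l)))
          ≡⟨ Sum-cong (λ l l<n → trans (cong (λ z → g * (z * p (suc j) l) + τ x l * (ι l * (g * p (suc j) l))) (sym (τ-clear x ev-x l l<n)))
               (solve 5 (λ g t x l y → g :* (t :* (x :- l) :* y) :+ t :* (l :* (g :* y)) := x :* g :* (t :* y)) refl g (τ x l) (ι x) (ι l) (p (suc j) l))) ⟩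
        Sum n (λ l → ι x * g * (τ x l * p (suc j) l)) ≡⟨ Sum-*ˡ (ι x * g) _ ⟩
        ι x * g * Sum n (λ l → τ x l * p (suc j) l) ≡⟨ cong (ι x * g *_) (sym (Z-suc x j)) ⟩
        ι x * g * Z x (suc j) ≡⟨ *-assoc _ _ _ ⟩
        ι x * (g * Z x (suc j)) ∎
        where g = h (suc j) ⁻¹

      -- The condition that the Schur complement at the vertex 0 vanishes: `ε-odd` turns its
      -- residues into a e l, so the two sides differ by a F x, which is 0 at even x. The bound
      -- includes x = n, which is not a node of the path.
      Z-row₀ : ∀ x → Even x → x ℕ.≤ n → Sum m (λ i → S 0 i * Z x i) ≡ ι x * (D 0 * Z x 0)
      Z-row₀ x ev-x x≤n = begin
        Sum m (λ i → S 0 i * Z x i) ≡⟨ pair-Z x (S 0) ⟩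
        S 0 0 + Sum n (λ l → τ x l * Sum m (λ i → S 0 i * V l i))
          ≡⟨ cong₂ _+_ S-00 (Sum-cong λ l l<n → begin
               τ x l * Sum m (λ i → S 0 i * V l i) ≡⟨ cong (τ x l *_) (V-row₀ l l<n) ⟩
               w l * ε l * (ι x − ι l) ⁻¹ * ε l ≡⟨ solve 3 (λ t i e → t :* i :* e := t :* e :* i) refl (w l * ε l) ((ι x − ι l) ⁻¹) (ε l) ⟩
               w l * ε l * ε l * (ι x − ι l) ⁻¹ ≡⟨ cong (_* (ι x − ι l) ⁻¹) (ε-odd l l<n) ⟩
               a * e l * (ι x − ι l) ⁻¹ ≡⟨ *-assoc _ _ _ ⟩
               a * (e l * (ι x − ι l) ⁻¹) ∎) ⟩
        a * b + Sum n (λ l → a * (e l * (ι x − ι l) ⁻¹)) ≡⟨ +-congˡ (Sum-*ˡ a _) ⟩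
        a * b + a * σ ≡⟨ solve 4 (λ a b s x → a :* b :+ a :* s := x :* (a :* κ 1) :- a :* (x :- b :- s)) refl a b σ (ι x) ⟩
        ι x * (a * 1#) − a * F x ≡⟨ cong₂ (λ y z → ι x * (a * y) − a * z) (sym (Z-0 x)) (F-even x ev-x x≤n) ⟩
        ι x * (a * Z x 0) − a * 0# ≡⟨ solve 2 (λ y a → y :- a :* κ 0 := y) refl (ι x * (a * Z x 0)) a ⟩
        ι x * (a * Z x 0) ∎
        where σ = Sum n (λ l → e l * (ι x − ι l) ⁻¹)

      -- Z takes the even index of each pair. For odd m the last index n is then even and gets Z n,
      -- the only eigenvector for the simple eigenvalue n; no V n exists, as the nodes end at n - 1.
      u : ℕ → ℕ → ℝ
      u c with parity c
      ... | inj₁ _ = Z (ev c)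
      ... | inj₂ _ = V (ev c)

      ev≤n : ∀ c → Even c → c ℕ.< m → ev c ℕ.≤ n
      ev≤n c evc c<m = subst (ℕ._≤ n) (sym (Even⇒ev c evc)) (ℕP.≤-pred c<m)

      ev<n : ∀ c → Odd c → c ℕ.< m → ev c ℕ.< n
      ev<n c od c<m = subst (ℕ._≤ n) (sym (Odd⇒ev c od)) (ℕP.≤-pred c<m)

      eigen : ∀ c i → c ℕ.< m → i ℕ.< m → Sum m (λ j → S i j * u c j) ≡ ι (ev c) * (D i * u c i)
      eigen c i c<m i<m with parity c
      eigen c zero c<m _ | inj₁ evc = Z-row₀ (ev c) (ev-Even c) (ev≤n c evc c<m)
      eigen c (suc i) c<m (s≤s i<n) | inj₁ _ = Z-row (ev c) i (ev-Even c) i<n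
      eigen c zero c<m _ | inj₂ od = begin
        Sum m (λ j → S 0 j * V (ev c) j) ≡⟨ V-row₀ (ev c) (ev<n c od c<m) ⟩
        ε (ev c) ≡⟨ ε-even (ev c) (ev<n c od c<m) (ev-Even c) ⟩
        0# ≡⟨ solve 2 (λ x a → κ 0 := x :* (a :* κ 0)) refl (ι (ev c)) a ⟩
        ι (ev c) * (a * 0#) ∎
      eigen c (suc i) c<m (s≤s i<n) | inj₂ od = V-row (ev c) i (ev<n c od c<m) i<n

      -- Both vectors belong to the same eigenvalue, so the pencil argument says nothing here. But Z
      -- x has no component along V x, as `τ x x` is 0 for even x, and V x vanishes at the vertex 0.
      Z-V-orthogonal : ∀ x → Even x → x ℕ.< n → Sum m (λ i → D i * (Z x i * V x i)) ≡ 0#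
      Z-V-orthogonal x ev-x x<n = begin
        Sum m (λ i → D i * (Z x i * V x i)) ≡⟨ Sum-cong (λ i _ → solve 3 (λ d z v → d :* (z :* v) := d :* v :* z) refl (D i) (Z x i) (V x i)) ⟩
        Sum m (λ i → D i * V x i * Z x i) ≡⟨ pair-Z x (λ i → D i * V x i) ⟩
        D 0 * 0# + Sum n (λ l → τ x l * Sum m (λ i → D i * V x i * V l i)) ≡⟨ cong₂ _+_ (zeroʳ (D 0)) (Sum-zero vanish) ⟩
        0# + 0# ≡⟨ +-identityˡ 0# ⟩
        0# ∎
        where
        vanish : ∀ l → l ℕ.< n → τ x l * Sum m (λ i → D i * V x i * V l i) ≡ 0#
        vanish l l<n with x ℕ.≟ l
        ... | yes refl = trans (cong (_* Sum m (λ i → D i * V x i * V l i)) (τ-even x l<n ev-x)) (zeroˡ _)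
        ... | no x≢l = trans (cong (τ x l *_) (trans (Sum-cong λ i _ → *-assoc (D i) (V x i) (V l i)) (V-orthogonal x<n l<n x≢l))) (zeroʳ _)

      u-orthogonal : ∀ c d → c ℕ.< m → d ℕ.< m → c ≢ d → Sum m (λ i → D i * (u c i * u d i)) ≡ 0#
      u-orthogonal c d c<m d<m c≢d with ev c ℕ.≟ ev d
      ... | no q = pencil-orthogonal S D (u c) (u d) S-sym (ι-≢ q)
              (λ i i<m → cong (u d i *_) (eigen c i c<m i<m)) (λ i i<m → cong (u c i *_) (eigen d i d<m i<m))
      ... | yes q with parity c | parity d
      ...   | inj₁ ec | inj₁ ed = ⊥-elim (c≢d (trans (sym (Even⇒ev c ec)) (trans q (Even⇒ev d ed))))
      ...   | inj₂ oc | inj₂ od = ⊥-elim (c≢d (trans (sym (Odd⇒ev c oc)) (trans (cong suc q) (Odd⇒ev d od))))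
      ...   | inj₁ _ | inj₂ od = subst (λ y → Sum m (λ i → D i * (Z y i * V (ev d) i)) ≡ 0#) (sym q)
                (Z-V-orthogonal (ev d) (ev-Even d) (ev<n d od d<m))
      ...   | inj₂ oc | inj₁ _ = subst (λ y → Sum m (λ i → D i * (V (ev c) i * Z y i)) ≡ 0#) q
                (trans (Sum-cong λ i _ → cong (D i *_) (*-comm (V (ev c) i) (Z (ev c) i))) (Z-V-orthogonal (ev c) (ev-Even c) (ev<n c oc c<m)))

      D-definite : ∀ (v : ℕ → ℝ) → Sum m (λ i → D i * (v i * v i)) ≡ 0# → ∀ i → i ℕ.< m → v i ≡ 0#
      D-definite v q i i<m = ≡0-stable λ vi≢0 → *-≢0 (proj₂ (D>0 i i<m)) (*-≢0 vi≢0 vi≢0)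
        (Sum-nonneg-≡0 (λ i i<m → *-nonneg (proj₁ (D>0 i i<m)) (square-nonneg (v i))) q i i<m)

      u-norm : ∀ c → c ℕ.< m → Sum m (λ i → D i * (u c i * u c i)) ≢ 0#
      u-norm c c<m q with parity c
      ... | inj₁ _ = 0≢1 (trans (sym (D-definite (Z (ev c)) q 0 (s≤s z≤n))) (Z-0 (ev c)))
      ... | inj₂ _ = 0≢1 (sym (D-definite (V (ev c)) q 1 (s≤s (s≤s z≤n))))

      pencil : CyclePencil m
      pencil = record
        { S = S ; D = D ; u = u ; S-sym = S-sym ; S-neighbour = S-neighbour ; S-other = S-other
        ; D≢0 = λ i i<m → proj₂ (D>0 i i<m) ; eigen = eigen ; u-orthogonal = u-orthogonal ; u-norm = u-norm }

  -- The choice of the weights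

  sgn-Even : ∀ l → Even l → sgn l ≡ 1#
  sgn-Even zero _ = refl
  sgn-Even (suc (suc l)) evl = trans (solve 1 (λ s → :- (:- s) := s) refl (sgn l)) (sgn-Even l evl)

  sgn-Odd : ∀ l → Odd l → sgn l ≡ - 1#
  sgn-Odd (suc l) odl = cong -_ (sgn-Even l odl)

  module Weights (M : ℕ) (M≥1 : 1 ℕ.≤ M) where
    PF : PartialFractions (suc M)
    PF = partialFractions (suc M)
    open PartialFractions PF

    β : ℕ → ℝ
    β = binomial M

    -- (1 + θ)² ≥ 4 θ for positive θ, so the equation for θ needs Y l ≥ 4, that is, a at least 4 β l
    -- / e l. The factor a is free because it scales the whole Schur complement. At even l the
    -- default inverse of e l = 0 gives a harmless bound.
    bound : ∃ λ a → Pos a × (∀ l → l ℕ.< suc M → four * β l * e l ⁻¹ ≤ᵣ a)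
    bound = upper-bound (suc M) (λ l → four * β l * e l ⁻¹)

    a : ℝ
    a = proj₁ bound

    a>0 : Pos a
    a>0 = proj₁ (proj₂ bound)

    Y θ : ℕ → ℝ
    Y l = a * e l * β l ⁻¹
    θ l = proj₁ (reciprocal-pair (Y l))

    θ>0 : ∀ l → Pos (θ l)
    θ>0 l = proj₁ (proj₂ (reciprocal-pair (Y l)))

    β>0 : ∀ l → l ℕ.≤ M → Pos (β l)
    β>0 l = binomial-Pos M l

    4≤Y : ∀ l → l ℕ.< suc M → Odd l → four ≤ᵣ Y l
    4≤Y l l<n od = ≤-by ((a − four * β l * e l ⁻¹) * (e l * β l ⁻¹))
      (*-nonneg (≤⇒0≤− (proj₂ (proj₂ bound) l l<n)) (proj₁ (Pos-* e>0 (Pos-⁻¹ b>0))))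
      (begin
        a * e l * β l ⁻¹ ≡⟨ solve 6 (λ a f b i e j → a :* e :* j :=
             f :* ((b :* j) :* (e :* i)) :+ (a :- f :* b :* i) :* (e :* j)) refl a four (β l) (e l ⁻¹) (e l) (β l ⁻¹) ⟩
        four * ((β l * β l ⁻¹) * (e l * e l ⁻¹)) + d ≡⟨ cong₂ (λ y z → four * (y * z) + d) (⁻¹-inverseʳ (proj₂ b>0)) (⁻¹-inverseʳ (proj₂ e>0)) ⟩
        four * (1# * 1#) + d ≡⟨ cong (_+ d) (solve 1 (λ f → f :* (κ 1 :* κ 1) := f) refl four) ⟩
        four + d ∎)
      where
      d = (a − four * β l * e l ⁻¹) * (e l * β l ⁻¹)
      e>0 : Pos (e l)
      e>0 = e-odd l l<n od
      b>0 : Pos (β l)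
      b>0 = β>0 l (ℕP.≤-pred l<n)

    θ-equation : ∀ l → l ℕ.< suc M → Odd l → (1# + θ l) * (1# + θ l) ≡ Y l * θ l
    θ-equation l l<n od = proj₂ (proj₂ (reciprocal-pair (Y l))) (4≤Y l l<n od)

    w : ℕ → ℝ
    w l with parity l
    ... | inj₁ _ = β l
    ... | inj₂ _ = θ l * β l

    w-Even : ∀ l → Even l → w l ≡ β l
    w-Even l evl with parity l
    ... | inj₁ _ = refl
    ... | inj₂ odl = ⊥-elim (Even⇒¬Odd {l} evl odl)

    w-Odd : ∀ l → Odd l → w l ≡ θ l * β l
    w-Odd l odl with parity l
    ... | inj₁ evl = ⊥-elim (Even⇒¬Odd {l} evl odl)
    ... | inj₂ _ = refl

    w>0 : ∀ l → l ℕ.≤ M → Pos (w l)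
    w>0 l l≤M with parity l
    ... | inj₁ _ = β>0 l l≤M
    ... | inj₂ _ = Pos-* (θ>0 l) (β>0 l l≤M)

    open Orthogonal M w w>0
    open Bordered M M≥1 w w>0 PF a a>0

    -- With the binomial weight and sign +1, `last-values` says that K p n l = 1.
    ε-Even : ∀ l → l ℕ.< n → Even l → ε l ≡ 0#
    ε-Even l l<n evl = *-cancelˡ-≡0 (proj₂ (β>0 l (ℕP.≤-pred l<n))) (begin
      β l * (1# − K * p n l) ≡⟨ solve 3 (λ b k y → b :* (κ 1 :- k :* y) := b :- k :* (b :* y)) refl (β l) K (p n l) ⟩
      β l − K * (β l * p n l) ≡⟨ cong (λ z → β l − K * (z * p n l)) (sym (w-Even l evl)) ⟩
      β l − K * (w l * p n l) ≡⟨ cong (β l −_) (last-values l l<n) ⟩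
      β l − sgn l * β l ≡⟨ cong (λ z → β l − z * β l) (sgn-Even l evl) ⟩
      β l − 1# * β l ≡⟨ solve 1 (λ b → b :- κ 1 :* b := κ 0) refl (β l) ⟩
      0# ∎)

    -- At odd nodes the sign is -1 and the weight has the extra factor θ, so K p n l = -1/θ and ε l
    -- = 1 + 1/θ.
    θε≡1+θ : ∀ l → l ℕ.< n → Odd l → θ l * ε l ≡ 1# + θ l
    θε≡1+θ l l<n odl = −≡0⇒≡ (*-cancelˡ-≡0 (proj₂ (β>0 l (ℕP.≤-pred l<n))) (begin
      β l * (θ l * (1# − K * p n l) − (1# + θ l))
        ≡⟨ solve 4 (λ b t k y → b :* (t :* (κ 1 :- k :* y) :- (κ 1 :+ t)) := :- (k :* (t :* b :* y)) :- b) refl (β l) (θ l) K (p n l) ⟩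
      - (K * (θ l * β l * p n l)) − β l ≡⟨ cong (λ z → - (K * (z * p n l)) − β l) (sym (w-Odd l odl)) ⟩
      - (K * (w l * p n l)) − β l ≡⟨ cong (λ z → - z − β l) (last-values l l<n) ⟩
      - (sgn l * β l) − β l ≡⟨ cong (λ z → - (z * β l) − β l) (sgn-Odd l odl) ⟩
      - (- 1# * β l) − β l ≡⟨ solve 1 (λ b → :- (:- κ 1 :* b) :- b := κ 0) refl (β l) ⟩
      0# ∎))

    -- At odd l the left side is β (1 + θ)² / θ = β Y, and Y was defined to make this a e l. At even
    -- l both sides vanish.
    wεε : ∀ l → l ℕ.< n → w l * ε l * ε l ≡ a * e l
    wεε l l<n with parity l
    ... | inj₁ evl = begin
      β l * ε l * ε l ≡⟨ cong (λ z → β l * z * z) (ε-Even l l<n evl) ⟩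
      β l * 0# * 0# ≡⟨ solve 2 (λ b a → b :* κ 0 :* κ 0 := a :* κ 0) refl (β l) a ⟩
      a * 0# ≡⟨ cong (a *_) (sym (e-even l evl)) ⟩
      a * e l ∎
    ... | inj₂ odl = −≡0⇒≡ (*-cancelˡ-≡0 (proj₂ (θ>0 l)) (begin
      θ l * (θ l * β l * ε l * ε l − a * e l)
        ≡⟨ solve 4 (λ t b e x → t :* (t :* b :* e :* e :- x) := b :* ((t :* e) :* (t :* e)) :- t :* x) refl (θ l) (β l) (ε l) (a * e l) ⟩
      β l * ((θ l * ε l) * (θ l * ε l)) − θ l * (a * e l) ≡⟨ cong (λ z → β l * (z * z) − θ l * (a * e l)) (θε≡1+θ l l<n odl) ⟩
      β l * ((1# + θ l) * (1# + θ l)) − θ l * (a * e l) ≡⟨ cong (λ z → β l * z − θ l * (a * e l)) (θ-equation l l<n odl) ⟩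
      β l * (a * e l * β l ⁻¹ * θ l) − θ l * (a * e l)
        ≡⟨ solve 4 (λ b x i t → b :* (x :* i :* t) :- t :* x := ((b :* i) :- κ 1) :* (t :* x)) refl (β l) (a * e l) (β l ⁻¹) (θ l) ⟩
      (β l * β l ⁻¹ − 1#) * (θ l * (a * e l)) ≡⟨ cong (λ z → (z − 1#) * (θ l * (a * e l))) (⁻¹-inverseʳ (proj₂ (β>0 l (ℕP.≤-pred l<n)))) ⟩
      (1# − 1#) * (θ l * (a * e l)) ≡⟨ solve 1 (λ x → (κ 1 :- κ 1) :* x := κ 0) refl (θ l * (a * e l)) ⟩
      0# ∎))

    cyclePencil′ : CyclePencil (suc (suc M))
    cyclePencil′ = Eigenvectors.pencil ε-Even wεε

  abstract
    cyclePencil : ∀ m → 3 ℕ.≤ m → CyclePencil m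
    cyclePencil (suc (suc M)) (s≤s (s≤s M≥1)) = Weights.cyclePencil′ M M≥1

  -- The torus

  Sum-product : ∀ {a b} (f g : ℕ → ℝ) → Sum a (λ i → Sum b (λ j → f i * g j)) ≡ Sum a f * Sum b g
  Sum-product {a} {b} f g = begin
    Sum a (λ i → Sum b (λ j → f i * g j)) ≡⟨ Sum-cong (λ i _ → trans (Sum-*ˡ (f i) g) (*-comm (f i) (Sum b g))) ⟩
    Sum a (λ i → Sum b g * f i) ≡⟨ Sum-*ˡ (Sum b g) f ⟩
    Sum b g * Sum a f ≡⟨ *-comm _ _ ⟩
    Sum a f * Sum b g ∎

  ∑-torus : ∀ n m (f : ℕ → ℕ → ℝ) → ∑ {n ℕ.* m} (λ y → f (row {n} y) (col {n} y)) ≡ Sum n (λ g → Sum m (λ h → f g h))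
  ∑-torus n m f = begin
    ∑ {n ℕ.* m} (λ y → f (row {n} y) (col {n} y)) ≡⟨ ∑-combine {n} _ ⟩
    ∑ {n} (λ i → ∑ {m} (λ j → f (row {n} (combine i j)) (col {n} (combine i j))))
      ≡⟨ ∑-cong (λ i → ∑-cong (λ j → cong₂ f (row-combine {n} i j) (col-combine {n} i j))) ⟩
    ∑ {n} (λ i → ∑ {m} (λ j → f (toℕ i) (toℕ j))) ≡⟨ ∑-cong {n} (λ i → sym (Sum≡∑ m (f (toℕ i)))) ⟩
    ∑ {n} (λ i → Sum m (f (toℕ i))) ≡⟨ sym (Sum≡∑ n _) ⟩
    Sum n (λ g → Sum m (λ h → f g h)) ∎

  module Torus {n m : ℕ} (P : CyclePencil n) (Q : CyclePencil m) where
    open CyclePencil P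
    open CyclePencil Q renaming
      ( S to S′ ; D to D′ ; u to u′ ; S-sym to S′-sym ; S-neighbour to S′-neighbour ; S-other to S′-other ; D≢0 to D′≢0
      ; eigen to eigen′ ; u-orthogonal to u′-orthogonal ; u-norm to u′-norm )

    entry : ℕ → ℕ → ℕ → ℕ → ℝ
    entry g h g′ h′ = S g g′ * (D′ h * δ h h′) − (D g * δ g g′) * S′ h h′

    A : Matrix R (n ℕ.* m)
    A x y = entry (row {n} x) (col {n} x) (row {n} y) (col {n} y)

    A-sym : ∀ x y → A x y ≡ A y x
    A-sym x y = cong₂ _−_
      (cong₂ _*_ (S-sym _ _) (δ-*-cong (col {n} x) (col {n} y) D′))
      (cong₂ _*_ (δ-*-cong (row {n} x) (row {n} y) D) (S′-sym _ _))

    entry-row : ∀ {g h h′} → h ≢ h′ → entry g h g h′ ≡ - (D g * S′ h h′)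
    entry-row {g} {h} {h′} h≢h′ = begin
      S g g * (D′ h * δ h h′) − (D g * δ g g) * S′ h h′ ≡⟨ cong₂ (λ y z → S g g * (D′ h * y) − (D g * z) * S′ h h′) (δ-≢ h≢h′) (δ-≡ {g} refl) ⟩
      S g g * (D′ h * 0#) − (D g * 1#) * S′ h h′
        ≡⟨ solve 4 (λ s d e t → s :* (d :* κ 0) :- (e :* κ 1) :* t := :- (e :* t)) refl (S g g) (D′ h) (D g) (S′ h h′) ⟩
      - (D g * S′ h h′) ∎

    entry-col : ∀ {g g′ h} → g ≢ g′ → entry g h g′ h ≡ S g g′ * D′ h
    entry-col {g} {g′} {h} g≢g′ = begin
      S g g′ * (D′ h * δ h h) − (D g * δ g g′) * S′ h h ≡⟨ cong₂ (λ y z → S g g′ * (D′ h * y) − (D g * z) * S′ h h) (δ-≡ {h} refl) (δ-≢ g≢g′) ⟩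
      S g g′ * (D′ h * 1#) − (D g * 0#) * S′ h h
        ≡⟨ solve 4 (λ s d e t → s :* (d :* κ 1) :- (e :* κ 0) :* t := s :* d) refl (S g g′) (D′ h) (D g) (S′ h h) ⟩
      S g g′ * D′ h ∎

    entry-far : ∀ {g g′ h h′} → g ≢ g′ → h ≢ h′ → entry g h g′ h′ ≡ 0#
    entry-far {g} {g′} {h} {h′} p q = begin
      S g g′ * (D′ h * δ h h′) − (D g * δ g g′) * S′ h h′ ≡⟨ cong₂ (λ y z → S g g′ * (D′ h * y) − (D g * z) * S′ h h′) (δ-≢ q) (δ-≢ p) ⟩
      S g g′ * (D′ h * 0#) − (D g * 0#) * S′ h h′
        ≡⟨ solve 4 (λ s d e t → s :* (d :* κ 0) :- (e :* κ 0) :* t := κ 0) refl (S g g′) (D′ h) (D g) (S′ h h′) ⟩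
      0# ∎

    entry-neighbour : ∀ {g h g′ h′} → g ℕ.< n → h ℕ.< m → g′ ℕ.< n → h′ ℕ.< m → ¬ (g ≡ g′ × h ≡ h′) →
      TorusNeighbour n m g h g′ h′ → entry g h g′ h′ ≢ 0#
    entry-neighbour g<n h<m _ h′<m distinct (inj₁ (refl , nb)) e =
      neg-≢0 (*-≢0 (D≢0 _ g<n) (S′-neighbour h<m h′<m nb)) (trans (sym (entry-row (λ q → distinct (refl , q)))) e)
    entry-neighbour g<n h<m g′<n _ distinct (inj₂ (refl , nb)) e =
      *-≢0 (S-neighbour g<n g′<n nb) (D′≢0 _ h<m) (trans (sym (entry-col (λ q → distinct (q , refl)))) e)

    entry-other : ∀ {g h g′ h′} → g ℕ.< n → h ℕ.< m → g′ ℕ.< n → h′ ℕ.< m → ¬ (g ≡ g′ × h ≡ h′) →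
      ¬ TorusNeighbour n m g h g′ h′ → entry g h g′ h′ ≡ 0#
    entry-other {g} {h} {g′} {h′} g<n h<m g′<n h′<m distinct ¬nb = go (g ℕ.≟ g′) (h ℕ.≟ h′)
      where
      go : Dec (g ≡ g′) → Dec (h ≡ h′) → entry g h g′ h′ ≡ 0#
      go (yes refl) (yes refl) = ⊥-elim (distinct (refl , refl))
      go (yes refl) (no q) = trans (entry-row q) (trans
        (cong (λ z → - (D g * z)) (S′-other h<m h′<m q (λ nb → ¬nb (inj₁ (refl , nb)))))
        (solve 1 (λ d → :- (d :* κ 0) := κ 0) refl (D g)))
      go (no q) (yes refl) = trans (entry-col q)
        (trans (cong (_* D′ h) (S-other g<n g′<n q (λ nb → ¬nb (inj₂ (refl , nb))))) (zeroˡ _))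
      go (no q) (no r) = entry-far q r

    A∈S : InS R (Cycle n □ Cycle m) A
    A∈S = A-sym , λ x y x≢y →
      let distinct : ¬ (row {n} x ≡ row {n} y × col {n} x ≡ col {n} y)
          distinct (p , q) = x≢y (row-col-injective {n} p q)
      in mk⇔
        (λ Axy≢0 → decidable-stable (adj (Cycle n □ Cycle m) x y BoolP.≟ true) λ ¬adj →
          Axy≢0 (entry-other (FinP.toℕ<n _) (FinP.toℕ<n _) (FinP.toℕ<n _) (FinP.toℕ<n _) distinct (¬adj ∘ neighbour⇒torusAdj {n} x y)))
        (λ adj → entry-neighbour (FinP.toℕ<n _) (FinP.toℕ<n _) (FinP.toℕ<n _) (FinP.toℕ<n _) distinct (torusAdj⇒neighbour {n} x y adj))

    v : ℕ → ℕ → Fin (n ℕ.* m) → ℝ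
    v c d y = u c (row {n} y) * u′ d (col {n} y)

    v-null : ∀ {c d} → c ℕ.< n → d ℕ.< m → ev c ≡ ev d → ∀ x → ∑ (λ y → A x y * v c d y) ≡ 0#
    v-null {c} {d} c<n d<m same x = begin
      ∑ (λ y → A x y * v c d y) ≡⟨ ∑-torus n m (λ g′ h′ → entry g h g′ h′ * (u c g′ * u′ d h′)) ⟩
      Sum n (λ g′ → Sum m (λ h′ → entry g h g′ h′ * (u c g′ * u′ d h′)))
        ≡⟨ Sum-cong (λ g′ _ → trans (Sum-cong λ h′ _ → solve 8 (λ s d z e k t a b →
             (s :* (d :* z) :- (e :* k) :* t) :* (a :* b) := (s :* a) :* (z :* (d :* b)) :- (k :* (e :* a)) :* (t :* b)) refl
             (S g g′) (D′ h) (δ h h′) (D g) (δ g g′) (S′ h h′) (u c g′) (u′ d h′)) (Sum-− _ _)) ⟩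
      Sum n (λ g′ → Sum m (λ h′ → (S g g′ * u c g′) * (δ h h′ * (D′ h * u′ d h′))) − Sum m (λ h′ → (δ g g′ * (D g * u c g′)) * (S′ h h′ * u′ d h′)))
        ≡⟨ Sum-− _ _ ⟩
      Sum n (λ g′ → Sum m (λ h′ → (S g g′ * u c g′) * (δ h h′ * (D′ h * u′ d h′)))) − Sum n (λ g′ → Sum m (λ h′ → (δ g g′ * (D g * u c g′)) * (S′ h h′ * u′ d h′)))
        ≡⟨ cong₂ _−_ (Sum-product (λ g′ → S g g′ * u c g′) (λ h′ → δ h h′ * (D′ h * u′ d h′)))
             (Sum-product (λ g′ → δ g g′ * (D g * u c g′)) (λ h′ → S′ h h′ * u′ d h′)) ⟩
      Sum n (λ g′ → S g g′ * u c g′) * Sum m (λ h′ → δ h h′ * (D′ h * u′ d h′)) − Sum n (λ g′ → δ g g′ * (D g * u c g′)) * Sum m (λ h′ → S′ h h′ * u′ d h′)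
        ≡⟨ cong₂ _−_ (cong₂ _*_ (eigen c g c<n g<n) (Sum-δ h (λ h′ → D′ h * u′ d h′) h<m))
             (cong₂ _*_ (Sum-δ g (λ g′ → D g * u c g′) g<n) (eigen′ d h d<m h<m)) ⟩
      ι (ev c) * (D g * u c g) * (D′ h * u′ d h) − (D g * u c g) * (ι (ev d) * (D′ h * u′ d h))
        ≡⟨ cong (λ z → ι z * (D g * u c g) * (D′ h * u′ d h) − (D g * u c g) * (ι (ev d) * (D′ h * u′ d h))) same ⟩
      ι (ev d) * (D g * u c g) * (D′ h * u′ d h) − (D g * u c g) * (ι (ev d) * (D′ h * u′ d h))
        ≡⟨ solve 3 (λ x y z → x :* y :* z :- y :* (x :* z) := κ 0) refl (ι (ev d)) (D g * u c g) (D′ h * u′ d h) ⟩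
      0# ∎
      where
      g = row {n} x
      h = col {n} x
      g<n : g ℕ.< n
      g<n = FinP.toℕ<n _
      h<m : h ℕ.< m
      h<m = FinP.toℕ<n _

    weight : Fin (n ℕ.* m) → ℝ
    weight y = D (row {n} y) * D′ (col {n} y)

    v-pairing : ∀ c d c′ d′ → ∑ (λ y → weight y * v c d y * v c′ d′ y) ≡
      Sum n (λ g → D g * (u c g * u c′ g)) * Sum m (λ h → D′ h * (u′ d h * u′ d′ h))
    v-pairing c d c′ d′ = begin
      ∑ (λ y → weight y * v c d y * v c′ d′ y) ≡⟨ ∑-torus n m (λ g h → D g * D′ h * (u c g * u′ d h) * (u c′ g * u′ d′ h)) ⟩
      Sum n (λ g → Sum m (λ h → D g * D′ h * (u c g * u′ d h) * (u c′ g * u′ d′ h)))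
        ≡⟨ Sum-cong (λ g _ → Sum-cong λ h _ → solve 6 (λ d e a b x y → d :* e :* (a :* b) :* (x :* y) := (d :* (a :* x)) :* (e :* (b :* y)))
             refl (D g) (D′ h) (u c g) (u′ d h) (u c′ g) (u′ d′ h)) ⟩
      Sum n (λ g → Sum m (λ h → (D g * (u c g * u c′ g)) * (D′ h * (u′ d h * u′ d′ h)))) ≡⟨ Sum-product _ _ ⟩
      Sum n (λ g → D g * (u c g * u c′ g)) * Sum m (λ h → D′ h * (u′ d h * u′ d′ h)) ∎

    module _ {k} (c d : Fin k → ℕ) (c<n : ∀ l → c l ℕ.< n) (d<m : ∀ l → d l ℕ.< m)
      (same : ∀ l → ev (c l) ≡ ev (d l)) (injective : ∀ l l′ → c l ≡ c l′ → d l ≡ d l′ → l ≡ l′) where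

      orthogonal-pair : ∀ l l′ → l ≢ l′ → ∑ (λ y → weight y * v (c l) (d l) y * v (c l′) (d l′) y) ≡ 0#
      orthogonal-pair l l′ l≢l′ = trans (v-pairing (c l) (d l) (c l′) (d l′)) (go (c l ℕ.≟ c l′))
        where
        go : Dec (c l ≡ c l′) → Sum n (λ g → D g * (u (c l) g * u (c l′) g)) * Sum m (λ h → D′ h * (u′ (d l) h * u′ (d l′) h)) ≡ 0#
        go (no q) = trans (cong (_* _) (u-orthogonal (c l) (c l′) (c<n l) (c<n l′) q)) (zeroˡ _)
        go (yes q) = trans (cong (_ *_) (u′-orthogonal (d l) (d l′) (d<m l) (d<m l′) (λ r → l≢l′ (injective l l′ q r)))) (zeroʳ _)

      -- Independence comes from orthogonality: with respect to the weight D ⊗ D′ distinct tensor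
      -- products are orthogonal and have nonzero norm, so pairing a vanishing combination with one
      -- of them isolates its coefficient.
      nullity : NullityAtLeast R A k
      nullity = (λ l → v (c l) (d l))
        , (λ l i → trans (sym (∑≡Σᶠ _)) (v-null (c<n l) (d<m l) (same l) i))
        , λ coeff zero-combination l₀ → *-cancelˡ-≡0
            (*-≢0 (u-norm (c l₀) (c<n l₀)) (u′-norm (d l₀) (d<m l₀)))
            (trans (cong (_* coeff l₀) (sym (v-pairing (c l₀) (d l₀) (c l₀) (d l₀)))) (begin
              ∑ (λ y → W l₀ y * V l₀ y) * coeff l₀
                ≡⟨ sym (∑-single l₀ (λ l l≢l₀ → trans (cong (_* coeff l) (orthogonal-pair l₀ l (l≢l₀ ∘ sym))) (zeroˡ _))) ⟩
              ∑ (λ l → ∑ (λ y → W l₀ y * V l y) * coeff l) ≡⟨ ∑-cong (λ l → sym (∑-*ʳ (coeff l) _)) ⟩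
              ∑ (λ l → ∑ (λ y → W l₀ y * V l y * coeff l)) ≡⟨ ∑-swap _ ⟩
              ∑ (λ y → ∑ (λ l → W l₀ y * V l y * coeff l))
                ≡⟨ ∑-cong (λ y → trans (∑-cong (λ l → solve 3 (λ w v c → w :* v :* c := w :* (c :* v)) refl (W l₀ y) (V l y) (coeff l)))
                     (trans (∑-*ˡ (W l₀ y) _) (trans (cong (W l₀ y *_) (trans (∑≡Σᶠ _) (zero-combination y))) (zeroʳ _)))) ⟩
              ∑ (λ (y : Fin (n ℕ.* m)) → 0#) ≡⟨ ∑-zero (λ _ → refl) ⟩
              0# ∎))
        where
        V W : Fin k → Fin (n ℕ.* m) → ℝ
        V l = v (c l) (d l)
        W l y = weight y * V l y

  -- Conclusion: both numbers of the torus

  -- A matrix of nullity at least k and a zero forcing set of size k certify each other: the set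
  -- bounds the nullity of every matrix, and the matrix bounds the size of every zero forcing set.
  both-numbers : ∀ {G k A} → InS R G A → NullityAtLeast R A k → (B : Subset (N G)) → ∣ B ∣ ≡ k → IsZeroForcingSet G B →
    MaxNullity R G k × ZeroForcingNumber G k
  both-numbers {A = A} A∈S null B size forcing =
    ((A , A∈S , null) , λ A′ A′∈S null′ → ℕP.<-irrefl (sym size) (nullity≤∣zeroForcing∣ A′∈S null′ B forcing)) ,
    ((B , size , forcing) , nullity≤∣zeroForcing∣ A∈S null)

  torus-numbers : ∀ {n m k} → 3 ℕ.≤ n → 3 ℕ.≤ m → (∀ l → l ℕ.< k → ⌊ l /2⌋ ℕ.< n) → (∀ l → l ℕ.< k → partner l ℕ.< m) →
    (B : Subset (n ℕ.* m)) → ∣ B ∣ ≡ k → IsZeroForcingSet (Cycle n □ Cycle m) B →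
    MaxNullity R (Cycle n □ Cycle m) k × ZeroForcingNumber (Cycle n □ Cycle m) k
  torus-numbers {n} {m} 3≤n 3≤m half<n partner<m = both-numbers T.A∈S
    (T.nullity (λ l → ⌊ toℕ l /2⌋) (λ l → partner (toℕ l))
      (λ l → half<n (toℕ l) (FinP.toℕ<n l)) (λ l → partner<m (toℕ l) (FinP.toℕ<n l)) (λ l → ev-partner (toℕ l))
      (λ l l′ p q → FinP.toℕ-injective (partner-injective (toℕ l) (toℕ l′) p q)))
    where module T = Torus (cyclePencil n 3≤n) (cyclePencil m 3≤m)

  numbers-odd-square : ∀ n → 3 ℕ.≤ n → Odd n →
    MaxNullity R (Cycle n □ Cycle n) (2 ℕ.* n ∸ 1) × ZeroForcingNumber (Cycle n □ Cycle n) (2 ℕ.* n ∸ 1)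
  numbers-odd-square n 3≤n odn with odd≥3 odn 3≤n
  ... | k , refl = torus-numbers 3≤n 3≤n
    (λ l l<k → half< (ℕP.<-≤-trans l<k (ℕP.m∸n≤m _ 1))) (λ l l<k → partner<-odd {n} l<k)
    (punctured (suc k ℕ.+ suc k) (k ℕ.+ suc k))
    (trans (∣punctured∣ (suc k ℕ.+ suc k) (k ℕ.+ suc k)) (sym (ℕP.+-suc (suc k ℕ.+ suc k) _)))
    (punctured-forcing k)

  numbers-otherwise : ∀ n m → 3 ℕ.≤ n → 3 ℕ.≤ m → n ℕ.< m ⊎ (m ≡ n × Even n) →
    MaxNullity R (Cycle n □ Cycle m) (2 ℕ.* n) × ZeroForcingNumber (Cycle n □ Cycle m) (2 ℕ.* n)
  numbers-otherwise n (suc (suc m)) 3≤n 3≤m cases = torus-numbers 3≤n 3≤m (λ l → half<) (partner< cases)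
    (twoColumns n m) (∣twoColumns∣ n m) (twoColumns-forcing n m)
    where
    partner< : n ℕ.< suc (suc m) ⊎ (suc (suc m) ≡ n × Even n) → ∀ l → l ℕ.< 2 ℕ.* n → partner l ℕ.< suc (suc m)
    partner< (inj₁ n<m) l = partner<-longer n<m
    partner< (inj₂ (refl , evn)) l = partner<-even evn
  numbers-otherwise n (suc zero) _ (s≤s ()) _

theorem2p6 : (R : RealField) (n m : ℕ) → 3 ≤ n → n ≤ m →
    MaxNullity R (Cycle n □ Cycle m) (theorem2p6-value n m) ×
    ZeroForcingNumber (Cycle n □ Cycle m) (theorem2p6-value n m)
theorem2p6 R n m 3≤n n≤m with isEqualOdd n m in eq
... | false = numbers-otherwise R n m 3≤n (ℕP.≤-trans 3≤n n≤m) (isEqualOdd-false n m n≤m eq)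
... | true with isEqualOdd-true n m eq
...   | refl , odn = numbers-odd-square R n 3≤n odn
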